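{- For every integer $n\ge 1$, \[\mathsf{Pop}(\mathrm{Tam}(B_n);q)=\sum_{k\ge 0}\binom{n-1}{k}\binom{n-k+1}{k}q^{n-k}.\]
   Context: For a finite lattice $M$ and $x\in M$, $\mathsf{Pop}_M(x)$ is the meet of $x$ together with all elements covered by $x$; $\mathscr{U}_M(x)$ is the set of elements covering $x$; $\mathsf{Pop}(M;q)=\sum_{b\in\mathsf{Pop}_M(M)} q^{|\mathscr{U}_M(b)|}$. Let $B_n$ be the set of permutations $x=x_1\cdots x_{2n}$ of $\{1,\dots,2n\}$ with $x_i+x_{2n+1-i}=2n+1$ for all $i$, ordered by the (right) weak order: $x\le y$ iff every pair of values $a<b$ with $b$ before $a$ in $x$ also has $b$ before $a$ in $y$. An element $x\in B_n$ contains a $312^*$ pattern if there are $i<j<k$ with $x_j<x_k<x_i$ and $x_k\ge n+1$. $\mathrm{Tam}(B_n)$ is the set of elements of $B_n$ avoiding $312^*$ patterns, with the order induced from the weak order on $B_n$ (the type $B$ Tamari lattice); covers and meets are taken in this lattice. -}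

module Defs where

open import Data.Bool using (Bool; true; false; _∧_; _∨_; not; if_then_else_)
open import Data.Nat using (ℕ; zero; suc; _+_; _*_; _∸_; _≡ᵇ_; _<ᵇ_; _≤ᵇ_)
open import Data.Nat.Combinatorics using (_C_)
open import Data.List using (List; []; _∷_; map; concatMap; filterᵇ; length; reverse; zipWith; upTo; foldr)
open import Data.Bool.ListAction using (all; any)
open import Data.Nat.ListAction using (sum)
open import Data.List.Properties using (≡-dec)
import Data.Nat as N
open import Relation.Nullary.Decidable using (⌊_⌋)

insertAll : ℕ → List ℕ → List (List ℕ)
insertAll x []       = (x ∷ []) ∷ []
insertAll x (y ∷ ys) = (x ∷ y ∷ ys) ∷ map (y ∷_) (insertAll x ys)

perms : List ℕ → List (List ℕ)
perms []       = [] ∷ []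
perms (x ∷ xs) = concatMap (insertAll x) (perms xs)

oneTo : ℕ → List ℕ
oneTo m = map suc (upTo m)

eqW : List ℕ → List ℕ → Bool
eqW x y = ⌊ ≡-dec N._≟_ x y ⌋

-- x_i + x_{2n+1-i} = 2n+1 for all i  (x_{2n+1-i} is the i-th entry of reverse x)
symmetric : ℕ → List ℕ → Bool
symmetric n x = all (λ s → s ≡ᵇ suc (2 * n)) (zipWith _+_ x (reverse x))

B : ℕ → List (List ℕ)
B n = filterᵇ (symmetric n) (perms (oneTo (2 * n)))

before : ℕ → ℕ → List ℕ → Bool
before b a []       = false
before b a (y ∷ ys) = if y ≡ᵇ b then any (_≡ᵇ a) ys else before b a ys

weakLeq : ℕ → List ℕ → List ℕ → Bool
weakLeq n x y =
  all (λ a → all (λ b → not (a <ᵇ b) ∨ not (before b a x) ∨ before b a y)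
                 (oneTo (2 * n)))
      (oneTo (2 * n))

pairsBelow : ℕ → ℕ → List ℕ → Bool
pairsBelow n c []       = false
pairsBelow n c (z ∷ zs) =
  any (λ w → (z <ᵇ w) ∧ (w <ᵇ c) ∧ (suc n ≤ᵇ w)) zs ∨ pairsBelow n c zs

contains312* : ℕ → List ℕ → Bool
contains312* n []       = false
contains312* n (y ∷ ys) = pairsBelow n y ys ∨ contains312* n ys

Tam : ℕ → List (List ℕ)
Tam n = filterᵇ (λ x → not (contains312* n x)) (B n)

leqT : ℕ → List ℕ → List ℕ → Bool
leqT = weakLeq

ltT : ℕ → List ℕ → List ℕ → Bool
ltT n x y = leqT n x y ∧ not (eqW x y)

coversT : ℕ → List ℕ → List ℕ → Bool
coversT n x y = ltT n x y ∧ not (any (λ z → ltT n x z ∧ ltT n z y) (Tam n))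

lowerCovers : ℕ → List ℕ → List (List ℕ)
lowerCovers n x = filterᵇ (λ z → coversT n z x) (Tam n)

upperCovers : ℕ → List ℕ → List (List ℕ)
upperCovers n x = filterᵇ (λ z → coversT n x z) (Tam n)

isMeet : ℕ → List (List ℕ) → List ℕ → Bool
isMeet n S z =
  all (λ s → leqT n z s) S ∧
  all (λ w → not (all (λ s → leqT n w s) S) ∨ leqT n w z) (Tam n)

isPopOf : ℕ → List ℕ → List ℕ → Bool
isPopOf n x z = isMeet n (x ∷ lowerCovers n x) z

inPopImage : ℕ → List ℕ → Bool
inPopImage n b = any (λ x → isPopOf n x b) (Tam n)

-- coefficient of q^j in Pop(Tam(B_n); q) = sum over b in Pop(Tam(B_n)) of q^|U(b)|
popCoeff : ℕ → ℕ → ℕ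
popCoeff n j =
  length (filterᵇ (λ b → inPopImage n b ∧ (length (upperCovers n b) ≡ᵇ j)) (Tam n))

-- coefficient of q^j in  sum_{k ≥ 0} C(n-1,k) C(n-k+1,k) q^(n-k)
-- (terms with k > n vanish since C(n-1,k) = 0 for n ≥ 1, so k ranges over 0..n)
rhsCoeff : ℕ → ℕ → ℕ
rhsCoeff n j =
  sum (map (λ k → if (n ∸ k) ≡ᵇ j then ((n ∸ 1) C k) * ((n ∸ k + 1) C k) else 0)
           (upTo (suc n)))

{-# OPTIONS --safe #-}

-- Write n + c as c and n + 1 - m as - m.  For x in Tam(B_n) let H a be the largest c such that c = a, or
-- c > a comes before a in x, and let t m be the largest c > 0 coming before - m (0 if there is none).
-- Avoidance makes these inversions intervals, so that x is the same thing as a pair (H , t) where the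
-- arcs (a , H a] are nested, the rows (0 , t m] are unions of arcs, and t is a self-conjugate partition;
-- the order is componentwise.  Thus x is a plane forest on 1 .. n, numbered in preorder, with a symmetric
-- lattice path over its roots.
--
-- An upper cover makes a node's next sibling its last child, or adds an addable rectangle to t.  Pop
-- detaches the last child of every node and removes all corners of t.  Hence b is in the image iff every
-- last sibling, and the last root of every run of equal rows of t, is a leaf, and t is not full; then b is
-- Pop of the join of its upper covers.
--
-- Cut along its runs, such a b becomes two sequences of lists of siblings, which are built by words of
-- n - 1 letters rise, stay, fall; the two ends of the lattice path contribute two more letters, stay or
-- fall.  The words that occur have k letters rise and k letters fall, where n - k is the number of upper
-- covers of b: choose the k letters rise among the first n - 1, then the k letters fall among the rest.

module Submission where

open import Defs
open import Data.Nat using (ℕ; _≤_)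
open import Relation.Binary.PropositionalEquality using (_≡_)

open import Data.Bool using (Bool; true; false; _∧_; _∨_; not; if_then_else_; T)
open import Data.Bool.ListAction using (all; any)
open import Data.Bool.Properties using (T-∧; T-∨; T-≡; T?; ∧-zeroʳ)
open import Data.Empty using (⊥; ⊥-elim)
open import Data.List using (List; []; _∷_; _++_; [_]; map; concatMap; filter; filterᵇ; length; reverse; zipWith; upTo; foldr)
open import Data.List.Membership.Propositional using (_∈_; _∉_; find; lose)
open import Data.List.Membership.Propositional.Properties
  using (∈-map⁺; ∈-map⁻; ∈-filter⁺; ∈-filter⁻; ∈-∃++; ∈-concatMap⁺; ∈-concatMap⁻; ∈-upTo⁺; ∈-upTo⁻; ∈-++⁺ˡ; ∈-++⁺ʳ; ∈-++⁻)
open import Data.List.Properties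
  using (unfold-reverse; ∷-injective; reverse-involutive; length-reverse; length-++; length-map; filter-++; map-++; map-id; map-cong-local; map-∘; upTo-∷ʳ; ≡-dec)
open import Data.List.Relation.Binary.Disjoint.Propositional using (Disjoint)
open import Data.List.Relation.Binary.Permutation.Propositional using (_↭_; ↭⇒↭ₛ; ↭-refl; ↭-sym; ↭-trans; prep; swap)
open import Data.List.Relation.Binary.Permutation.Propositional.Properties using (∈-resp-↭; ↭-empty-inv; shift; drop-∷; ↭-reverse; ↭-length)
open import Data.List.Relation.Binary.Permutation.Setoid.Properties using (Unique-resp-↭)
open import Data.List.Relation.Unary.All as All using (All; []; _∷_)
open import Data.List.Relation.Unary.All.Properties using (all⁺; all⁻)
open import Data.List.Relation.Unary.AllPairs using (AllPairs; []; _∷_)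
import Data.List.Relation.Unary.AllPairs.Properties as AllPairs
open import Data.List.Relation.Unary.Any using (here; there)
open import Data.List.Relation.Unary.Any.Properties using (any⁺; any⁻; reverse⁺)
open import Data.List.Relation.Unary.Unique.Propositional using (Unique)
import Data.List.Relation.Unary.Unique.Propositional.Properties as Unique
open import Data.Nat using (zero; suc; _+_; _*_; _∸_; _⊔_; _⊓_; _≡ᵇ_; _<ᵇ_; _≤ᵇ_; _<_; z≤n; s≤s; s≤s⁻¹; _≟_; _≤?_; _<?_)
open import Data.Nat.Combinatorics using (_C_; nCk+nC[k+1]≡[n+1]C[k+1]; k>n⇒nCk≡0)
open import Data.Nat.ListAction using (sum)
open import Data.Nat.Properties
open import Data.Nat.Tactic.RingSolver using (solve-∀)
open import Data.Product using (_×_; _,_; proj₁; proj₂; ∃-syntax; Σ)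
open import Data.Sum using (_⊎_; inj₁; inj₂; [_,_]′)
open import Data.Sum.Properties using (inj₁-injective; inj₂-injective)
open import Function using (_∘_; id; Equivalence)
open import Relation.Binary.Definitions using (tri<; tri≈; tri>)
import Relation.Binary.PropositionalEquality as ≡
open import Relation.Binary.PropositionalEquality using (_≢_; refl; sym; trans; cong; cong₂; subst; subst₂)
open import Relation.Nullary using (¬_; Dec; yes; no; contradiction)
open import Relation.Nullary.Decidable using (_×-dec_; _⊎-dec_; ¬?; toWitness; fromWitness)

open Equivalence using (to; from)

-- The shape of the image has one cause. The arcs and rows of Pop X are unions of arcs of X, while
-- every arc of X with more than one point loses its last child in Pop X. If a last sibling of Pop X
-- had children, its arc would end together with an arc or row around it, and its longer arc in X
-- would have no room there. If `t` were full in Pop X, it would be full in X, where the square over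
-- the last root is a corner, which Pop removes. The exponent comes from the same picture. A node
-- can absorb its next sibling unless it is the last of its list, and there is one list for every
-- inner node and every run; each north run in turn offers one addable rectangle. So n exceeds the
-- number of upper covers by the number of inner nodes plus that of east runs, and these are what
-- the letters rise create. Equality of rises and falls expresses the alternation of east and north
-- runs. The functions in `Data` matter only on 1 .. n, so objects are compared by mutual `⊑` and
-- matched by relations.

∈-tail : ∀ {A : Set} {x y : A} {ys} → x ∈ y ∷ ys → x ≢ y → x ∈ ys
∈-tail (here x≡y)   x≢y = contradiction x≡y x≢y
∈-tail (there x∈ys) _   = x∈ys

head∉ : ∀ {A : Set} {y : A} {ys} → Unique (y ∷ ys) → y ∉ ys
head∉ (y# ∷ _) y∈ys = All.lookup y# y∈ys refl

-- Positions in lists without repetition.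

data Precedes {A : Set} (b a : A) : List A → Set where
  here  : ∀ {ys} → a ∈ ys → Precedes b a (b ∷ ys)
  there : ∀ {y ys} → Precedes b a ys → Precedes b a (y ∷ ys)

module _ {A : Set} where

  precedes-∈ˡ : ∀ {a b : A} {xs} → Precedes b a xs → b ∈ xs
  precedes-∈ˡ (here _)  = here refl
  precedes-∈ˡ (there p) = there (precedes-∈ˡ p)

  precedes-∈ʳ : ∀ {a b : A} {xs} → Precedes b a xs → a ∈ xs
  precedes-∈ʳ (here a∈) = there a∈
  precedes-∈ʳ (there p) = there (precedes-∈ʳ p)

  precedes-total : ∀ {a b : A} {xs} → b ∈ xs → a ∈ xs → a ≢ b → Precedes b a xs ⊎ Precedes a b xs
  precedes-total (here refl) a∈          a≢b = inj₁ (here (∈-tail a∈ a≢b))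
  precedes-total (there b∈)  (here refl) a≢b = inj₂ (here b∈)
  precedes-total (there b∈)  (there a∈)  a≢b with precedes-total b∈ a∈ a≢b
  ... | inj₁ p = inj₁ (there p)
  ... | inj₂ p = inj₂ (there p)

  precedes-trans : ∀ {a b c : A} {xs} → Unique xs → Precedes c b xs → Precedes b a xs → Precedes c a xs
  precedes-trans u        (here b∈) (here a∈) = here a∈
  precedes-trans u        (here b∈) (there q) = here (precedes-∈ʳ q)
  precedes-trans u        (there p) (here a∈) = contradiction (precedes-∈ʳ p) (head∉ u)
  precedes-trans (_ ∷ u)  (there p) (there q) = there (precedes-trans u p q)

  precedes-irrefl : ∀ {a : A} {xs} → Unique xs → ¬ Precedes a a xs
  precedes-irrefl u       (here a∈) = head∉ u a∈
  precedes-irrefl (_ ∷ u) (there p) = precedes-irrefl u p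

  precedes-asym : ∀ {a b : A} {xs} → Unique xs → Precedes b a xs → ¬ Precedes a b xs
  precedes-asym u p q = precedes-irrefl u (precedes-trans u p q)

  allPairs-precedes : ∀ {R : A → A → Set} {a b xs} → AllPairs R xs → Precedes b a xs → R b a
  allPairs-precedes (r ∷ _)  (here a∈) = All.lookup r a∈
  allPairs-precedes (_ ∷ rs) (there p) = allPairs-precedes rs p

  precedes-allPairs : ∀ {R : A → A → Set} xs → (∀ {a b} → Precedes b a xs → R b a) → AllPairs R xs
  precedes-allPairs []       _ = []
  precedes-allPairs (x ∷ xs) f = All.tabulate (λ a∈ → f (here a∈)) ∷ precedes-allPairs xs (λ p → f (there p))

  -- If the heads differed, each would lie in the tail of the other list, so `R` would hold both
  -- ways. Permutations are shown equal in this way, both for antisymmetry and for the symmetry of a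
  -- sorted word.
  sorted-unique : ∀ {R : A → A → Set} → (∀ {u v} → R u v → ¬ R v u) → ∀ {xs ys} →
                  AllPairs R xs → AllPairs R ys →
                  (∀ {z} → z ∈ xs → z ∈ ys) → (∀ {z} → z ∈ ys → z ∈ xs) → xs ≡ ys
  sorted-unique asym {[]}     {[]}     _ _ _ _ = refl
  sorted-unique asym {[]}     {y ∷ ys} _ _ _ g = contradiction (g (here refl)) λ ()
  sorted-unique asym {x ∷ xs} {[]}     _ _ f _ = contradiction (f (here refl)) λ ()
  sorted-unique {R} asym {x ∷ xs} {y ∷ ys} (rx ∷ sx) (ry ∷ sy) f g = go (f (here refl)) (g (here refl))
    where
    irr : ∀ {u v} → R u v → u ≢ v
    irr r refl = asym r r
    same : x ≡ y → x ∷ xs ≡ y ∷ ys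
    same refl = cong (x ∷_) (sorted-unique asym sx sy
      (λ z∈ → ∈-tail (f (there z∈)) (λ z≡ → irr (All.lookup rx z∈) (sym z≡)))
      (λ z∈ → ∈-tail (g (there z∈)) (λ z≡ → irr (All.lookup ry z∈) (sym z≡))))
    go : x ∈ y ∷ ys → y ∈ x ∷ xs → x ∷ xs ≡ y ∷ ys
    go (here x≡y) _           = same x≡y
    go _          (here y≡x)  = same (sym y≡x)
    go (there x∈) (there y∈)  = contradiction (All.lookup rx y∈) (asym (All.lookup ry x∈))

  precedes-++ˡ : ∀ {a b : A} {xs} ys → Precedes b a xs → Precedes b a (xs ++ ys)
  precedes-++ˡ ys (here a∈) = here (∈-++⁺ˡ a∈)
  precedes-++ˡ ys (there p) = there (precedes-++ˡ ys p)

  precedes-∷ʳ : ∀ {a b : A} {xs} → b ∈ xs → Precedes b a (xs ++ [ a ])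
  precedes-∷ʳ {xs = x ∷ xs} (here refl) = here (∈-++⁺ʳ xs (here refl))
  precedes-∷ʳ (there b∈)  = there (precedes-∷ʳ b∈)

  precedes-reverse : ∀ {a b : A} {xs} → Precedes b a xs → Precedes a b (reverse xs)
  precedes-reverse {xs = x ∷ xs} (here a∈) =
    subst (Precedes _ _) (sym (unfold-reverse x xs)) (precedes-∷ʳ (reverse⁺ a∈))
  precedes-reverse {xs = x ∷ xs} (there p) =
    subst (Precedes _ _) (sym (unfold-reverse x xs)) (precedes-++ˡ [ x ] (precedes-reverse p))

precedes-map : ∀ {A B : Set} (f : A → B) {a b xs} → Precedes b a xs → Precedes (f b) (f a) (map f xs)
precedes-map f (here a∈) = here (∈-map⁺ f a∈)
precedes-map f (there p) = there (precedes-map f p)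

T-not⁻ : ∀ {b} → T (not b) → ¬ T b
T-not⁻ {false} _ ()

T-not⁺ : ∀ {b} → ¬ T b → T (not b)
T-not⁺ {false} _ = _
T-not⁺ {true}  f = f _

∈-any⁺ : ∀ {A : Set} (p : A → Bool) {x xs} → x ∈ xs → T (p x) → T (any p xs)
∈-any⁺ p x∈ px = any⁺ p (lose x∈ px)

∈-any⁻ : ∀ {A : Set} (p : A → Bool) {xs} → T (any p xs) → ∃[ x ] x ∈ xs × T (p x)
∈-any⁻ p {xs} t = find (any⁻ p xs t)

before⇒precedes : ∀ {b a} xs → T (before b a xs) → Precedes b a xs
before⇒precedes {b} {a} (y ∷ ys) t with y ≡ᵇ b in eq
... | false = there (before⇒precedes ys t)
... | true with refl ← ≡ᵇ⇒≡ y b (from T-≡ eq) with z , z∈ , pz ← ∈-any⁻ (_≡ᵇ a) {ys} t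
           with refl ← ≡ᵇ⇒≡ z a pz = here z∈

precedes⇒before : ∀ {b a xs} → Unique xs → Precedes b a xs → T (before b a xs)
precedes⇒before {b} {a} {y ∷ ys} u p with y ≡ᵇ b in eq | p
... | true  | here a∈ = ∈-any⁺ (_≡ᵇ a) a∈ (≡⇒≡ᵇ a a refl)
... | true  | there q with refl ← ≡ᵇ⇒≡ y b (from T-≡ eq) = contradiction (precedes-∈ˡ q) (head∉ u)
... | false | here a∈ = contradiction (trans (sym eq) (to T-≡ (≡⇒≡ᵇ y y refl))) λ ()
precedes⇒before {b} {a} {y ∷ ys} (_ ∷ u) p | false | there q = precedes⇒before u q

-- Permutations

∈-insertAll⁻ : ∀ {x zs} ys → zs ∈ insertAll x ys → zs ↭ x ∷ ys
∈-insertAll⁻ []       (here refl) = ↭-refl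
∈-insertAll⁻ (y ∷ ys) (here refl) = ↭-refl
∈-insertAll⁻ (y ∷ ys) (there zs∈) with ws , ws∈ , refl ← ∈-map⁻ (y ∷_) zs∈ =
  ↭-trans (prep y (∈-insertAll⁻ ys ws∈)) (swap y _ ↭-refl)

∈-insertAll⁺ : ∀ {x} as {bs} → as ++ x ∷ bs ∈ insertAll x (as ++ bs)
∈-insertAll⁺ []       {[]}     = here refl
∈-insertAll⁺ []       {b ∷ bs} = here refl
∈-insertAll⁺ (a ∷ as)          = there (∈-map⁺ (a ∷_) (∈-insertAll⁺ as))

∈-perms⁻ : ∀ {zs} xs → zs ∈ perms xs → zs ↭ xs
∈-perms⁻ []       (here refl) = ↭-refl
∈-perms⁻ (x ∷ xs) zs∈ with ys , ys∈ , q ← find (∈-concatMap⁻ (insertAll x) {xs = perms xs} zs∈) =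
  ↭-trans (∈-insertAll⁻ ys q) (prep x (∈-perms⁻ xs ys∈))

∈-perms⁺ : ∀ {zs} xs → zs ↭ xs → zs ∈ perms xs
∈-perms⁺ []       p with refl ← ↭-empty-inv p = here refl
∈-perms⁺ (x ∷ xs) p with as , bs , refl ← ∈-∃++ (∈-resp-↭ (↭-sym p) (here refl)) =
  ∈-concatMap⁺ (insertAll x) (lose (∈-perms⁺ xs (drop-∷ (↭-trans (↭-sym (shift x as bs)) p))) (∈-insertAll⁺ as))

-- Deleting the only `x` from `zs` returns either list. This keeps `perms` free of repetitions, so
-- that lengths of filtered lists count elements.
insertAll-injective : ∀ {x zs} ys ys′ → x ∉ ys → x ∉ ys′ →
                      zs ∈ insertAll x ys → zs ∈ insertAll x ys′ → ys ≡ ys′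
insertAll-injective []       []         _ _ _ _ = refl
insertAll-injective []       (y ∷ ys′)  _ m (here refl) (there q) with _ , _ , refl ← ∈-map⁻ (y ∷_) q =
  contradiction (here refl) m
insertAll-injective (y ∷ ys) []         m _ (there q) (here refl) with _ , _ , refl ← ∈-map⁻ (y ∷_) q =
  contradiction (here refl) m
insertAll-injective (y ∷ ys) (y′ ∷ ys′) _ _  (here refl) (here refl) = refl
insertAll-injective (y ∷ ys) (y′ ∷ ys′) _ m  (here refl) (there q) with _ , _ , refl ← ∈-map⁻ (y′ ∷_) q =
  contradiction (here refl) m
insertAll-injective (y ∷ ys) (y′ ∷ ys′) m _  (there q) (here refl) with _ , _ , refl ← ∈-map⁻ (y ∷_) q =
  contradiction (here refl) m
insertAll-injective (y ∷ ys) (y′ ∷ ys′) m m′ (there p) (there q)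
  with _ , p′ , refl ← ∈-map⁻ (y ∷_) p with _ , q′ , refl ← ∈-map⁻ (y′ ∷_) q =
  cong (y ∷_) (insertAll-injective ys ys′ (m ∘ there) (m′ ∘ there) p′ q′)

insertAll-unique : ∀ {x} ys → x ∉ ys → Unique (insertAll x ys)
insertAll-unique []       _ = [] ∷ []
insertAll-unique {x} (y ∷ ys) m =
  All.tabulate (λ q e → differ (subst (_∈ map (y ∷_) (insertAll x ys)) (sym e) q)) ∷
  Unique.map⁺ (proj₂ ∘ ∷-injective) (insertAll-unique ys (m ∘ there))
  where
  differ : x ∷ y ∷ ys ∉ map (y ∷_) (insertAll x ys)
  differ q with _ , _ , refl ← ∈-map⁻ (y ∷_) q = m (here refl)

perms-unique : ∀ xs → Unique xs → Unique (perms xs)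
perms-unique []       _ = [] ∷ []
perms-unique (x ∷ xs) u@(_ ∷ u′) = go (perms xs) (∈-perms⁻ xs) (perms-unique xs u′)
  where
  go : ∀ yss → (∀ {ys} → ys ∈ yss → ys ↭ xs) → Unique yss → Unique (concatMap (insertAll x) yss)
  go []         _ _ = []
  go (ys ∷ yss) f uu@(_ ∷ v) = Unique.++⁺ (insertAll-unique ys (x∉ (here refl))) (go yss (f ∘ there) v) disj
    where
    x∉ : ∀ {zs} → zs ∈ ys ∷ yss → x ∉ zs
    x∉ q x∈ = head∉ u (∈-resp-↭ (f q) x∈)
    disj : Disjoint (insertAll x ys) (concatMap (insertAll x) yss)
    disj (p , q) with ys′ , ys′∈ , q′ ← find (∈-concatMap⁻ (insertAll x) {xs = yss} q) =
      head∉ uu (subst (_∈ yss) (sym (insertAll-injective ys ys′ (x∉ (here refl)) (x∉ (there ys′∈)) p q′)) ys′∈)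

∈-oneTo⁺ : ∀ {m a} → 1 ≤ a → a ≤ m → a ∈ oneTo m
∈-oneTo⁺ {a = suc a} _ a≤m = ∈-map⁺ suc (∈-upTo⁺ a≤m)

∈-oneTo⁻ : ∀ {m a} → a ∈ oneTo m → 1 ≤ a × a ≤ m
∈-oneTo⁻ a∈ with i , i∈ , refl ← ∈-map⁻ suc a∈ = s≤s z≤n , ∈-upTo⁻ i∈

oneTo-unique : ∀ m → Unique (oneTo m)
oneTo-unique m = Unique.map⁺ suc-injective (Unique.upTo⁺ m)

unique-↭ : ∀ {A : Set} {xs ys : List A} → xs ↭ ys → Unique xs → Unique ys
unique-↭ {A} p = Unique-resp-↭ (≡.setoid A) (↭⇒↭ₛ p)

module _ {A B : Set} (R : A → B → Set) where

  -- Delete from `ys` a partner of the head of `xs`; injectivity of `R` keeps the partners of the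
  -- other elements in what is left.
  length-≤ : ∀ {xs ys} → Unique xs → (∀ {x} → x ∈ xs → ∃[ y ] y ∈ ys × R x y) →
             (∀ {x x′ y} → x ∈ xs → x′ ∈ xs → R x y → R x′ y → x ≡ x′) → length xs ≤ length ys
  length-≤ {[]}          _ _ _ = z≤n
  length-≤ {x ∷ xs} {ys} uu@(_ ∷ u) f inj with y , y∈ , r ← f (here refl)
                                     with as , bs , refl ← ∈-∃++ y∈ =
    subst (suc (length xs) ≤_) (↭-length (↭-sym (shift y as bs))) (s≤s (length-≤ u g (λ p q → inj (there p) (there q))))
    where
    g : ∀ {x′} → x′ ∈ xs → ∃[ y′ ] y′ ∈ as ++ bs × R x′ y′
    g x′∈ with y′ , y′∈ , r′ ← f (there x′∈) with ∈-resp-↭ (shift y as bs) y′∈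
    ... | here refl = contradiction (subst (_∈ xs) (inj (there x′∈) (here refl) r′ r) x′∈) (head∉ uu)
    ... | there q   = y′ , q , r′

length-bijection : ∀ {A B : Set} (R : A → B → Set) {xs ys} → Unique xs → Unique ys →
                   (∀ {x} → x ∈ xs → ∃[ y ] y ∈ ys × R x y) →
                   (∀ {y} → y ∈ ys → ∃[ x ] x ∈ xs × R x y) →
                   (∀ {x x′ y} → x ∈ xs → x′ ∈ xs → R x y → R x′ y → x ≡ x′) →
                   (∀ {x y y′} → y ∈ ys → y′ ∈ ys → R x y → R x y′ → y ≡ y′) →
                   length xs ≡ length ys
length-bijection R ux uy f g inj fun =
  ≤-antisym (length-≤ R ux f inj) (length-≤ (λ y x → R x y) uy g (λ p q r s → fun p q r s))

-- Pattern avoidance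

∈-pairsBelow⁻ : ∀ {n b} zs → T (pairsBelow n b zs) →
                ∃[ a ] ∃[ c ] Precedes a c zs × a < c × c < b × n < c
∈-pairsBelow⁻ {n} {b} (z ∷ zs) t with to T-∨ t
... | inj₁ u with w , w∈ , q ← ∈-any⁻ (λ w → (z <ᵇ w) ∧ (w <ᵇ b) ∧ (suc n ≤ᵇ w)) u
             with q₁ , q₂ ← to T-∧ q with q₃ , q₄ ← to T-∧ q₂ =
  z , w , here w∈ , <ᵇ⇒< z w q₁ , <ᵇ⇒< w b q₃ , ≤ᵇ⇒≤ (suc n) w q₄
... | inj₂ u with a , c , p , r ← ∈-pairsBelow⁻ zs u = a , c , there p , r

∈-pairsBelow⁺ : ∀ {n b a c zs} → Precedes a c zs → a < c → c < b → n < c → T (pairsBelow n b zs)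
∈-pairsBelow⁺ {n} {b} {a} {c} (here c∈) a<c c<b n<c = from T-∨ (inj₁
  (∈-any⁺ (λ w → (a <ᵇ w) ∧ (w <ᵇ b) ∧ (suc n ≤ᵇ w)) c∈ (from T-∧ (<⇒<ᵇ a<c , from T-∧ (<⇒<ᵇ c<b , ≤⇒≤ᵇ n<c)))))
∈-pairsBelow⁺ {n} {b} {zs = z ∷ zs} (there p) a<c c<b n<c = from
    (T-∨ {any (λ w → (z <ᵇ w) ∧ (w <ᵇ b) ∧ (suc n ≤ᵇ w)) zs}) (inj₂ (∈-pairsBelow⁺ p a<c c<b n<c))

contains⁻ : ∀ {n} xs → T (contains312* n xs) →
            ∃[ b ] ∃[ a ] ∃[ c ] Precedes b a xs × Precedes a c xs × a < c × c < b × n < c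
contains⁻ {n} (y ∷ ys) t with to T-∨ t
... | inj₁ u with a , c , p , r ← ∈-pairsBelow⁻ ys u = y , a , c , here (precedes-∈ˡ p) , there p , r
... | inj₂ u with b , a , c , p , q , r ← contains⁻ ys u = b , a , c , there p , there q , r

contains⁺ : ∀ {n b a c xs} → Unique xs → Precedes b a xs → Precedes a c xs →
            a < c → c < b → n < c → T (contains312* n xs)
contains⁺ u (here a∈) (here c∈) a<c c<b n<c = contradiction a∈ (head∉ u)
contains⁺ u (here a∈) (there q) a<c c<b n<c = from T-∨ (inj₁ (∈-pairsBelow⁺ q a<c c<b n<c))
contains⁺ u (there p) (here c∈) a<c c<b n<c = contradiction (precedes-∈ʳ p) (head∉ u)
contains⁺ {n} {xs = y ∷ ys} (_ ∷ u) (there p) (there q) a<c c<b n<c =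
  from (T-∨ {pairsBelow n y ys}) (inj₂ (contains⁺ u p q a<c c<b n<c))

-- Sorting, and largest elements below a bound.

module InsertionSort {A : Set} (P : A → Set) (R : A → A → Set) (R? : ∀ x y → Dec (R x y))
  (R-total : ∀ {x y} → P x → P y → x ≢ y → R x y ⊎ R y x)
  (R-trans : ∀ {x y z} → P x → P y → P z → R x y → R y z → R x z) where

  insert : A → List A → List A
  insert x []       = x ∷ []
  insert x (y ∷ ys) with R? x y
  ... | yes _ = x ∷ y ∷ ys
  ... | no  _ = y ∷ insert x ys

  sort : List A → List A
  sort []       = []
  sort (x ∷ xs) = insert x (sort xs)

  insert-↭ : ∀ x ys → insert x ys ↭ x ∷ ys
  insert-↭ x []       = ↭-refl
  insert-↭ x (y ∷ ys) with R? x y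
  ... | yes _ = ↭-refl
  ... | no  _ = ↭-trans (prep y (insert-↭ x ys)) (swap y x ↭-refl)

  sort-↭ : ∀ xs → sort xs ↭ xs
  sort-↭ []       = ↭-refl
  sort-↭ (x ∷ xs) = ↭-trans (insert-↭ x (sort xs)) (prep x (sort-↭ xs))

  insert-sorted : ∀ {x ys} → P x → All P ys → x ∉ ys → AllPairs R ys → AllPairs R (insert x ys)
  insert-sorted {x} {[]}     _  _          _   _         = [] ∷ []
  insert-sorted {x} {y ∷ ys} px (py ∷ pys) x∉ (ry ∷ rys) with R? x y
  ... | yes r = (r ∷ All.tabulate (λ z∈ → R-trans px py (All.lookup pys z∈) r (All.lookup ry z∈))) ∷ ry ∷ rys
  ... | no ¬r = All.tabulate (λ z∈ → below (∈-resp-↭ (insert-↭ x ys) z∈)) ∷ insert-sorted px pys (x∉ ∘ there) rys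
    where
    below : ∀ {z} → z ∈ x ∷ ys → R y z
    below (here refl) = [ (λ r → contradiction r ¬r) , id ]′ (R-total px py (λ x≡y → x∉ (here x≡y)))
    below (there z∈)  = All.lookup ry z∈

  sort-sorted : ∀ {xs} → All P xs → Unique xs → AllPairs R (sort xs)
  sort-sorted {[]}     _          _         = []
  sort-sorted {x ∷ xs} (px ∷ pxs) u@(_ ∷ v) = insert-sorted px
    (All.tabulate (λ z∈ → All.lookup pxs (∈-resp-↭ (sort-↭ xs) z∈)))
    (λ x∈ → head∉ u (∈-resp-↭ (sort-↭ xs) x∈)) (sort-sorted pxs v)

supᵇ : (ℕ → Bool) → ℕ → ℕ
supᵇ p zero    = 0
supᵇ p (suc m) = if p (suc m) then suc m else supᵇ p m

supᵇ-≤ : ∀ p m → supᵇ p m ≤ m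
supᵇ-≤ p zero    = z≤n
supᵇ-≤ p (suc m) with p (suc m)
... | true  = ≤-refl
... | false = m≤n⇒m≤1+n (supᵇ-≤ p m)

≤-supᵇ : ∀ p {m c} → c ≤ m → T (p c) → c ≤ supᵇ p m
≤-supᵇ p {zero}  c≤m pc = c≤m
≤-supᵇ p {suc m} c≤m pc with p (suc m) in eq
... | true  = c≤m
... | false with m≤n⇒m<n∨m≡n c≤m
...   | inj₁ c<  = ≤-supᵇ p (s≤s⁻¹ c<) pc
...   | inj₂ refl = contradiction (subst T eq pc) id

supᵇ-T : ∀ p m → 0 < supᵇ p m → T (p (supᵇ p m))
supᵇ-T p (suc m) 0< with p (suc m) in eq
... | true  = from T-≡ eq
... | false = supᵇ-T p m 0<

-- Pairs of arcs and rows, and their order.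

record Data : Set where
  constructor ⟨_,_⟩
  field
    H t : ℕ → ℕ
open Data public

module Poset (n : ℕ) where

  In : ℕ → Set
  In a = 1 ≤ a × a ≤ n

  -- Row m consists of the cells (m , c) with c ≤ `t D m`. `t-sym` makes this set of cells
  -- symmetric, which already forces the row lengths to decrease (`row≤`).
  record Valid (D : Data) : Set where
    field
      H-lower : ∀ {a} → In a → a ≤ H D a
      H-upper : ∀ {a} → In a → H D a ≤ n
      t-upper : ∀ {m} → In m → t D m ≤ n
      H-nest  : ∀ {a c} → In a → a < c → c ≤ H D a → H D c ≤ H D a
      t-nest  : ∀ {m c} → In m → 1 ≤ c → c ≤ t D m → H D c ≤ t D m
      t-sym   : ∀ {m c} → In m → 1 ≤ c → c ≤ t D m → m ≤ t D c

  infix 4 _⊑_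
  -- Values outside 1 .. n are ignored, so `⊑` is antisymmetric only up to agreement on that range.
  record _⊑_ (D E : Data) : Set where
    constructor _,_
    field
      H-mono : ∀ {a} → In a → H D a ≤ H E a
      t-mono : ∀ {m} → In m → t D m ≤ t E m
  open _⊑_ public

  ⊑-refl : ∀ {D} → D ⊑ D
  ⊑-refl = (λ _ → ≤-refl) , (λ _ → ≤-refl)

  ⊑-trans : ∀ {D E F} → D ⊑ E → E ⊑ F → D ⊑ F
  ⊑-trans p q = (λ i → ≤-trans (H-mono p i) (H-mono q i)) , (λ i → ≤-trans (t-mono p i) (t-mono q i))

-- From elements of Tam(B_n) to valid pairs.

module Encode (n : ℕ) where
  open Poset n public

  ρ : ℕ → ℕ
  ρ v = suc (2 * n) ∸ v

  2n≡ : suc (2 * n) ≡ n + suc n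
  2n≡ = trans (cong (λ k → suc (n + k)) (+-identityʳ n)) (sym (+-suc n n))

  ρ-pos : ∀ c → ρ (n + c) ≡ suc n ∸ c
  ρ-pos c = trans (cong (_∸ (n + c)) 2n≡) ([m+n]∸[m+o]≡n∸o n (suc n) c)

  ρ-neg : ∀ {m} → In m → ρ (suc n ∸ m) ≡ n + m
  ρ-neg {m} (_ , m≤n) = trans (cong (_∸ (suc n ∸ m)) 2n≡)
    (trans (+-∸-assoc n (m∸n≤m (suc n) m)) (cong (n +_) (m∸[m∸n]≡n (m≤n⇒m≤1+n m≤n))))

  ρ-involutive : ∀ {v} → v ≤ 2 * n → ρ (ρ v) ≡ v
  ρ-involutive v≤ = m∸[m∸n]≡n (m≤n⇒m≤1+n v≤)

  -- The value n + c stands for c, the value n + 1 - m for - m.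

  data Signed : ℕ → Set where
    pos : ∀ {c} → In c → Signed (n + c)
    neg : ∀ {m} → In m → Signed (suc n ∸ m)

  signed : ∀ {v} → 1 ≤ v → v ≤ 2 * n → Signed v
  signed {v} 1≤v v≤ with v ≤? n
  ... | yes v≤n = subst Signed (m∸[m∸n]≡n (m≤n⇒m≤1+n v≤n))
                    (neg (m<n⇒0<n∸m (s≤s v≤n) , ∸-monoʳ-≤ (suc n) 1≤v))
  ... | no  v≰n = subst Signed (m+[n∸m]≡n (<⇒≤ (≰⇒> v≰n)))
                    (pos (m<n⇒0<n∸m (≰⇒> v≰n) ,
                      ≤-trans (∸-monoˡ-≤ n v≤) (≤-reflexive (trans (m+n∸m≡n n (n + 0)) (+-identityʳ n)))))

  pos-≤ : ∀ {c} → In c → n + c ≤ 2 * n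
  pos-≤ (_ , c≤n) = ≤-trans (+-monoʳ-≤ n c≤n) (≤-reflexive (cong (n +_) (sym (+-identityʳ n))))

  neg-≤ : ∀ {m} → In m → suc n ∸ m ≤ n
  neg-≤ (1≤m , _) = ∸-monoʳ-≤ (suc n) 1≤m

  -- `avoid` is pattern avoidance read positively: behind `a`, the value `c` would complete a
  -- pattern. Hence among the values above both `a` and n, those that precede `a` are closed
  -- downwards.
  record Tamari (x : List ℕ) : Set where
    field
      perm  : x ↭ oneTo (2 * n)
      symm  : reverse x ≡ map ρ x
      avoid : ∀ {a b c} → a < c → c < b → n < c → c ∈ x → Precedes b a x → Precedes c a x

    unique : Unique x
    unique = unique-↭ (↭-sym perm) (oneTo-unique (2 * n))

    range : ∀ {v} → v ∈ x → 1 ≤ v × v ≤ 2 * n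
    range v∈ = ∈-oneTo⁻ (∈-resp-↭ perm v∈)

    member : ∀ {v} → 1 ≤ v → v ≤ 2 * n → v ∈ x
    member 1≤v v≤ = ∈-resp-↭ (↭-sym perm) (∈-oneTo⁺ 1≤v v≤)

    map-ρρ : map ρ (map ρ x) ≡ x
    map-ρρ = trans (sym (map-∘ x)) (trans
        (map-cong-local (All.tabulate (λ v∈ → ρ-involutive (proj₂ (range v∈))))) (map-id x))

    flip : ∀ {u v} → Precedes v u x → Precedes (ρ u) (ρ v) x
    flip {u} {v} p = subst (Precedes _ _) map-ρρ
      (precedes-map ρ (subst (Precedes u v) symm (precedes-reverse p)))

    pos∈ : ∀ {c} → In c → n + c ∈ x
    pos∈ {c} ic@(1≤c , _) = member (≤-trans 1≤c (m≤n+m c n)) (pos-≤ ic)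

  map-ρ-reverse : ∀ xs ys → All (_≡ suc (2 * n)) (zipWith _+_ xs ys) → length ys ≡ length xs → ys ≡ map ρ xs
  map-ρ-reverse []       []       _        _ = refl
  map-ρ-reverse (x ∷ xs) (y ∷ ys) (e ∷ es) l =
    cong₂ _∷_ (trans (sym (m+n∸m≡n x y)) (cong (_∸ x) e)) (map-ρ-reverse xs ys es (suc-injective l))

  zip-ρ : ∀ xs → All (_≤ 2 * n) xs → All (_≡ suc (2 * n)) (zipWith _+_ xs (map ρ xs))
  zip-ρ []       _          = []
  zip-ρ (x ∷ xs) (x≤ ∷ xs≤) = m+[n∸m]≡n (m≤n⇒m≤1+n x≤) ∷ zip-ρ xs xs≤

  tamari⁻ : ∀ {x} → x ∈ Tam n → Tamari x
  tamari⁻ {x} x∈ with x∈B , av ← ∈-filter⁻ (T? ∘ (λ x → not (contains312* n x))) {xs = B n} x∈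
                 with x∈P , sy ← ∈-filter⁻ (T? ∘ symmetric n) {xs = perms (oneTo (2 * n))} x∈B = record
    { perm = pm
    ; symm = map-ρ-reverse x (reverse x) (All.map (≡ᵇ⇒≡ _ _) (all⁺ (λ s → s ≡ᵇ suc (2 * n)) _ sy)) (length-reverse x)
    ; avoid = λ a<c c<b n<c c∈ p → [ id , (λ q → contradiction (contains⁺ u p q a<c c<b n<c) (T-not⁻ av)) ]′
                (precedes-total c∈ (precedes-∈ʳ p) (<⇒≢ a<c))
    }
    where
    pm = ∈-perms⁻ (oneTo (2 * n)) x∈P
    u = unique-↭ (↭-sym pm) (oneTo-unique (2 * n))

  tamari⁺ : ∀ {x} → Tamari x → x ∈ Tam n
  tamari⁺ {x} tm = ∈-filter⁺ (T? ∘ (λ x → not (contains312* n x)))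
    (∈-filter⁺ (T? ∘ symmetric n) (∈-perms⁺ (oneTo (2 * n)) perm)
      (all⁻ (λ s → s ≡ᵇ suc (2 * n)) (All.map (≡⇒≡ᵇ _ _)
        (subst (λ y → All (_≡ suc (2 * n)) (zipWith _+_ x y)) (sym symm)
          (zip-ρ x (All.tabulate (proj₂ ∘ range)))))))
    (T-not⁺ λ t → let b , a , c , p , q , a<c , c<b , n<c = contains⁻ x t in
      precedes-asym unique (avoid a<c c<b n<c (precedes-∈ʳ q) p) q)
    where open Tamari tm

  Tam-unique : Unique (Tam n)
  Tam-unique = Unique.filter⁺ (T? ∘ (λ x → not (contains312* n x)))
    (Unique.filter⁺ (T? ∘ symmetric n) (perms-unique (oneTo (2 * n)) (oneTo-unique (2 * n))))

  -- The supremum is 0 if nothing precedes, and it may be attained by a value below `a`; the maximum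
  -- with `a` covers both cases. For `t` the default 0 is the empty row.
  encode : List ℕ → Data
  encode x = ⟨ (λ a → a ⊔ supᵇ (λ c → before (n + c) (n + a) x) n)
             , (λ m → supᵇ (λ c → before (n + c) (suc n ∸ m) x) n) ⟩

  module _ {x : List ℕ} (tm : Tamari x) where
    open Tamari tm

    private
      sup-H sup-t : ℕ → ℕ
      sup-H a = supᵇ (λ c → before (n + c) (n + a) x) n
      sup-t m = supᵇ (λ c → before (n + c) (suc n ∸ m) x) n

      -- Avoidance enters here: the value at the supremum precedes `u`, and by `avoid` so does every
      -- smaller positive value above `u`.
      sup⁻ : ∀ u {c} → u < n + c → In c → c ≤ supᵇ (λ c → before (n + c) u x) n → Precedes (n + c) u x
      sup⁻ u {c} u<c ic@(1≤c , _) c≤ with m≤n⇒m<n∨m≡n c≤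
      ... | inj₂ c≡ = subst (λ c → Precedes (n + c) u x) (sym c≡) p
        where p = before⇒precedes x (supᵇ-T (λ c → before (n + c) u x) n (≤-trans 1≤c c≤))
      ... | inj₁ c< = avoid u<c (+-monoʳ-< n c<) (≤-trans (≤-reflexive (+-comm 1 n)) (+-monoʳ-≤ n 1≤c)) (pos∈ ic) p
        where p = before⇒precedes x (supᵇ-T (λ c → before (n + c) u x) n (≤-trans 1≤c c≤))

      sup⁺ : ∀ u {c} → In c → Precedes (n + c) u x → c ≤ supᵇ (λ c → before (n + c) u x) n
      sup⁺ u (_ , c≤n) p = ≤-supᵇ (λ c → before (n + c) u x) c≤n (precedes⇒before unique p)

    neg<pos : ∀ {m c} → In m → In c → suc n ∸ m < n + c
    neg<pos im (1≤c , _) = ≤-trans (s≤s (neg-≤ im)) (≤-trans (≤-reflexive (+-comm 1 n)) (+-monoʳ-≤ n 1≤c))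

    H⁻ : ∀ {a c} → a < c → c ≤ n → c ≤ H (encode x) a → Precedes (n + c) (n + a) x
    H⁻ {a} {c} a<c c≤n c≤H with ⊔-sel a (sup-H a)
    ... | inj₁ e = contradiction (≤-trans c≤H (≤-reflexive e)) (<⇒≱ a<c)
    ... | inj₂ e = sup⁻ (n + a) (+-monoʳ-< n a<c) (≤-trans (s≤s z≤n) a<c , c≤n) (≤-trans c≤H (≤-reflexive e))

    H⁺ : ∀ {a c} → In c → Precedes (n + c) (n + a) x → c ≤ H (encode x) a
    H⁺ {a} ic p = ≤-trans (sup⁺ (n + a) ic p) (m≤n⊔m a (sup-H a))

    t⁻ : ∀ {m c} → In m → In c → c ≤ t (encode x) m → Precedes (n + c) (suc n ∸ m) x
    t⁻ {m} im ic c≤ = sup⁻ (suc n ∸ m) (neg<pos im ic) ic c≤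

    t⁺ : ∀ {m c} → In c → Precedes (n + c) (suc n ∸ m) x → c ≤ t (encode x) m
    t⁺ {m} ic p = sup⁺ (suc n ∸ m) ic p

    private
      H-up : ∀ {a} → In a → H (encode x) a ≤ n
      H-up {a} (_ , a≤n) = ⊔-lub a≤n (supᵇ-≤ _ n)

      t-up : ∀ {m} → In m → t (encode x) m ≤ n
      t-up {m} _ = supᵇ-≤ _ n

    -- Nesting is transitivity of precedence (`H c` precedes c, which precedes a or - m), and
    -- `t-sym` is the symmetry of `x`.
    encode-valid : Valid (encode x)
    encode-valid = record
      { H-lower = λ {a} _ → m≤m⊔n a (sup-H a)
      ; H-upper = H-up
      ; t-upper = t-up
      ; H-nest = H-n
      ; t-nest = t-n
      ; t-sym = λ {m} {c} im 1≤c c≤ → let ic = 1≤c , ≤-trans c≤ (t-up im) in t⁺ {c} im (flipped im ic (t⁻ im ic c≤))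
      }
      where
      flipped : ∀ {m c} → In m → In c → Precedes (n + c) (suc n ∸ m) x → Precedes (n + m) (suc n ∸ c) x
      flipped {m} {c} im _ p = subst₂ (λ v u → Precedes v u x) (ρ-neg im) (ρ-pos c) (flip p)
      H-n : ∀ {a c} → In a → a < c → c ≤ H (encode x) a → H (encode x) c ≤ H (encode x) a
      H-n {a} {c} ia a<c c≤ with m≤n⇒m<n∨m≡n (m≤m⊔n c (sup-H c))
      ... | inj₂ e = ≤-trans (≤-reflexive (sym e)) c≤
      ... | inj₁ c< = H⁺ (≤-trans (s≤s z≤n) c< , H-up ic)
                         (precedes-trans unique (H⁻ c< (H-up ic) ≤-refl) (H⁻ a<c (proj₂ ic) c≤))
        where ic = ≤-trans (s≤s z≤n) a<c , ≤-trans c≤ (H-up ia)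
      t-n : ∀ {m c} → In m → 1 ≤ c → c ≤ t (encode x) m → H (encode x) c ≤ t (encode x) m
      t-n {m} {c} im 1≤c c≤ with m≤n⇒m<n∨m≡n (m≤m⊔n c (sup-H c))
      ... | inj₂ e = ≤-trans (≤-reflexive (sym e)) c≤
      ... | inj₁ c< = t⁺ {m} (≤-trans (s≤s z≤n) c< , H-up ic)
                         (precedes-trans unique (H⁻ c< (H-up ic) ≤-refl) (t⁻ im ic c≤))
        where ic = 1≤c , ≤-trans c≤ (t-up im)

  weakLeq⁺ : ∀ {x y} → Unique y → (∀ {u v} → u < v → Precedes v u x → Precedes v u y) → T (weakLeq n x y)
  weakLeq⁺ {x} {y} uy f = all⁻ outer {xs = oneTo (2 * n)} (All.tabulate λ {a} _ → all⁻ (inner a) {xs = oneTo (2 * n)} (All.tabulate λ {b} _ → go a b))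
    where
    inner : ℕ → ℕ → Bool
    inner a b = not (a <ᵇ b) ∨ not (before b a x) ∨ before b a y
    outer : ℕ → Bool
    outer a = all (inner a) (oneTo (2 * n))
    go : ∀ a b → T (not (a <ᵇ b) ∨ not (before b a x) ∨ before b a y)
    go a b with a <ᵇ b in e
    ... | false = _
    ... | true with before b a x in e′
    ...   | false = _
    ...   | true = precedes⇒before uy (f (<ᵇ⇒< a b (from T-≡ e)) (before⇒precedes x (from T-≡ e′)))

  weakLeq⁻ : ∀ {x y u v} → T (weakLeq n x y) → u ∈ oneTo (2 * n) → v ∈ oneTo (2 * n) → u < v →
             Unique x → Precedes v u x → Precedes v u y
  weakLeq⁻ {x} {y} {u} {v} l u∈ v∈ u<v ux p = go
      (All.lookup (all⁺ _ (oneTo (2 * n)) (All.lookup (all⁺ _ (oneTo (2 * n)) l) u∈)) v∈)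
    where
    go : T (not (u <ᵇ v) ∨ not (before v u x) ∨ before v u y) → Precedes v u y
    go s with to (T-∨ {not (u <ᵇ v)}) s
    ... | inj₁ q = contradiction (<⇒<ᵇ u<v) (T-not⁻ q)
    ... | inj₂ q with to (T-∨ {not (before v u x)}) q
    ...   | inj₁ r = contradiction (precedes⇒before ux p) (T-not⁻ r)
    ...   | inj₂ r = before⇒precedes y r

  -- Only the extreme inversions need to be carried over: `H a` before a, and `t m` before - m.
  leq⇒⊑ : ∀ {x y} → Tamari x → Tamari y → T (leqT n x y) → encode x ⊑ encode y
  leq⇒⊑ {x} {y} tx ty l = (λ {a} ia → hh ia) , (λ {m} im → tt im)
    where
    module X = Tamari tx
    module Y = Tamari ty
    vx = encode-valid tx
    imp : ∀ {u v} → u < v → Precedes v u x → Precedes v u y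
    imp u<v p = weakLeq⁻ l (∈-resp-↭ X.perm (precedes-∈ʳ p)) (∈-resp-↭ X.perm (precedes-∈ˡ p)) u<v X.unique p
    hh : ∀ {a} → In a → H (encode x) a ≤ H (encode y) a
    hh {a} ia with m≤n⇒m<n∨m≡n (Valid.H-lower vx ia)
    ... | inj₂ e = ≤-trans (≤-reflexive (sym e)) (Valid.H-lower (encode-valid ty) ia)
    ... | inj₁ a< = H⁺ ty (≤-trans (proj₁ ia) (<⇒≤ a<) , Valid.H-upper vx ia)
                      (imp (+-monoʳ-< n a<) (H⁻ tx a< (Valid.H-upper vx ia) ≤-refl))
    tt : ∀ {m} → In m → t (encode x) m ≤ t (encode y) m
    tt {m} im with t (encode x) m in e
    ... | zero = z≤n
    ... | suc k = t⁺ ty {m} ic (imp (neg<pos tx im ic) (t⁻ tx im ic (≤-reflexive (sym e))))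
      where ic = s≤s z≤n , subst (_≤ n) e (Valid.t-upper vx im)

  -- An inversion of two positive values is controlled by `H`, one of a positive and a negative
  -- value by `t`; one of two negative values is reflected to two positive ones.
  ⊑⇒leq : ∀ {x y} → Tamari x → Tamari y → encode x ⊑ encode y → T (leqT n x y)
  ⊑⇒leq {x} {y} tx ty l = weakLeq⁺ {x} Y.unique imp
    where
    module X = Tamari tx
    module Y = Tamari ty
    imp : ∀ {u v} → u < v → Precedes v u x → Precedes v u y
    go : ∀ {u v} → Signed u → Signed v → u < v → Precedes v u x → Precedes v u y
    go (pos {a} ia) (pos {c} ic) u<v p =
      H⁻ ty (+-cancelˡ-< n a c u<v) (proj₂ ic) (≤-trans (H⁺ tx ic p) (H-mono l ia))
    go (neg {m} im) (pos ic) u<v p = t⁻ ty im ic (≤-trans (t⁺ tx {m} ic p) (t-mono l im))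
    go (pos ia) (neg im) u<v p = contradiction u<v (<-asym (neg<pos ty im ia))
    go (neg {m} im) (neg {k} ik) u<v p = subst₂ (λ v u → Precedes v u y) (ρ-pos k) (ρ-pos m)
      (Y.flip (go (pos ik) (pos im) (+-monoʳ-< n (∸-cancelˡ-< u<v)) (subst₂ (λ v u → Precedes v u x) (ρ-neg im)
          (ρ-neg ik) (X.flip p))))
      where
      ∸-cancelˡ-< : suc n ∸ m < suc n ∸ k → k < m
      ∸-cancelˡ-< lt = ≰⇒> λ m≤k → <⇒≱ lt (∸-monoʳ-≤ (suc n) m≤k)
    imp u<v p = let ru = X.range (precedes-∈ʳ p) ; rv = X.range (precedes-∈ˡ p) in
      go (signed (proj₁ ru) (proj₂ ru)) (signed (proj₁ rv) (proj₂ rv)) u<v p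

  -- A pair in increasing order in `x` cannot be inverted in `y`, since by the second hypothesis it
  -- would be inverted in `x`. So all precedences agree, and they determine the list.
  ⊑-antisym-perm : ∀ {x y} → Tamari x → Tamari y → encode x ⊑ encode y → encode y ⊑ encode x → x ≡ y
  ⊑-antisym-perm {x} {y} tx ty l l′ =
    sorted-unique {R = λ v u → Precedes v u y} (precedes-asym Y.unique)
      (precedes-allPairs x imp) (precedes-allPairs y id)
      (λ z∈ → Y.member (proj₁ (X.range z∈)) (proj₂ (X.range z∈)))
      (λ z∈ → X.member (proj₁ (Y.range z∈)) (proj₂ (Y.range z∈)))
    where
    module X = Tamari tx
    module Y = Tamari ty
    in-range : ∀ {v} → v ∈ x → v ∈ oneTo (2 * n)
    in-range = ∈-resp-↭ X.perm
    imp : ∀ {u v} → Precedes v u x → Precedes v u y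
    imp {u} {v} p with <-cmp u v
    ... | tri< u<v _ _ = weakLeq⁻ (⊑⇒leq tx ty l) (in-range (precedes-∈ʳ p)) (in-range (precedes-∈ˡ p)) u<v X.unique p
    ... | tri≈ _ refl _ = contradiction p (precedes-irrefl X.unique)
    ... | tri> _ _ v<u = [ id , (λ q → contradiction
              (weakLeq⁻ (⊑⇒leq ty tx l′) (in-range (precedes-∈ˡ p)) (in-range (precedes-∈ʳ p)) v<u Y.unique q)
              (precedes-asym X.unique p)) ]′
            (precedes-total (mem (precedes-∈ˡ p)) (mem (precedes-∈ʳ p)) (<⇒≢ v<u ∘ sym))
      where
      mem : ∀ {z} → z ∈ x → z ∈ y
      mem z∈ = Y.member (proj₁ (X.range z∈)) (proj₂ (X.range z∈))

-- From valid pairs back to permutations.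

module Realise (n : ℕ) where
  open Encode n public

  data Val : Set where
    pos neg : ℕ → Val

  InVal : Val → Set
  InVal (pos c) = In c
  InVal (neg m) = In m

  val : ℕ → Val
  val v with v ≤? n
  ... | yes _ = neg (suc n ∸ v)
  ... | no  _ = pos (v ∸ n)

  val-pos : ∀ {c} → In c → val (n + c) ≡ pos c
  val-pos {c} (1≤c , _) with n + c ≤? n
  ... | yes le = contradiction (≤-trans (≤-reflexive (+-comm 1 n)) (≤-trans (+-monoʳ-≤ n 1≤c) le)) 1+n≰n
  ... | no  _  = cong pos (m+n∸m≡n n c)

  val-neg : ∀ {m} → In m → val (suc n ∸ m) ≡ neg m
  val-neg {m} im with suc n ∸ m ≤? n
  ... | yes _ = cong neg (m∸[m∸n]≡n (m≤n⇒m≤1+n (proj₂ im)))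
  ... | no ≰  = contradiction (neg-≤ im) ≰

  module _ {D : Data} (V : Valid D) where
    open Valid V

    -- The first alternative is an inversion; in the second the smaller value `c` comes first
    -- because `a` lies beyond its arc.
    PosPrec : ℕ → ℕ → Set
    PosPrec c a = (a < c × c ≤ H D a) ⊎ (c < a × H D c < a)

    Prec : Val → Val → Set
    Prec (pos c) (pos a) = PosPrec c a
    Prec (pos c) (neg m) = c ≤ t D m
    Prec (neg m) (pos c) = t D m < c
    Prec (neg m) (neg k) = PosPrec k m

    posPrec? : ∀ c a → Dec (PosPrec c a)
    posPrec? c a = (a <? c ×-dec c ≤? H D a) ⊎-dec (c <? a ×-dec H D c <? a)

    prec? : ∀ x y → Dec (Prec x y)
    prec? (pos c) (pos a) = posPrec? c a
    prec? (pos c) (neg m) = c ≤? t D m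
    prec? (neg m) (pos c) = t D m <? c
    prec? (neg m) (neg k) = posPrec? k m

    posPrec-asym : ∀ {c a} → PosPrec c a → ¬ PosPrec a c
    posPrec-asym (inj₁ (a<c , c≤H)) (inj₁ (c<a , _))   = <-asym a<c c<a
    posPrec-asym (inj₁ (a<c , c≤H)) (inj₂ (_ , H<c))   = <⇒≱ H<c c≤H
    posPrec-asym (inj₂ (c<a , H<a)) (inj₁ (_ , a≤H))   = <⇒≱ H<a a≤H
    posPrec-asym (inj₂ (c<a , H<a)) (inj₂ (a<c , _))   = <-asym a<c c<a

    prec-asym : ∀ {x y} → Prec x y → ¬ Prec y x
    prec-asym {pos c} {pos a} p q = posPrec-asym p q
    prec-asym {pos c} {neg m} p q = <⇒≱ q p
    prec-asym {neg m} {pos c} p q = <⇒≱ p q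
    prec-asym {neg m} {neg k} p q = posPrec-asym p q

    posPrec-total : ∀ {c a} → c ≢ a → PosPrec c a ⊎ PosPrec a c
    posPrec-total {c} {a} c≢a with <-cmp c a
    ... | tri≈ _ c≡a _ = contradiction c≡a c≢a
    ... | tri< c<a _ _ with H D c <? a
    ...   | yes H<a = inj₁ (inj₂ (c<a , H<a))
    ...   | no  H≮a = inj₂ (inj₁ (c<a , ≮⇒≥ H≮a))
    posPrec-total {c} {a} c≢a | tri> _ _ a<c with H D a <? c
    ...   | yes H<c = inj₂ (inj₂ (a<c , H<c))
    ...   | no  H≮c = inj₁ (inj₁ (a<c , ≮⇒≥ H≮c))

    prec-total : ∀ {x y} → x ≢ y → Prec x y ⊎ Prec y x
    prec-total {pos c} {pos a} x≢y = posPrec-total (λ e → x≢y (cong pos e))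
    prec-total {pos c} {neg m} _   = [ inj₁ , inj₂ ]′ (≤-<-connex c (t D m))
    prec-total {neg m} {pos c} _   = [ inj₂ , inj₁ ]′ (≤-<-connex c (t D m))
    prec-total {neg m} {neg k} x≢y = [ inj₂ , inj₁ ]′ (posPrec-total {m} {k} (λ e → x≢y (cong neg e)))

    posPrec-trans : ∀ {c b a} → In c → In b → In a → PosPrec c b → PosPrec b a → PosPrec c a
    posPrec-trans ic ib ia (inj₁ (b<c , c≤Hb)) (inj₁ (a<b , b≤Ha)) =
      inj₁ (<-trans a<b b<c , ≤-trans c≤Hb (H-nest ia a<b b≤Ha))
    posPrec-trans ic ib ia (inj₁ (b<c , c≤Hb)) (inj₂ (b<a , Hb<a)) =
      inj₂ (≤-<-trans c≤Hb Hb<a , ≤-<-trans (H-nest ib b<c c≤Hb) Hb<a)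
    posPrec-trans {c} {b} {a} ic ib ia (inj₂ (c<b , Hc<b)) (inj₁ (a<b , b≤Ha)) with <-cmp a c
    ... | tri< a<c _ _  = inj₁ (a<c , ≤-trans (<⇒≤ c<b) b≤Ha)
    ... | tri≈ _ refl _ = contradiction b≤Ha (<⇒≱ Hc<b)
    ... | tri> _ _ c<a with H D c <? a
    ...   | yes H<a = inj₂ (c<a , H<a)
    ...   | no  H≮a = contradiction (≤-trans b≤Ha (H-nest ic c<a (≮⇒≥ H≮a))) (<⇒≱ Hc<b)
    posPrec-trans ic ib ia (inj₂ (c<b , Hc<b)) (inj₂ (b<a , Hb<a)) =
      inj₂ (<-trans c<b b<a , <-trans Hc<b b<a)

    prec-neg : ∀ {c b m} → In c → In b → In m → PosPrec c b → b ≤ t D m → c ≤ t D m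
    prec-neg ic ib im (inj₁ (b<c , c≤Hb)) b≤t = ≤-trans c≤Hb (t-nest im (proj₁ ib) b≤t)
    prec-neg ic ib im (inj₂ (c<b , _))    b≤t = ≤-trans (<⇒≤ c<b) b≤t

    -- Positive triples use nesting of arcs. Where rows are involved, `t-sym` exchanges rows and
    -- columns until both hypotheses concern the same row or column, which is a union of arcs.
    prec-trans : ∀ {x y z} → InVal x → InVal y → InVal z → Prec x y → Prec y z → Prec x z
    prec-trans {pos c} {pos b} {pos a} ic ib ia p q = posPrec-trans ic ib ia p q
    prec-trans {pos c} {pos b} {neg m} ic ib im p q = prec-neg ic ib im p q
    prec-trans {pos c} {neg m} {pos a} ic im ia p q =
      inj₂ (≤-<-trans p q , ≤-<-trans (t-nest im (proj₁ ic) p) q)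
    prec-trans {pos c} {neg m} {neg k} ic im ik p q =
      t-sym ic (proj₁ ik) (prec-neg ik im ic q (t-sym im (proj₁ ic) p))
    prec-trans {neg m} {pos b} {pos a} im ib ia p q = ≰⇒> λ a≤t → <⇒≱ p (prec-neg ib ia im q a≤t)
    prec-trans {neg m} {pos b} {neg k} im ib ik p q =
      inj₂ (≤-<-trans k≤tb tb<m , ≤-<-trans (t-nest ib (proj₁ ik) k≤tb) tb<m)
      where
      k≤tb = t-sym ik (proj₁ ib) q
      tb<m = ≰⇒> λ m≤tb → <⇒≱ p (t-sym ib (proj₁ im) m≤tb)
    prec-trans {neg m} {neg k} {pos a} im ik ia p q = ≰⇒> λ a≤tm →
      <⇒≱ q (t-sym ia (proj₁ ik) (prec-neg ik im ia p (t-sym im (proj₁ ia) a≤tm)))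
    prec-trans {neg m} {neg k} {neg l} im ik il p q = posPrec-trans il ik im q p

    private
      Range : ℕ → Set
      Range v = 1 ≤ v × v ≤ 2 * n

      Q : ℕ → ℕ → Set
      Q u v = Prec (val u) (val v)

      in-val : ∀ {v} → Range v → InVal (val v)
      in-val (l , u) with signed l u
      ... | pos ic = subst InVal (sym (val-pos ic)) ic
      ... | neg im = subst InVal (sym (val-neg im)) im

      unval : Val → ℕ
      unval (pos c) = n + c
      unval (neg m) = suc n ∸ m

      unval-val : ∀ {v} → Range v → unval (val v) ≡ v
      unval-val (l , u) with signed l u
      ... | pos ic = cong unval (val-pos ic)
      ... | neg im = cong unval (val-neg im)

      Q-total : ∀ {u v} → Range u → Range v → u ≢ v → Q u v ⊎ Q v u
      Q-total ru rv u≢v = prec-total λ e → u≢v (trans (sym (unval-val ru)) (trans (cong unval e) (unval-val rv)))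

      -- Transitivity of `Prec` is available for values in range only, so the sort carries the
      -- predicate `Range`.
      module Sort = InsertionSort Range Q (λ u v → prec? (val u) (val v)) Q-total
        (λ {u} {v} {w} ru rv rw → prec-trans {val u} {val v} {val w} (in-val ru) (in-val rv) (in-val rw))

      range-oneTo : All Range (oneTo (2 * n))
      range-oneTo = All.tabulate ∈-oneTo⁻

    word : List ℕ
    word = Sort.sort (oneTo (2 * n))

    private
      word-↭ : word ↭ oneTo (2 * n)
      word-↭ = Sort.sort-↭ (oneTo (2 * n))

      sorted : AllPairs Q word
      sorted = Sort.sort-sorted range-oneTo (oneTo-unique (2 * n))

      word-range : ∀ {v} → v ∈ word → Range v
      word-range v∈ = ∈-oneTo⁻ (∈-resp-↭ word-↭ v∈)

      word-member : ∀ {v} → Range v → v ∈ word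
      word-member (l , u) = ∈-resp-↭ (↭-sym word-↭) (∈-oneTo⁺ l u)

      precedes⁻ : ∀ {v u} → Precedes v u word → Q v u
      precedes⁻ = allPairs-precedes sorted

      precedes⁺ : ∀ {v u} → Range v → Range u → Q v u → Precedes v u word
      precedes⁺ {v} {u} rv ru q with v ≟ u
      ... | yes refl = contradiction q (prec-asym {val v} {val v} q)
      ... | no v≢u = [ id , (λ p → contradiction (precedes⁻ p) (prec-asym {val v} {val u} q)) ]′
                     (precedes-total (word-member rv) (word-member ru) (v≢u ∘ sym))

      ρ-range : ∀ {v} → Range v → Range (ρ v)
      ρ-range (l , u) = m<n⇒0<n∸m (s≤s u) , ∸-monoʳ-≤ (suc (2 * n)) l

      pos-range : ∀ {c} → In c → Range (n + c)
      pos-range {c} ic = ≤-trans (proj₁ ic) (m≤n+m c n) , pos-≤ ic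

      neg-range : ∀ {m} → In m → Range (suc n ∸ m)
      neg-range im@(_ , m≤n) = m<n⇒0<n∸m (s≤s m≤n) , ≤-trans (neg-≤ im) (m≤m+n n (n + 0))

      opp : Val → Val
      opp (pos c) = neg c
      opp (neg m) = pos m

      val-ρ : ∀ {v} → Range v → val (ρ v) ≡ opp (val v)
      val-ρ (l , u) with signed l u
      ... | pos {c} ic = trans (cong val (ρ-pos c)) (trans (val-neg ic) (cong opp (sym (val-pos ic))))
      ... | neg {m} im = trans (cong val (ρ-neg im)) (trans (val-pos im) (cong opp (sym (val-neg im))))

      prec-opp : ∀ {x y} → InVal x → InVal y → Prec x y → Prec (opp y) (opp x)
      prec-opp {pos c} {pos a} _ _   p = p
      prec-opp {pos c} {neg m} ic im p = t-sym im (proj₁ ic) p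
      prec-opp {neg m} {pos c} im ic p = ≰⇒> λ m≤t → <⇒≱ p (t-sym ic (proj₁ im) m≤t)
      prec-opp {neg m} {neg k} _ _   p = p

      -- Negation reverses `Prec`, so both lists are sorted by `Q` and have the same elements.
      word-symm : reverse word ≡ map ρ word
      word-symm = sorted-unique {R = λ v u → Q u v} (λ {u} {v} → prec-asym {val v} {val u})
        (precedes-allPairs (reverse word)
          (λ {a} {b} p → precedes⁻ (subst (Precedes a b) (reverse-involutive word) (precedes-reverse p))))
        (AllPairs.map⁺ (precedes-allPairs word λ {a} {b} p →
          let ra = word-range (precedes-∈ʳ p) ; rb = word-range (precedes-∈ˡ p) in
          subst₂ Prec (sym (val-ρ ra)) (sym (val-ρ rb)) (prec-opp {val b} {val a} (in-val rb) (in-val ra)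
              (precedes⁻ p))))
        (λ z∈ → let rz = word-range (∈-resp-↭ (↭-reverse word) z∈) in
          subst (_∈ map ρ word) (ρ-involutive (proj₂ rz)) (∈-map⁺ ρ (word-member (ρ-range rz))))
        (λ z∈ → let y , y∈ , e = ∈-map⁻ ρ z∈ in
          ∈-resp-↭ (↭-sym (↭-reverse word)) (subst (_∈ word) (sym e) (word-member (ρ-range (word-range y∈)))))

      -- From n < c it follows that `c` and the larger `b` are positive; then `c` lies in any arc
      -- above `a`, or row of `a`, that contains `b`.
      word-avoid : ∀ {a b c} → a < c → c < b → n < c → c ∈ word → Precedes b a word → Precedes c a word
      word-avoid {a} {b} {c} a<c c<b n<c c∈ p = precedes⁺ rc ra
          (go (signed (proj₁ ra) (proj₂ ra)) (signed (proj₁ rb) (proj₂ rb)) (signed (proj₁ rc) (proj₂ rc))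
          a<c c<b n<c (precedes⁻ p))
        where
        ra = word-range (precedes-∈ʳ p)
        rb = word-range (precedes-∈ˡ p)
        rc = word-range c∈
        go : ∀ {a b c} → Signed a → Signed b → Signed c → a < c → c < b → n < c → Q b a → Q c a
        go sa sb (neg im) _ _ n<c _ = contradiction (neg-≤ im) (<⇒≱ n<c)
        go sa (neg im) (pos {c} ic) _ c<b _ _ = contradiction c<b
            (<⇒≯ (≤-<-trans (neg-≤ im) (≤-trans (≤-reflexive (+-comm 1 n)) (+-monoʳ-≤ n (proj₁ ic)))))
        go (pos {a} ia) (pos {b} ib) (pos {c} ic) a<c c<b _ q =
          subst₂ Prec (sym (val-pos ic)) (sym (val-pos ia))
              (inj₁ (a<c′ , below (subst₂ Prec (val-pos ib) (val-pos ia) q)))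
          where
          a<c′ = +-cancelˡ-< n a c a<c
          c<b′ = +-cancelˡ-< n c b c<b
          below : PosPrec b a → c ≤ H D a
          below (inj₁ (_ , b≤)) = ≤-trans (<⇒≤ c<b′) b≤
          below (inj₂ (b<a , _)) = contradiction (<-trans a<c′ c<b′) (<-asym b<a)
        go (neg {m} im) (pos {b} ib) (pos {c} ic) a<c c<b _ q =
          subst₂ Prec (sym (val-pos ic)) (sym (val-neg im))
              (≤-trans (<⇒≤ (+-cancelˡ-< n c b c<b)) (subst₂ Prec (val-pos ib) (val-neg im) q))

    word-tamari : Tamari word
    word-tamari = record { perm = word-↭ ; symm = word-symm ; avoid = word-avoid }

    private
      V′ = encode-valid word-tamari

      pp⇒H : ∀ {c a} → a < c → PosPrec c a → c ≤ H D a
      pp⇒H a<c (inj₁ (_ , c≤)) = c≤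
      pp⇒H a<c (inj₂ (c<a , _)) = contradiction a<c (<-asym c<a)

    encode-word-⊑ : encode word ⊑ D
    encode-word-⊑ = (λ ia → hh ia) , (λ im → tt im)
      where
      hh : ∀ {a} → In a → H (encode word) a ≤ H D a
      hh {a} ia with m≤n⇒m<n∨m≡n (Valid.H-lower V′ ia)
      ... | inj₂ e  = ≤-trans (≤-reflexive (sym e)) (H-lower ia)
      ... | inj₁ a< = pp⇒H a< (subst₂ Prec (val-pos ic) (val-pos ia) (precedes⁻ (H⁻ word-tamari a< (proj₂ ic) ≤-refl)))
        where ic = ≤-trans (s≤s z≤n) a< , Valid.H-upper V′ ia
      tt : ∀ {m} → In m → t (encode word) m ≤ t D m
      tt {m} im with t (encode word) m in e
      ... | zero = z≤n
      ... | suc k = subst₂ Prec (val-pos ic) (val-neg im) (precedes⁻ (t⁻ word-tamari im ic (≤-reflexive (sym e))))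
        where ic = s≤s z≤n , subst (_≤ n) e (Valid.t-upper V′ im)

    ⊑-encode-word : D ⊑ encode word
    ⊑-encode-word = (λ ia → hh ia) , (λ im → tt im)
      where
      hh : ∀ {a} → In a → H D a ≤ H (encode word) a
      hh {a} ia with m≤n⇒m<n∨m≡n (H-lower ia)
      ... | inj₂ e  = ≤-trans (≤-reflexive (sym e)) (Valid.H-lower V′ ia)
      ... | inj₁ a< = H⁺ word-tamari ic (precedes⁺ (pos-range ic) (pos-range ia)
          (subst₂ Prec (sym (val-pos ic)) (sym (val-pos ia)) (inj₁ (a< , ≤-refl))))
        where ic = ≤-trans (s≤s z≤n) a< , H-upper ia
      tt : ∀ {m} → In m → t D m ≤ t (encode word) m
      tt {m} im with t D m in e
      ... | zero = z≤n
      ... | suc k = t⁺ word-tamari {m} ic (precedes⁺ (pos-range ic) (neg-range im)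
          (subst₂ Prec (sym (val-pos ic)) (sym (val-neg im)) (≤-reflexive (sym e))))
        where ic = s≤s z≤n , subst (_≤ n) e (t-upper im)

-- Bounded search and modification of functions.

least : ∀ {P : ℕ → Set} → (∀ a → Dec (P a)) → ∀ m →
        (∃[ a ] (1 ≤ a × a ≤ m) × P a × (∀ {b} → 1 ≤ b → b < a → ¬ P b)) ⊎ (∀ {a} → 1 ≤ a → a ≤ m → ¬ P a)
least P? zero = inj₂ λ 1≤a a≤0 _ → contradiction (≤-trans 1≤a a≤0) λ ()
least P? (suc m) with least P? m
... | inj₁ (a , (1≤a , a≤m) , r) = inj₁ (a , (1≤a , m≤n⇒m≤1+n a≤m) , r)
... | inj₂ none with P? (suc m)
...   | yes p = inj₁ (suc m , (s≤s z≤n , ≤-refl) , p , λ 1≤b b< → none 1≤b (s≤s⁻¹ b<))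
...   | no ¬p = inj₂ λ {a} 1≤a a≤ → [ (λ a< → none 1≤a (s≤s⁻¹ a<)) , (λ { refl → ¬p }) ]′ (m≤n⇒m<n∨m≡n a≤)

greatest : ∀ {P : ℕ → Set} → (∀ a → Dec (P a)) → ∀ m →
           (∃[ a ] (1 ≤ a × a ≤ m) × P a × (∀ {b} → a < b → b ≤ m → ¬ P b)) ⊎ (∀ {a} → 1 ≤ a → a ≤ m → ¬ P a)
greatest P? zero = inj₂ λ 1≤a a≤0 _ → contradiction (≤-trans 1≤a a≤0) λ ()
greatest P? (suc m) with P? (suc m)
... | yes p = inj₁ (suc m , (s≤s z≤n , ≤-refl) , p , λ m<b b≤ → contradiction b≤ (<⇒≱ m<b))
... | no ¬p with greatest P? m
...   | inj₁ (a , (1≤a , a≤m) , pa , r) = inj₁ (a , (1≤a , m≤n⇒m≤1+n a≤m) , pa , λ {b} a<b b≤ →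
          [ (λ b< → r a<b (s≤s⁻¹ b<)) , (λ { refl → ¬p }) ]′ (m≤n⇒m<n∨m≡n b≤))
...   | inj₂ none = inj₂ λ {a} 1≤a a≤ → [ (λ a< → none 1≤a (s≤s⁻¹ a<)) , (λ { refl → ¬p }) ]′ (m≤n⇒m<n∨m≡n a≤)

_[_≔_] : (ℕ → ℕ) → ℕ → ℕ → ℕ → ℕ
(f [ a ≔ v ]) b with b ≟ a
... | yes _ = v
... | no  _ = f b

≔-same : ∀ f a v → (f [ a ≔ v ]) a ≡ v
≔-same f a v with a ≟ a
... | yes _ = refl
... | no ¬e = contradiction refl ¬e

≔-other : ∀ f {a} v {b} → b ≢ a → (f [ a ≔ v ]) b ≡ f b
≔-other f {a} v {b} b≢a with b ≟ a
... | yes e = contradiction e b≢a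
... | no _  = refl

raise : ∀ {P : ℕ → Set} → (∀ m → Dec (P m)) → ℕ → (ℕ → ℕ) → ℕ → ℕ
raise P? v f m with P? m
... | yes _ = v ⊔ f m
... | no  _ = f m

module _ {P : ℕ → Set} (P? : ∀ m → Dec (P m)) {v : ℕ} {f : ℕ → ℕ} {m : ℕ} where

  ≤-raise⁻ : ∀ {c} → c ≤ raise P? v f m → (P m × c ≤ v) ⊎ c ≤ f m
  ≤-raise⁻ c≤ with P? m
  ... | no _  = inj₂ c≤
  ... | yes p with ⊔-sel v (f m)
  ...   | inj₁ e = inj₁ (p , ≤-trans c≤ (≤-reflexive e))
  ...   | inj₂ e = inj₂ (≤-trans c≤ (≤-reflexive e))

  ≤-raise : ∀ {c} → c ≤ f m → c ≤ raise P? v f m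
  ≤-raise c≤ with P? m
  ... | no _  = c≤
  ... | yes _ = m≤n⇒m≤o⊔n v c≤

  ≤-raiseᵛ : ∀ {c} → P m → c ≤ v → c ≤ raise P? v f m
  ≤-raiseᵛ p c≤ with P? m
  ... | no ¬p = contradiction p ¬p
  ... | yes _ = m≤n⇒m≤n⊔o (f m) c≤

minAbove : ℕ → ℕ → List ℕ → ℕ
minAbove a top []       = top
minAbove a top (v ∷ vs) with a ≤? v
... | yes _ = v ⊓ minAbove a top vs
... | no  _ = minAbove a top vs

minAbove-≤top : ∀ a top vs → minAbove a top vs ≤ top
minAbove-≤top a top []       = ≤-refl
minAbove-≤top a top (v ∷ vs) with a ≤? v
... | yes _ = ≤-trans (m⊓n≤n v _) (minAbove-≤top a top vs)
... | no _  = minAbove-≤top a top vs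

minAbove-≤ : ∀ {a top v} vs → v ∈ vs → a ≤ v → minAbove a top vs ≤ v
minAbove-≤ {a} {top} (w ∷ vs) v∈ a≤v with a ≤? w | v∈
... | yes _  | here refl = m⊓n≤m w _
... | yes _  | there q   = ≤-trans (m⊓n≤n w _) (minAbove-≤ vs q a≤v)
... | no a≰w | here refl = contradiction a≤v a≰w
... | no _   | there q   = minAbove-≤ vs q a≤v

minAbove-∈ : ∀ {a top} vs → a ≤ top → (minAbove a top vs ∈ top ∷ vs) × a ≤ minAbove a top vs
minAbove-∈ {a} {top} []       a≤ = here refl , a≤
minAbove-∈ {a} {top} (v ∷ vs) a≤ with a ≤? v | minAbove-∈ {a} {top} vs a≤
... | no _    | here e  , l = here e , l
... | no _    | there q , l = there (there q) , l
... | yes a≤v | q , l with ⊓-sel v (minAbove a top vs)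
...   | inj₁ e = there (here e) , subst (a ≤_) (sym e) a≤v
...   | inj₂ e with q
...     | here e′ = here (trans e e′) , subst (a ≤_) (sym e) l
...     | there q′ = there (there (subst (_∈ vs) (sym e) q′)) , subst (a ≤_) (sym e) l

-- Upper covers

module Upper (n : ℕ) where
  open Realise n public

  infix 4 _⋖_
  record _⋖_ (D E : Data) : Set where
    field
      below   : D ⊑ E
      strict  : ¬ E ⊑ D
      between : ∀ {Z} → Valid Z → D ⊑ Z → Z ⊑ E → Z ⊑ D ⊎ E ⊑ Z

  -- The right ends ≥ a of arcs (d , H d] with d < a and of rows (0 , t m]; n closes the root row.
  data Row (D : Data) (a : ℕ) : ℕ → Set where
    top : Row D a n
    arc : ∀ {d} → 1 ≤ d → d < a → Row D a (H D d)
    row : ∀ {m} → In m → Row D a (t D m)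

  -- H D a is strictly below hull D a unless a is the last sibling (or last in its run of roots).
  hull : Data → ℕ → ℕ
  hull D a = minAbove a n (map (H D) (oneTo (a ∸ 1)) ++ map (t D) (oneTo n))

  module _ (D : Data) where

    hull-≤n : ∀ a → hull D a ≤ n
    hull-≤n a = minAbove-≤top a n (map (H D) (oneTo (a ∸ 1)) ++ map (t D) (oneTo n))

    hull-min : ∀ {a v} → Row D a v → a ≤ v → hull D a ≤ v
    hull-min {a} top _ = hull-≤n a
    hull-min {suc a} (arc 1≤d d<a) a≤v =
      minAbove-≤ (map (H D) (oneTo a) ++ map (t D) (oneTo n)) (∈-++⁺ˡ (∈-map⁺ (H D) (∈-oneTo⁺ 1≤d (s≤s⁻¹ d<a)))) a≤v
    hull-min {a} (row (1≤m , m≤n)) a≤v =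
      minAbove-≤ _ (∈-++⁺ʳ (map (H D) (oneTo (a ∸ 1))) (∈-map⁺ (t D) (∈-oneTo⁺ 1≤m m≤n))) a≤v

    hull-lower : ∀ {a} → In a → a ≤ hull D a
    hull-lower {a} (_ , a≤n) = proj₂ (minAbove-∈ (map (H D) (oneTo (a ∸ 1)) ++ map (t D) (oneTo n)) a≤n)

    hull-row : ∀ {a} → In a → Row D a (hull D a)
    hull-row {suc a} ia@(_ , a≤n) with proj₁ (minAbove-∈ (map (H D) (oneTo a) ++ map (t D) (oneTo n)) a≤n)
    ... | here e  = subst (Row D (suc a)) (sym e) top
    ... | there q with ∈-++⁻ (map (H D) (oneTo a)) q
    ...   | inj₁ p with d , d∈ , e ← ∈-map⁻ (H D) p =
      subst (Row D (suc a)) (sym e) (arc (proj₁ (∈-oneTo⁻ d∈)) (s≤s (proj₂ (∈-oneTo⁻ d∈))))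
    ...   | inj₂ p with m , m∈ , e ← ∈-map⁻ (t D) p = subst (Row D (suc a)) (sym e) (row (∈-oneTo⁻ m∈))

  row-weaken : ∀ {D a c v} → a ≤ c → Row D a v → Row D c v
  row-weaken a≤c top           = top
  row-weaken a≤c (arc 1≤d d<a) = arc 1≤d (<-≤-trans d<a a≤c)
  row-weaken a≤c (row im)      = row im

  module _ {D : Data} (V : Valid D) where
    open Valid V

    row-nest : ∀ {a c v} → In a → Row D a v → a ≤ c → c ≤ v → H D c ≤ v
    row-nest (1≤a , _)   top           a≤c c≤v = H-upper (≤-trans 1≤a a≤c , c≤v)
    row-nest (1≤a , a≤n) (arc 1≤d d<a) a≤c c≤v = H-nest (1≤d , <⇒≤ (<-≤-trans d<a a≤n)) (<-≤-trans d<a a≤c) c≤v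
    row-nest (1≤a , _)   (row im)      a≤c c≤v = t-nest im (≤-trans 1≤a a≤c) c≤v

    hull-nest : ∀ {a c v} → Row D a v → a ≤ c → c ≤ v → hull D c ≤ v
    hull-nest r a≤c c≤v = hull-min D (row-weaken a≤c r) c≤v

    H≤hull : ∀ {a} → In a → H D a ≤ hull D a
    H≤hull ia = row-nest ia (hull-row D ia) ≤-refl (hull-lower D ia)

  HSlot : Data → ℕ → Set
  HSlot D a = hull D a ≢ H D a

  -- Of an addable rectangle and its transpose only the one with corner (x , y), y ≤ x, is listed; y
  -- is `suc (t D x)`, and the second condition is the other half of `Addable`.
  TSlot : Data → ℕ → Set
  TSlot D x = t D x < x × suc (t D (suc (t D x))) ≡ x

  -- (x , y) is the corner of a rectangle which, with its transpose, can be added to t.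
  Addable : Data → ℕ → ℕ → Set
  Addable D x y = suc (t D x) ≡ y × suc (t D y) ≡ x

  swap-addable : ∀ {D x y} → Addable D x y → Addable D y x
  swap-addable (p , q) = q , p

  -- In preorder the next sibling of `a` has the number `suc (H D a)`.
  extend : Data → ℕ → Data
  extend D a = ⟨ H D [ a ≔ H D (suc (H D a)) ] , t D ⟩

  within? : ∀ x v m → Dec (x ≤ m × m ≤ v)
  within? x v m = x ≤? m ×-dec m ≤? v

  -- Rows are unions of arcs and `t` is symmetric, so with the cell (x , y) come the whole rectangle
  -- over the arcs of `x` and `y` and its transpose.
  adjoin : Data → ℕ → ℕ → Data
  adjoin D x y = ⟨ H D , raise (within? x (H D x)) (H D y) (raise (within? y (H D y)) (H D x) (t D)) ⟩

  Cell : Data → ℕ → ℕ → ℕ → ℕ → Set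
  Cell D x y m c = c ≤ t D m ⊎ ((x ≤ m × m ≤ H D x) × c ≤ H D y) ⊎ ((y ≤ m × m ≤ H D y) × c ≤ H D x)

  module _ {D : Data} (V : Valid D) where
    open Valid V

    module _ {a : ℕ} (ia : In a) (slot : HSlot D a) where

      private
        c = suc (H D a)
        H′ = H D [ a ≔ H D c ]

      next≤hull : suc (H D a) ≤ hull D a
      next≤hull = ≤∧≢⇒< (H≤hull V ia) (slot ∘ sym)

      private
        c≤n : c ≤ n
        c≤n = ≤-trans next≤hull (hull-≤n D a)

        ic : In c
        ic = s≤s z≤n , c≤n

        a<c : a < c
        a<c = s≤s (H-lower ia)

        -- A row around `a` reaches at least to the hull, so it contains the next sibling and, being
        -- closed, the arc of that sibling.
        enclosed : ∀ {v} → Row D a v → a ≤ v → H D c ≤ v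
        enclosed r a≤v = row-nest V ia r (<⇒≤ a<c) (≤-trans next≤hull (hull-min D r a≤v))

        H′-≤ : ∀ {b v} → H D b ≤ v → (b ≡ a → H D c ≤ v) → H′ b ≤ v
        H′-≤ {b} p q with b ≟ a
        ... | yes e = q e
        ... | no _  = p

      extend-grows : H D a < H D c
      extend-grows = H-lower ic

      ⊑-extend : D ⊑ extend D a
      ⊑-extend = (λ {b} ib → grow b) , (λ _ → ≤-refl)
        where
        grow : ∀ b → H D b ≤ H′ b
        grow b with b ≟ a
        ... | yes refl = <⇒≤ extend-grows
        ... | no _     = ≤-refl

      extend-valid : Valid (extend D a)
      extend-valid = record
        { H-lower = λ ib → ≤-trans (H-lower ib) (H-mono ⊑-extend ib)
        ; H-upper = λ ib → H′-≤ (H-upper ib) (λ _ → H-upper ic)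
        ; t-upper = t-upper
        ; H-nest = nest
        ; t-nest = λ im 1≤b b≤ → H′-≤ (t-nest im 1≤b b≤) (λ { refl → enclosed (row im) b≤ })
        ; t-sym = t-sym
        }
        where
        nest : ∀ {d b} → In d → d < b → b ≤ H′ d → H′ b ≤ H′ d
        nest {d} {b} id′ d<b b≤ with d ≟ a
        ... | no _ = H′-≤ (H-nest id′ d<b b≤) (λ { refl → enclosed (arc (proj₁ id′) d<b) b≤ })
        ... | yes refl = H′-≤ inner (λ e → contradiction d<b (<-irrefl (sym e)))
          where
          inner : H D b ≤ H D c
          inner with <-cmp b c
          ... | tri< b<c _ _  = ≤-trans (H-nest id′ d<b (s≤s⁻¹ b<c)) (<⇒≤ extend-grows)
          ... | tri≈ _ refl _ = ≤-refl
          ... | tri> _ _ c<b  = H-nest ic c<b b≤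

      extend-least : ∀ {Z} → Valid Z → D ⊑ Z → H D a < H Z a → extend D a ⊑ Z
      extend-least {Z} VZ l lt = (λ {b} ib → H′-≤ (H-mono l ib) (λ { refl →
        ≤-trans (H-mono l ic) (Valid.H-nest VZ ia a<c lt) })) , t-mono l

      extend-H : H (extend D a) a ≡ H D c
      extend-H = ≔-same (H D) a (H D c)

  module _ {D : Data} (V : Valid D) where
    open Valid V

    -- Transpose the last cell of row `m`: its column contains `m`, hence `m₀`; transpose back.
    row≤ : ∀ {m m₀} → 1 ≤ m₀ → m₀ ≤ m → m ≤ n → t D m ≤ t D m₀
    row≤ {m} {m₀} 1≤m₀ m₀≤m m≤n with t D m in e
    ... | zero  = z≤n
    ... | suc k = t-sym (s≤s z≤n , ≤-trans (≤-reflexive (sym e)) (t-upper im)) 1≤m₀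
        (≤-trans m₀≤m (t-sym im (s≤s z≤n) (≤-reflexive (sym e))))
      where im = ≤-trans 1≤m₀ m₀≤m , m≤n

    -- The two nodes lie in the same rows: an arc that starts inside the arc of `a` also ends there
    -- and cannot reach the sibling.
    hull-sibling : ∀ {a} → In a → HSlot D a → hull D (suc (H D a)) ≡ hull D a
    hull-sibling {a} ia s = ≤-antisym (hull-nest V (hull-row D ia) (<⇒≤ a<c) (next≤hull V ia s))
      (go (hull-row D ic) (hull-lower D ic))
      where
      ic : In (suc (H D a))
      ic = s≤s z≤n , ≤-trans (next≤hull V ia s) (hull-≤n D a)
      a<c : a < suc (H D a)
      a<c = s≤s (H-lower ia)
      go : ∀ {v} → Row D (suc (H D a)) v → suc (H D a) ≤ v → hull D a ≤ v
      go top _ = hull-≤n D a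
      go (row im) ≤v = hull-min D (row im) (≤-trans (<⇒≤ a<c) ≤v)
      go (arc {d} 1≤d d<) ≤v with <-cmp d a
      ... | tri< d<a _ _  = hull-min D (arc 1≤d d<a) (≤-trans (<⇒≤ a<c) ≤v)
      ... | tri≈ _ refl _ = contradiction ≤v 1+n≰n
      ... | tri> _ _ a<d  = contradiction (H-nest ia a<d (s≤s⁻¹ d<)) (<⇒≱ ≤v)

    hull-child : ∀ {a} → In a → a < H D a → hull D (suc a) ≡ H D a
    hull-child {a} ia a<H = ≤-antisym (hull-min D (arc (proj₁ ia) ≤-refl) a<H) (go (hull-row D ic) (hull-lower D ic))
      where
      ic : In (suc a)
      ic = s≤s z≤n , ≤-trans a<H (H-upper ia)
      go : ∀ {v} → Row D (suc a) v → suc a ≤ v → H D a ≤ v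
      go top _ = H-upper ia
      go (row im) ≤v = t-nest im (proj₁ ia) (<⇒≤ ≤v)
      go (arc {d} 1≤d d<) ≤v with m≤n⇒m<n∨m≡n (s≤s⁻¹ d<)
      ... | inj₁ d<a  = H-nest (1≤d , <⇒≤ (<-≤-trans d<a (proj₂ ia))) d<a (<⇒≤ ≤v)
      ... | inj₂ refl = ≤-refl

    module _ {x y : ℕ} (ix : In x) (iy : In y) (ad : Addable D x y) where

      private
        t₀ = raise (within? y (H D y)) (H D x) (t D)

      ≤-adjoin⁻ : ∀ {m c} → c ≤ t (adjoin D x y) m →
                  Cell D x y m c
      ≤-adjoin⁻ c≤ with ≤-raise⁻ (within? x (H D x)) c≤
      ... | inj₁ p = inj₂ (inj₁ p)
      ... | inj₂ c≤′ with ≤-raise⁻ (within? y (H D y)) c≤′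
      ...   | inj₁ p = inj₂ (inj₂ p)
      ...   | inj₂ p = inj₁ p

      ≤-adjoin : ∀ {m c} → c ≤ t D m → c ≤ t (adjoin D x y) m
      ≤-adjoin {m} c≤ = ≤-raise (within? x (H D x)) {H D y} {t₀} {m} (≤-raise (within? y (H D y)) {H D x} {t D} {m} c≤)

      ≤-adjoinˣ : ∀ {m c} → x ≤ m → m ≤ H D x → c ≤ H D y → c ≤ t (adjoin D x y) m
      ≤-adjoinˣ {m} p q c≤ = ≤-raiseᵛ (within? x (H D x)) {H D y} {t₀} {m} (p , q) c≤

      ≤-adjoinʸ : ∀ {m c} → y ≤ m → m ≤ H D y → c ≤ H D x → c ≤ t (adjoin D x y) m
      ≤-adjoinʸ {m} p q c≤ = ≤-raise (within? x (H D x)) {H D y} {t₀} {m}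
          (≤-raiseᵛ (within? y (H D y)) {H D x} {t D} {m} (p , q) c≤)

      ⊑-adjoin : D ⊑ adjoin D x y
      ⊑-adjoin = (λ _ → ≤-refl) , (λ _ → ≤-adjoin ≤-refl)

      adjoin-cell : y ≤ t (adjoin D x y) x
      adjoin-cell = ≤-adjoinˣ ≤-refl (H-lower ix) (H-lower iy)

    -- The columns below `y` make up row `x`, which is closed, and those from `y` on lie in the arc
    -- of `y`.
    addable-nest : ∀ {x y c} → In x → In y → Addable D x y → 1 ≤ c → c ≤ H D y → H D c ≤ H D y
    addable-nest {x} {y} {c} ix iy (e , _) 1≤c c≤ with <-cmp c y
    ... | tri< c<y _ _  = ≤-trans (t-nest ix 1≤c (s≤s⁻¹ (≤-trans c<y (≤-reflexive (sym e)))))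
                            (≤-trans (n≤1+n _) (≤-trans (≤-reflexive e) (H-lower iy)))
    ... | tri≈ _ refl _ = ≤-refl
    ... | tri> _ _ y<c  = H-nest iy y<c c≤

    -- Column `c` contains `x`; being a union of arcs, it contains the whole arc of `x`.
    block-row : ∀ {x m c} → In x → m ≤ H D x → 1 ≤ c → c ≤ t D x → m ≤ t D c
    block-row {x} ix m≤ 1≤c c≤ = ≤-trans m≤ (t-nest (1≤c , ≤-trans c≤ (t-upper ix)) (proj₁ ix) (t-sym ix 1≤c c≤))

    module _ {x y : ℕ} (ix : In x) (iy : In y) (ad : Addable D x y) where

      adjoin-valid : Valid (adjoin D x y)
      adjoin-valid = record
        { H-lower = H-lower
        ; H-upper = H-upper
        ; t-upper = λ im → upper im (≤-adjoin⁻ ix iy ad ≤-refl)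
        ; H-nest = H-nest
        ; t-nest = λ im 1≤c c≤ → nest im 1≤c (≤-adjoin⁻ ix iy ad c≤)
        ; t-sym = λ im 1≤c c≤ → symm im 1≤c (≤-adjoin⁻ ix iy ad c≤)
        }
        where
        upper : ∀ {m c} → In m → Cell D x y m c → c ≤ n
        upper im (inj₁ p)              = ≤-trans p (t-upper im)
        upper im (inj₂ (inj₁ (_ , p))) = ≤-trans p (H-upper iy)
        upper im (inj₂ (inj₂ (_ , p))) = ≤-trans p (H-upper ix)
        nest : ∀ {m c} → In m → 1 ≤ c → Cell D x y m c →
               H D c ≤ t (adjoin D x y) m
        nest im 1≤c (inj₁ p)              = ≤-adjoin ix iy ad (t-nest im 1≤c p)
        nest im 1≤c (inj₂ (inj₁ ((p , q) , c≤))) = ≤-adjoinˣ ix iy ad p q (addable-nest ix iy ad 1≤c c≤)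
        nest im 1≤c (inj₂ (inj₂ ((p , q) , c≤))) = ≤-adjoinʸ ix iy ad p q
            (addable-nest iy ix (swap-addable {D} ad) 1≤c c≤)
        symm : ∀ {m c} → In m → 1 ≤ c → Cell D x y m c →
               m ≤ t (adjoin D x y) c
        symm im 1≤c (inj₁ p) = ≤-adjoin ix iy ad (t-sym im 1≤c p)
        symm {m} {c} im 1≤c (inj₂ (inj₁ ((p , q) , c≤))) with ≤-<-connex y c
        ... | inj₁ y≤c = ≤-adjoinʸ ix iy ad y≤c c≤ q
        ... | inj₂ c<y = ≤-adjoin ix iy ad (block-row ix q 1≤c (s≤s⁻¹ (≤-trans c<y (≤-reflexive (sym (proj₁ ad))))))
        symm {m} {c} im 1≤c (inj₂ (inj₂ ((p , q) , c≤))) with ≤-<-connex x c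
        ... | inj₁ x≤c = ≤-adjoinˣ ix iy ad x≤c c≤ q
        ... | inj₂ c<x = ≤-adjoin ix iy ad (block-row iy q 1≤c (s≤s⁻¹ (≤-trans c<x (≤-reflexive (sym (proj₂ ad))))))

      -- In `Z`, close the row through the cell (x , y) under arcs, transpose, and close again: this
      -- yields the whole rectangle.
      adjoin-least : ∀ {Z} → Valid Z → D ⊑ Z → y ≤ t Z x → adjoin D x y ⊑ Z
      adjoin-least {Z} VZ l y≤ = H-mono l , λ im → go im (≤-adjoin⁻ ix iy ad ≤-refl)
        where
        module Z = Valid VZ
        x≤ : x ≤ t Z y
        x≤ = Z.t-sym ix (proj₁ iy) y≤
        fill : ∀ {x y m} → In x → In y → In m → x ≤ t Z y → m ≤ H D x → H D y ≤ t Z m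
        fill ix iy im x≤ m≤ = ≤-trans (H-mono l iy) (Z.t-nest im (proj₁ iy)
          (Z.t-sym iy (proj₁ im) (≤-trans m≤ (≤-trans (H-mono l ix) (Z.t-nest iy (proj₁ ix) x≤)))))
        go : ∀ {m c} → In m → Cell D x y m c → c ≤ t Z m
        go im (inj₁ p) = ≤-trans p (t-mono l im)
        go im (inj₂ (inj₁ ((_ , q) , c≤))) = ≤-trans c≤ (fill ix iy im x≤ q)
        go im (inj₂ (inj₂ ((_ , q) , c≤))) = ≤-trans c≤ (fill iy ix im y≤ q)

    -- Distinct addable rectangles are disjoint.
    addable-corner : ∀ {x y x′ y′} → In x → In y → In x′ → In y′ → Addable D x y → Addable D x′ y′ →
                     x′ ≤ x → x ≤ H D x′ → x ≡ x′
    addable-corner {x} {y} {x′} {y′} ix iy ix′ iy′ (e , f) (e′ , f′) x′≤x x≤ with m≤n⇒m<n∨m≡n x′≤x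
    ... | inj₂ eq = sym eq
    ... | inj₁ x′<x = contradiction (≤-trans (≤-reflexive (sym e′)) (≤-trans (s≤s tx′≤tx) (≤-reflexive e))) (<⇒≱ y<y′)
      where
      y<y′ : y < y′
      y<y′ = ≤-trans (s≤s (t-sym iy (proj₁ ix′) (s≤s⁻¹ (≤-trans x′<x (≤-reflexive (sym f)))))) (≤-reflexive e′)
      tx′≤tx : t D x′ ≤ t D x
      tx′≤tx with t D x′ in eq
      ... | zero  = z≤n
      ... | suc k = t-sym (s≤s z≤n , ≤-trans (≤-reflexive (sym eq)) (t-upper ix′)) (proj₁ ix)
                      (block-row ix′ x≤ (s≤s z≤n) (≤-reflexive (sym eq)))

  data Slot (D : Data) : ℕ ⊎ ℕ → Set where
    H-slot : ∀ {a} → In a → HSlot D a → Slot D (inj₁ a)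
    T-slot : ∀ {x} → In x → TSlot D x → Slot D (inj₂ x)

  up : Data → ℕ ⊎ ℕ → Data
  up D (inj₁ a) = extend D a
  up D (inj₂ x) = adjoin D x (suc (t D x))

  module _ (D : Data) where

    T-addable : ∀ {x} → TSlot D x → Addable D x (suc (t D x))
    T-addable (_ , e) = refl , e

    T-in : ∀ {x} → In x → TSlot D x → In (suc (t D x))
    T-in ix (lt , _) = s≤s z≤n , ≤-trans lt (proj₂ ix)

  module _ {D : Data} (V : Valid D) where
    open Valid V

    up-valid : ∀ {s} → Slot D s → Valid (up D s)
    up-valid (H-slot ia p) = extend-valid V ia p
    up-valid (T-slot ix p) = adjoin-valid V ix (T-in D ix p) (T-addable D p)

    ⊑-up : ∀ {s} → Slot D s → D ⊑ up D s
    ⊑-up (H-slot ia p) = ⊑-extend V ia p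
    ⊑-up (T-slot ix p) = ⊑-adjoin V ix (T-in D ix p) (T-addable D p)

    up-injective : ∀ {s s′} → Slot D s → Slot D s′ → up D s ⊑ up D s′ → s ≡ s′
    up-injective (H-slot {a} ia p) (H-slot {a′} ia′ p′) l with a ≟ a′
    ... | yes e = cong inj₁ e
    ... | no ¬e = contradiction (subst₂ _≤_ (extend-H V ia p) (≔-other (H D) _ ¬e) (H-mono l ia))
        (<⇒≱ (extend-grows V ia p))
    up-injective (H-slot ia p) (T-slot ix q) l =
      contradiction (≤-trans (≤-reflexive (sym (extend-H V ia p))) (H-mono l ia)) (<⇒≱ (extend-grows V ia p))
    up-injective (T-slot ix q) (H-slot ia p) l =
      contradiction (≤-trans (adjoin-cell V ix (T-in D ix q) (T-addable D q)) (t-mono l ix)) 1+n≰n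
    up-injective (T-slot {x} ix q) (T-slot {x′} ix′ q′) l
      with ≤-adjoin⁻ V ix′ (T-in D ix′ q′) (T-addable D q′) (≤-trans (adjoin-cell V ix (T-in D ix q) (T-addable D q)) (t-mono l ix))
    ... | inj₁ p = contradiction p 1+n≰n
    ... | inj₂ (inj₁ ((x′≤x , x≤) , _)) =
      cong inj₂ (addable-corner V ix (T-in D ix q) ix′ (T-in D ix′ q′) (T-addable D q) (T-addable D q′) x′≤x x≤)
    -- The cell lies in the transposed rectangle, so x = y′ and y = x′. Both slots have their second
    -- coordinate at most the first, so all four numbers agree.
    ... | inj₂ (inj₂ ((y′≤x , x≤) , _)) = cong inj₂ (≤-antisym
            (≤-trans (≤-reflexive x≡y′) (proj₁ q′))
            (≤-trans (≤-reflexive (trans (sym (proj₂ q′)) (cong (suc ∘ t D) (sym x≡y′)))) (proj₁ q)))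
      where
      x≡y′ : x ≡ suc (t D x′)
      x≡y′ = addable-corner V ix (T-in D ix q) (T-in D ix′ q′) ix′ (T-addable D q)
          (swap-addable {D} (T-addable D q′)) y′≤x x≤

    -- The first row that grows from `D` to `Z` shows an addable corner; if no row grows, the first
    -- arc that grows has a next sibling to absorb.
    up-cofinal : ∀ {Z} → Valid Z → D ⊑ Z → Z ⊑ D ⊎ ∃[ s ] Slot D s × up D s ⊑ Z
    up-cofinal {Z} VZ l with least (λ m → t D m <? t Z m) n
    ... | inj₁ (m , im , lt , min) = inj₂ (corner (≤-total c m))
      where
      module Z = Valid VZ
      c = suc (t D m)
      ic : In c
      ic = s≤s z≤n , ≤-trans lt (Z.t-upper im)
      tc≡ : suc (t D c) ≡ m
      tc≡ = ≤-antisym (≰⇒> λ m≤tc → 1+n≰n (t-sym ic (proj₁ im) m≤tc)) (bound im lt min)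
        where
        bound : ∀ {m} → In m → t D m < t Z m → (∀ {b} → 1 ≤ b → b < m → ¬ t D b < t Z b) → m ≤ suc (t D (suc (t D m)))
        bound {suc zero}    _  _  _   = s≤s z≤n
        -- `Z` has a new cell in row k + 2, hence also the cell above it in row k + 1; as row k + 1
        -- does not grow, that cell belongs to `D`.
        bound {suc (suc k)} im@(_ , m≤n) lt min = s≤s (t-sym ik (s≤s z≤n) (≤-trans
          (Z.t-sym (s≤s z≤n , ≤-trans lt (Z.t-upper im)) (s≤s z≤n) (<⇒≤ (Z.t-sym im (s≤s z≤n) lt)))
              (≮⇒≥ (min (s≤s z≤n) ≤-refl))))
          where
          ik : In (suc k)
          ik = s≤s z≤n , <⇒≤ m≤n
      corner : c ≤ m ⊎ m ≤ c → ∃[ s ] Slot D s × up D s ⊑ Z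
      corner (inj₁ c≤m) = inj₂ m , T-slot im (c≤m , tc≡) , adjoin-least V im ic (refl , tc≡) VZ l lt
      corner (inj₂ m≤c) = inj₂ c , T-slot ic slot , subst (λ z → adjoin D c z ⊑ Z) (sym tc≡)
                            (adjoin-least V ic im (tc≡ , refl) VZ l (Z.t-sym im (s≤s z≤n) lt))
        where
        slot : TSlot D c
        slot = ≤-trans (≤-reflexive tc≡) m≤c , cong (suc ∘ t D) tc≡
    ... | inj₂ t≮ with least (λ a → H D a <? H Z a) n
    ...   | inj₂ H≮ = inj₁ ((λ ia → ≮⇒≥ (H≮ (proj₁ ia) (proj₂ ia))) , (λ im → ≮⇒≥ (t≮ (proj₁ im) (proj₂ im))))
    ...   | inj₁ (a , ia , lt , min) = inj₂ (inj₁ a , H-slot ia slot , extend-least V ia slot VZ l lt)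
      where
      module Z = Valid VZ
      -- An earlier arc or a row that contains `a` and ends at `H D a` would have to grow in `Z`
      -- together with the arc of `a`.
      differ : ∀ {v} → Row D a v → v ≢ H D a
      differ top e = contradiction (≤-trans lt (Z.H-upper ia)) (<⇒≱ (s≤s (≤-reflexive e)))
      differ (arc {d} 1≤d d<a) e = contradiction (≤-trans (Z.H-nest id′ d<a (≤-trans a≤ (H-mono l id′)))
          (≮⇒≥ (min 1≤d d<a))) (<⇒≱ (≤-trans (s≤s (≤-reflexive e)) lt))
        where
        id′ : In d
        id′ = 1≤d , <⇒≤ (<-≤-trans d<a (proj₂ ia))
        a≤ : a ≤ H D d
        a≤ = ≤-trans (H-lower ia) (≤-reflexive (sym e))
      differ (row {m} im) e = contradiction (≤-trans (Z.t-nest im (proj₁ ia) (≤-trans a≤ (t-mono l im)))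
          (≮⇒≥ (t≮ (proj₁ im) (proj₂ im)))) (<⇒≱ (≤-trans (s≤s (≤-reflexive e)) lt))
        where
        a≤ : a ≤ t D m
        a≤ = ≤-trans (H-lower ia) (≤-reflexive (sym e))
      slot : HSlot D a
      slot = differ (hull-row D ia)

    up-strict : ∀ {s} → Slot D s → ¬ up D s ⊑ D
    up-strict (H-slot ia p) l = contradiction (≤-trans (≤-reflexive (sym (extend-H V ia p))) (H-mono l ia))
        (<⇒≱ (extend-grows V ia p))
    up-strict (T-slot ix q) l = contradiction (≤-trans (adjoin-cell V ix (T-in D ix q) (T-addable D q))
        (t-mono l ix)) 1+n≰n

    -- What lies strictly above `D` and within `up D s` is above some `up D s′`, and `up-injective`
    -- gives s′ = s.
    up-cover : ∀ {s} → Slot D s → D ⋖ up D s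
    up-cover {s} σ = record
      { below = ⊑-up σ
      ; strict = up-strict σ
      ; between = λ {Z} VZ D⊑Z Z⊑ → go (up-cofinal VZ D⊑Z) Z⊑
      }
      where
      go : ∀ {Z} → Z ⊑ D ⊎ (∃[ s′ ] Slot D s′ × up D s′ ⊑ Z) → Z ⊑ up D s → Z ⊑ D ⊎ up D s ⊑ Z
      go (inj₁ p) _ = inj₁ p
      go {Z} (inj₂ (s′ , σ′ , l)) Z⊑ = inj₂ (subst (λ z → up D z ⊑ Z) (up-injective σ′ σ (⊑-trans l Z⊑)) l)

    cover-up : ∀ {E} → Valid E → D ⋖ E → ∃[ s ] Slot D s × E ⊑ up D s × up D s ⊑ E
    cover-up VE c with up-cofinal VE (_⋖_.below c)
    ... | inj₁ l = contradiction l (_⋖_.strict c)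
    ... | inj₂ (s , σ , l) with _⋖_.between c (up-valid σ) (⊑-up σ) l
    ...   | inj₁ l′ = contradiction l′ (up-strict σ)
    ...   | inj₂ l′ = s , σ , l′ , l

-- Lower covers and the image of Pop

cap : ∀ {P : ℕ → Set} → (∀ m → Dec (P m)) → ℕ → (ℕ → ℕ) → ℕ → ℕ
cap P? v f m with P? m
... | yes _ = v ⊓ f m
... | no  _ = f m

module _ {P : ℕ → Set} (P? : ∀ m → Dec (P m)) {v : ℕ} {f : ℕ → ℕ} {m : ℕ} where

  ≤-cap⁻ : ∀ {c} → c ≤ cap P? v f m → c ≤ f m × (P m → c ≤ v)
  ≤-cap⁻ c≤ with P? m
  ... | no ¬p = c≤ , λ p → contradiction p ¬p
  ... | yes _ = ≤-trans c≤ (m⊓n≤n v (f m)) , λ _ → ≤-trans c≤ (m⊓n≤m v (f m))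

  ≤-cap : ∀ {c} → c ≤ f m → (P m → c ≤ v) → c ≤ cap P? v f m
  ≤-cap c≤ g with P? m
  ... | no _  = c≤
  ... | yes p = ⊓-glb (g p) c≤

module Lower (n : ℕ) where
  open Upper n public

  shrink : Data → ℕ → ℕ → Data
  shrink D a v = ⟨ H D [ a ≔ v ] , t D ⟩

  -- Removes the cells (m , c) with m > i and c > j, and their transposes.
  cut : Data → ℕ → ℕ → Data
  cut D i j = ⟨ H D , cap (i <?_) j (cap (j <?_) i (t D)) ⟩

  Closed : Data → ℕ → Set
  Closed D v = ∀ {c} → 1 ≤ c → c ≤ v → H D c ≤ v

  module _ {X : Data} (V : Valid X) where
    open Valid V

    module _ {a v : ℕ} (ia : In a) (a≤v : a ≤ v) (v≤H : v ≤ H X a)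
             (closed : ∀ {c} → a < c → c ≤ v → H X c ≤ v) where

      private
        upd-≤ : ∀ {b w} → H X b ≤ w → (b ≡ a → v ≤ w) → (H X [ a ≔ v ]) b ≤ w
        upd-≤ {b} p q with b ≟ a
        ... | yes e = q e
        ... | no _  = p

        upd-≥ : ∀ {b w} → w ≤ H X b → (b ≡ a → w ≤ v) → w ≤ (H X [ a ≔ v ]) b
        upd-≥ {b} p q with b ≟ a
        ... | yes e = q e
        ... | no _  = p

      shrink-⊑ : shrink X a v ⊑ X
      shrink-⊑ = (λ _ → upd-≤ ≤-refl (λ { refl → v≤H })) , (λ _ → ≤-refl)

      shrink-valid : Valid (shrink X a v)
      shrink-valid = record
        { H-lower = λ ib → upd-≥ (H-lower ib) (λ { refl → a≤v })
        ; H-upper = λ ib → ≤-trans (H-mono shrink-⊑ ib) (H-upper ib)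
        ; t-upper = t-upper
        ; H-nest = nest
        ; t-nest = λ im 1≤c c≤ → upd-≤ (t-nest im 1≤c c≤) (λ { refl → ≤-trans v≤H (t-nest im 1≤c c≤) })
        ; t-sym = t-sym
        }
        where
        nest : ∀ {d b} → In d → d < b → b ≤ (H X [ a ≔ v ]) d → (H X [ a ≔ v ]) b ≤ (H X [ a ≔ v ]) d
        nest {d} {b} id′ d<b b≤ with d ≟ a
        ... | no _     = upd-≤ (H-nest id′ d<b b≤) (λ { refl → ≤-trans v≤H (H-nest id′ d<b b≤) })
        ... | yes refl = upd-≤ (closed d<b b≤) (λ _ → ≤-refl)

      ⊑-shrink : ∀ {Z} → Z ⊑ X → H Z a ≤ v → Z ⊑ shrink X a v
      ⊑-shrink l p = (λ ib → upd-≥ (H-mono l ib) (λ { refl → p })) , t-mono l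

      shrink-strict : v < H X a → ¬ X ⊑ shrink X a v
      shrink-strict lt l = contradiction (≤-trans (H-mono l ia) (≤-reflexive (≔-same (H X) a v))) (<⇒≱ lt)

      -- Together with `closed`, the second hypothesis makes `suc v` the last child of `a`. The arc
      -- of `a` in `Z` either stops before that child or, by nesting, contains all of it.
      shrink-cover : v < H X a → H X (suc v) ≡ H X a → shrink X a v ⋖ X
      shrink-cover lt e = record
        { below = shrink-⊑
        ; strict = shrink-strict lt
        ; between = λ {Z} VZ l l′ → go VZ l l′
        }
        where
        go : ∀ {Z} → Valid Z → shrink X a v ⊑ Z → Z ⊑ X → Z ⊑ shrink X a v ⊎ X ⊑ Z
        go {Z} VZ l l′ with ≤-<-connex (H Z a) v
        ... | inj₁ p = inj₁ (⊑-shrink l′ p)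
        ... | inj₂ p = inj₂ ((λ ib → grow ib) , t-mono l)
          where
          grow : ∀ {b} → In b → H X b ≤ H Z b
          grow {b} ib with b ≟ a
          ... | no b≢a = ≤-trans (≤-reflexive (sym (≔-other (H X) v b≢a))) (H-mono l ib)
          ... | yes refl = ≤-trans (≤-reflexive (sym e)) (≤-trans (grow-suc) (Valid.H-nest VZ ia (s≤s a≤v) p))
            where
            grow-suc : H X (suc v) ≤ H Z (suc v)
            grow-suc = ≤-trans (≤-reflexive (sym (≔-other (H X) v (<⇒≢ (s≤s a≤v) ∘ sym))))
                         (H-mono l (s≤s z≤n , ≤-trans lt (H-upper ia)))

    module _ {i j : ℕ} where

      private
        t₀ = cap (j <?_) i (t X)

      ≤-cut⁻ : ∀ {m c} → c ≤ t (cut X i j) m → c ≤ t X m × (i < m → c ≤ j) × (j < m → c ≤ i)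
      ≤-cut⁻ {m} c≤ with p , q ← ≤-cap⁻ (i <?_) {j} {t₀} {m} c≤ with r , s ← ≤-cap⁻ (j <?_) {i} {t X} {m} p = r , q , s

      ≤-cut : ∀ {m c} → c ≤ t X m → (i < m → c ≤ j) → (j < m → c ≤ i) → c ≤ t (cut X i j) m
      ≤-cut {m} p q r = ≤-cap (i <?_) {j} {t₀} {m} (≤-cap (j <?_) {i} {t X} {m} p r) q

      cut-⊑ : cut X i j ⊑ X
      cut-⊑ = (λ _ → ≤-refl) , (λ _ → proj₁ (≤-cut⁻ ≤-refl))

      cut-valid : Closed X i → Closed X j → Valid (cut X i j)
      cut-valid ci cj = record
        { H-lower = H-lower
        ; H-upper = H-upper
        ; t-upper = λ im → ≤-trans (t-mono cut-⊑ im) (t-upper im)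
        ; H-nest = H-nest
        ; t-nest = λ im 1≤c c≤ → let p , q , r = ≤-cut⁻ c≤ in
            ≤-cut (t-nest im 1≤c p) (λ l → cj 1≤c (q l)) (λ l → ci 1≤c (r l))
        ; t-sym = λ im 1≤c c≤ → let p , q , r = ≤-cut⁻ c≤ in
            ≤-cut (t-sym im 1≤c p) (λ i<c → ≮⇒≥ λ j<m → <⇒≱ i<c (r j<m)) (λ j<c → ≮⇒≥ λ i<m → <⇒≱ j<c (q i<m))
        }

      ⊑-cut : ∀ {Z} → Valid Z → Z ⊑ X → In (suc i) → In (suc j) → t Z (suc i) ≤ j → Z ⊑ cut X i j
      ⊑-cut {Z} VZ l ii ij p = H-mono l , λ {m} im → ≤-cut (t-mono l im)
        (λ i<m → ≮⇒≥ λ j<t → <⇒≱ (s≤s p) (Z.t-sym ij (s≤s z≤n) (≤-trans i<m (Z.t-sym im (s≤s z≤n) j<t))))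
        (λ j<m → ≮⇒≥ λ i<t → <⇒≱ (s≤s p) (≤-trans j<m (Z.t-sym im (s≤s z≤n) i<t)))
        where module Z = Valid VZ

      cut-strict : In (suc i) → suc j ≤ t X (suc i) → ¬ X ⊑ cut X i j
      cut-strict ii p l = 1+n≰n (≤-trans (≤-trans p (t-mono l ii)) (proj₁ (proj₂ (≤-cut⁻ ≤-refl)) ≤-refl))

      -- The bounds put the removed cells into one rectangle over two arcs, and its transpose; if
      -- `Z` retains the corner (i + 1 , j + 1), closing under arcs restores them all.
      cut-cover : In (suc i) → In (suc j) → suc j ≤ t X (suc i) →
                  t X (suc i) ≤ H X (suc j) → t X (suc j) ≤ H X (suc i) → cut X i j ⋖ X
      cut-cover ii ij p pi pj = record
        { below = cut-⊑
        ; strict = cut-strict ii p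
        ; between = λ VZ l l′ → go VZ l l′
        }
        where
        go : ∀ {Z} → Valid Z → cut X i j ⊑ Z → Z ⊑ X → Z ⊑ cut X i j ⊎ X ⊑ Z
        go {Z} VZ l l′ with ≤-<-connex (t Z (suc i)) j
        ... | inj₁ q = inj₁ (⊑-cut VZ l′ ii ij q)
        ... | inj₂ q = inj₂ (H-mono l , λ {m} im → fill im ≤-refl)
          where
          module Z = Valid VZ
          q′ = Z.t-sym ii (s≤s z≤n) q
          -- The bounds on t confine the removed cells to the rectangle of the root blocks of i + 1 and j + 1.
          block : ∀ {i j m c} → In (suc i) → In (suc j) → suc j ≤ t Z (suc i) → t X (suc i) ≤ H X (suc j) →
                  t X (suc j) ≤ H X (suc i) → H X (suc j) ≤ H Z (suc j) → H X (suc i) ≤ H Z (suc i) →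
                  In m → 1 ≤ c → i < m → j < c → c ≤ t X m → c ≤ t Z m
          block ii ij q pi pj gj gi im 1≤c i<m j<c c≤ =
            Z.t-sym ic (proj₁ im) (≤-trans m≤Hi (≤-trans gi (Z.t-nest ic (s≤s z≤n) (Z.t-sym ii 1≤c c≤tZi))))
            where
            ic = 1≤c , ≤-trans c≤ (t-upper im)
            c≤tXi = t-sym ic (s≤s z≤n) (≤-trans i<m (t-sym im 1≤c c≤))
            c≤tZi = ≤-trans c≤tXi (≤-trans pi (≤-trans gj (Z.t-nest ii (s≤s z≤n) q)))
            m≤Hi = ≤-trans (t-sym im (s≤s z≤n) (≤-trans j<c c≤)) pj
          fill : ∀ {m c} → In m → c ≤ t X m → c ≤ t Z m
          fill {m} {zero} im c≤ = z≤n
          fill {m} {c@(suc _)} im c≤ with i <? m ×-dec j <? c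
          ... | yes (a , b) = block ii ij q pi pj (H-mono l ij) (H-mono l ii) im (s≤s z≤n) a b c≤
          ... | no ¬1 with j <? m ×-dec i <? c
          ...   | yes (a , b) = block ij ii q′ pj pi (H-mono l ii) (H-mono l ij) im (s≤s z≤n) a b c≤
          ...   | no ¬2 = ≤-trans (≤-cut c≤ (λ a → ≮⇒≥ λ b → ¬1 (a , b)) (λ a → ≮⇒≥ λ b → ¬2 (a , b))) (t-mono l im)

  -- Arcs and rows of `Y` are unions of arcs of `X`. Every lower cover of `X` has this property and
  -- meets inherit it, so Pop of `X` has it too.
  record ArcClosed (X Y : Data) : Set where
    field
      H-closed : ∀ {a c} → In a → a < c → c ≤ H Y a → H X c ≤ H Y a
      t-closed : ∀ {m c} → In m → 1 ≤ c → c ≤ t Y m → H X c ≤ t Y m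
  open ArcClosed

  self-closed : ∀ {X} → Valid X → ArcClosed X X
  self-closed V = record { H-closed = Valid.H-nest V ; t-closed = Valid.t-nest V }

  -- If Y ⋖ X shrinks some arc, then, a being the last such arc, Y is X with only the arc a shrunk.
  cover-closed : ∀ {X Y} → Valid X → Valid Y → Y ⋖ X → ArcClosed X Y
  cover-closed {X} {Y} VX VY cov with greatest (λ a → H Y a <? H X a) n
  ... | inj₂ none = record
    { H-closed = λ ia a<c c≤ → ≤-trans (≮⇒≥ (none (≤-trans (proj₁ ia) (<⇒≤ a<c)) (≤-trans c≤ (Y.H-upper ia))))
        (Y.H-nest ia a<c c≤)
    ; t-closed = λ im 1≤c c≤ → ≤-trans (≮⇒≥ (none 1≤c (≤-trans c≤ (Y.t-upper im)))) (Y.t-nest im 1≤c c≤)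
    }
    where
    module Y = Valid VY
  ... | inj₁ (a , ia , lt , max) = record
    { H-closed = hc
    ; t-closed = λ im 1≤c c≤ → ≤-trans (X.t-nest im 1≤c (≤-trans c≤ (t-mono below im))) (t-mono Z⊑Y im)
    }
    where
    module X = Valid VX
    module Y = Valid VY
    open _⋖_ cov
    closed : ∀ {c} → a < c → c ≤ H Y a → H X c ≤ H Y a
    closed a<c c≤ = ≤-trans (≮⇒≥ (max a<c (≤-trans c≤ (Y.H-upper ia)))) (Y.H-nest ia a<c c≤)
    Z = shrink X a (H Y a)
    Z⊑Y : Z ⊑ Y
    Z⊑Y with between (shrink-valid VX ia (Y.H-lower ia) (<⇒≤ lt) closed)
                     (⊑-shrink VX ia (Y.H-lower ia) (<⇒≤ lt) closed below ≤-refl)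
                     (shrink-⊑ VX ia (Y.H-lower ia) (<⇒≤ lt) closed)
    ... | inj₁ l = l
    ... | inj₂ l = contradiction l (shrink-strict VX ia (Y.H-lower ia) (<⇒≤ lt) closed lt)
    hc : ∀ {b c} → In b → b < c → c ≤ H Y b → H X c ≤ H Y b
    hc {b} ib b<c c≤ with b ≟ a
    ... | yes refl = closed b<c c≤
    ... | no b≢a   = ≤-trans (X.H-nest ib b<c (≤-trans c≤ (H-mono below ib)))
                       (≤-trans (≤-reflexive (sym (≔-other (H X) (H Y a) b≢a))) (H-mono Z⊑Y ib))

  infixr 7 _∧ᴰ_
  _∧ᴰ_ : Data → Data → Data
  D ∧ᴰ E = ⟨ (λ a → H D a ⊓ H E a) , (λ m → t D m ⊓ t E m) ⟩

  ∧ᴰ-⊑ˡ : ∀ D E → D ∧ᴰ E ⊑ D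
  ∧ᴰ-⊑ˡ D E = (λ _ → m⊓n≤m _ _) , (λ _ → m⊓n≤m _ _)

  ∧ᴰ-⊑ʳ : ∀ D E → D ∧ᴰ E ⊑ E
  ∧ᴰ-⊑ʳ D E = (λ _ → m⊓n≤n (H D _) _) , (λ _ → m⊓n≤n (t D _) _)

  ∧ᴰ-greatest : ∀ {D E F} → F ⊑ D → F ⊑ E → F ⊑ D ∧ᴰ E
  ∧ᴰ-greatest p q = (λ ia → ⊓-glb (H-mono p ia) (H-mono q ia)) , (λ im → ⊓-glb (t-mono p im) (t-mono q im))

  -- Closure of intervals under arcs and symmetry of a set of cells survive intersection, so meets
  -- are componentwise.
  ∧ᴰ-valid : ∀ {D E} → Valid D → Valid E → Valid (D ∧ᴰ E)
  ∧ᴰ-valid VD VE = record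
    { H-lower = λ ia → ⊓-glb (D.H-lower ia) (E.H-lower ia)
    ; H-upper = λ ia → ≤-trans (m⊓n≤m _ _) (D.H-upper ia)
    ; t-upper = λ im → ≤-trans (m⊓n≤m _ _) (D.t-upper im)
    ; H-nest = λ ia a<c c≤ → ⊓-mono-≤ (D.H-nest ia a<c (≤-trans c≤ (m⊓n≤m _ _)))
        (E.H-nest ia a<c (≤-trans c≤ (m⊓n≤n _ _)))
    ; t-nest = λ im 1≤c c≤ → ⊓-mono-≤ (D.t-nest im 1≤c (≤-trans c≤ (m⊓n≤m _ _)))
        (E.t-nest im 1≤c (≤-trans c≤ (m⊓n≤n _ _)))
    ; t-sym = λ im 1≤c c≤ → ⊓-glb (D.t-sym im 1≤c (≤-trans c≤ (m⊓n≤m _ _))) (E.t-sym im 1≤c (≤-trans c≤ (m⊓n≤n _ _)))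
    }
    where
    module D = Valid VD
    module E = Valid VE

  ∧ᴰ-closed : ∀ {X D E} → ArcClosed X D → ArcClosed X E → ArcClosed X (D ∧ᴰ E)
  ∧ᴰ-closed p q = record
    { H-closed = λ ia a<c c≤ → ⊓-glb (H-closed p ia a<c (≤-trans c≤ (m⊓n≤m _ _)))
        (H-closed q ia a<c (≤-trans c≤ (m⊓n≤n _ _)))
    ; t-closed = λ im 1≤c c≤ → ⊓-glb (t-closed p im 1≤c (≤-trans c≤ (m⊓n≤m _ _)))
        (t-closed q im 1≤c (≤-trans c≤ (m⊓n≤n _ _)))
    }

  -- The universal property of the meet, phrased with `⋖` instead of a list of covers.
  record IsPop (X B : Data) : Set where
    field
      pop-⊑    : B ⊑ X
      pop-⋖    : ∀ {Y} → Valid Y → Y ⋖ X → B ⊑ Y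
      pop-greatest : ∀ {W} → Valid W → W ⊑ X → (∀ {Y} → Valid Y → Y ⋖ X → W ⊑ Y) → W ⊑ B

  -- `leaf` is the contrapositive: a node with children is never the last of its siblings or of its
  -- run.
  record Image (B : Data) : Set where
    field
      leaf    : ∀ {a} → In a → H B a ≢ a → HSlot B a
      notFull : t B n < n
  open Image

  module _ {X B : Data} (VX : Valid X) (VB : Valid B) (1≤n : 1 ≤ n)
           (arcs : ArcClosed X B) (pop-⊑ : B ⊑ X) (pop-⋖ : ∀ {Y} → Valid Y → Y ⋖ X → B ⊑ Y) where

    private
      module X = Valid VX
      module B = Valid VB
      iₙ : In n
      iₙ = 1≤n , ≤-refl

    pop-shrinks : ∀ {a} → In a → a < H X a → H B a < H X a
    -- The least `c` beyond `a` whose arc ends with that of `a` is the last child of `a`; `H X a` is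
    -- a candidate, so the search succeeds. Detaching this child gives a lower cover, and `B` lies
    -- below it.
    pop-shrinks {a} ia lt with least (λ c → a <? c ×-dec H X c ≟ H X a) n
    ... | inj₂ none = contradiction (lt , ≤-antisym (X.H-nest ia lt ≤-refl) (X.H-lower iH)) (none (proj₁ iH) (proj₂ iH))
      where iH = ≤-trans (proj₁ ia) (<⇒≤ lt) , X.H-upper ia
    ... | inj₁ (suc v , ic , (a<c , e) , min) = ≤-<-trans (≤-trans (H-mono (pop-⋖ valid cover) ia)
        (≤-reflexive (≔-same (H X) a v))) v<H
      where
      a≤v = s≤s⁻¹ a<c
      v<H : v < H X a
      v<H = ≤-trans (X.H-lower ic) (≤-reflexive e)
      closed : ∀ {c} → a < c → c ≤ v → H X c ≤ v
      closed {c} a<c c≤v = ≮⇒≥ λ v<Hc → min (≤-trans (proj₁ ia) (<⇒≤ a<c)) (s≤s c≤v)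
        (a<c , ≤-antisym (X.H-nest ia a<c (≤-trans c≤v (<⇒≤ v<H)))
                 (≤-trans (≤-reflexive (sym e)) (X.H-nest (≤-trans (proj₁ ia) (<⇒≤ a<c) , ≤-trans c≤v
                     (<⇒≤ (proj₂ ic))) (s≤s c≤v) v<Hc)))
      valid = shrink-valid VX ia a≤v (<⇒≤ v<H) closed
      cover = shrink-cover VX ia a≤v (<⇒≤ v<H) closed v<H e

    -- Without a slot some arc or row of `B` around `a` ends at `H B a`. It is closed under arcs of
    -- `X`, so it would contain the arc of `a` in `X`, which is longer.
    pop-leaf : ∀ {a} → In a → H B a ≢ a → HSlot B a
    pop-leaf {a} ia H≢a e = absurd (hull-row B ia) (≤-trans (B.H-lower ia) (≤-reflexive (sym e))) (≤-reflexive e)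
      where
      a<H = ≤∧≢⇒< (B.H-lower ia) (H≢a ∘ sym)
      shrinks = pop-shrinks ia (≤-trans a<H (H-mono pop-⊑ ia))
      absurd : ∀ {v} → Row B a v → a ≤ v → v ≤ H B a → ⊥
      absurd top a≤v v≤ = <⇒≱ shrinks (≤-trans (X.H-upper ia) v≤)
      absurd (arc 1≤d d<a) a≤v v≤ = <⇒≱ shrinks
          (≤-trans (H-closed arcs (1≤d , <⇒≤ (<-≤-trans d<a (proj₂ ia))) d<a a≤v) v≤)
      absurd (row im) a≤v v≤ = <⇒≱ shrinks (≤-trans (t-closed arcs im (proj₁ ia) a≤v) v≤)

    pop-notFull : t B n < n
    pop-notFull with t B n <? n
    ... | yes lt = lt
    -- The least `d` whose arc ends at n is the last root. With `t` full, removing the square over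
    -- its tree is a lower cover of `X` in which row n is shorter than n.
    ... | no ≮n with least (λ d → H X d ≟ n) n
    ...   | inj₂ none = contradiction (≤-antisym (X.H-upper iₙ) (X.H-lower iₙ)) (none 1≤n ≤-refl)
    ...   | inj₁ (suc i , ii , e , min) = contradiction
            (≤-trans (≤-trans (≮⇒≥ ≮n) (t-mono (pop-⋖ (cut-valid VX closed closed) cover) iₙ))
                     (proj₁ (proj₂ (≤-cut⁻ VX {i} {i} {n} ≤-refl)) (proj₂ ii)))
            (<⇒≱ (proj₂ ii))
      where
      full : n ≤ t X (suc i)
      full = X.t-sym iₙ (proj₁ ii) (≤-trans (≤-trans (proj₂ ii) (≮⇒≥ ≮n)) (t-mono pop-⊑ iₙ))
      closed : Closed X i
      closed {c} 1≤c c≤ = ≮⇒≥ λ i<H → min 1≤c (s≤s c≤)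
        (≤-antisym (X.H-upper ic) (≤-trans (≤-reflexive (sym e)) (X.H-nest ic (s≤s c≤) i<H)))
        where ic = 1≤c , ≤-trans c≤ (<⇒≤ (proj₂ ii))
      tH : t X (suc i) ≤ H X (suc i)
      tH = ≤-trans (X.t-upper ii) (≤-reflexive (sym e))
      cover : cut X i i ⋖ X
      cover = cut-cover VX ii ii (≤-trans (proj₂ ii) full) tH tH

    pop⇒image : Image B
    pop⇒image = record { leaf = pop-leaf ; notFull = pop-notFull }

  -- The join of the upper covers of B: every run of siblings (or of roots in a run of equal rows)
  -- is turned into a chain and all addable rectangles are added.
  module _ (B : Data) where

    next : ℕ → ℕ
    next k with k <? n
    ... | yes _ = hull B (suc k)
    ... | no  _ = n

    chain : Data
    chain = ⟨ hull B , next ∘ t B ⟩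

  module Chain {B : Data} (VB : Valid B) (image : Image B) where

    private
      module B = Valid VB
      X = chain B

      ≤-next : ∀ {k} → k ≤ n → k ≤ next B k
      ≤-next {k} k≤n with k <? n
      ... | yes k<n = <⇒≤ (hull-lower B (s≤s z≤n , k<n))
      ... | no _    = k≤n

      next-hull : ∀ {k} → k < n → next B k ≡ hull B (suc k)
      next-hull {k} k<n with k <? n
      ... | yes _  = refl
      ... | no k≮n = contradiction k<n k≮n

      next-≤n : ∀ k → next B k ≤ n
      next-≤n k with k <? n
      ... | yes _ = hull-≤n B (suc k)
      ... | no _  = ≤-refl

      row-hull : ∀ {m c} → In m → 1 ≤ c → c ≤ t B m → hull B c ≤ t B m
      row-hull im 1≤c c≤ = hull-min B (row im) c≤

      -- Arcs starting at or before `t B c` end there, because row `c` is closed, so only rows can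
      -- close the run behind it. By symmetry such a row is among the first `t B (suc (t B c))`, and
      -- the last hypothesis bounds its length.
      hull-run : ∀ {c m₁} → In c → t B c < n → m₁ ≤ n →
                 (∀ {m′} → In m′ → m′ ≤ t B (suc (t B c)) → m₁ ≤ t B m′) → m₁ ≤ hull B (suc (t B c))
      hull-run {c} {m₁} ic lt m₁≤n f = go (hull-row B i₀) (hull-lower B i₀)
        where
        i₀ : In (suc (t B c))
        i₀ = s≤s z≤n , lt
        go : ∀ {v} → Row B (suc (t B c)) v → suc (t B c) ≤ v → m₁ ≤ v
        go top _ = m₁≤n
        go (arc 1≤d d<) ≤v = contradiction (B.t-nest ic 1≤d (s≤s⁻¹ d<)) (<⇒≱ ≤v)
        go (row im′) ≤v = f im′ (B.t-sym im′ (s≤s z≤n) ≤v)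

    B⊑chain : B ⊑ X
    B⊑chain = (λ ia → H≤hull VB ia) , (λ im → ≤-next (B.t-upper im))

    chain-valid : Valid X
    chain-valid = record
      { H-lower = hull-lower B
      ; H-upper = λ {a} _ → hull-≤n B a
      ; t-upper = λ {m} _ → next-≤n (t B m)
      ; H-nest = λ ia a<c c≤ → hull-nest VB (hull-row B ia) (<⇒≤ a<c) c≤
      ; t-nest = nest
      ; t-sym = symm
      }
      where
      nest : ∀ {m c} → In m → 1 ≤ c → c ≤ next B (t B m) → hull B c ≤ next B (t B m)
      nest {m} {c} im 1≤c c≤ with t B m <? n
      ... | no _ = hull-≤n B c
      ... | yes lt with ≤-<-connex c (t B m)
      ...   | inj₁ c≤t = ≤-trans (row-hull im 1≤c c≤t) (<⇒≤ (hull-lower B (s≤s z≤n , lt)))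
      ...   | inj₂ t<c = hull-nest VB (hull-row B (s≤s z≤n , lt)) t<c c≤
      symm : ∀ {m c} → In m → 1 ≤ c → c ≤ next B (t B m) → m ≤ next B (t B c)
      symm {m} {c} im 1≤c c≤ with ≤-<-connex c (t B m)
      ... | inj₁ c≤t = ≤-trans (B.t-sym im 1≤c c≤t) (≤-next (B.t-upper (1≤c , ≤-trans c≤t (B.t-upper im))))
      ... | inj₂ t<c with ≤-<-connex m (t B c)
      ...   | inj₁ m≤ = ≤-trans m≤ (≤-next (B.t-upper ic))
        where ic = 1≤c , ≤-trans c≤ (next-≤n (t B m))
      -- The cell (m , c) is new. Every row through column `c₀` reaches `hull B c₀`, so columns `c₀`
      -- and `c` are equally long; hence every row through column `m₀` reaches `m`.
      ...   | inj₂ tc<m = ≤-trans (hull-run ic tc<n (proj₂ im) f) (≤-reflexive (sym (next-hull tc<n)))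
        where
        ic : In c
        ic = 1≤c , ≤-trans c≤ (next-≤n (t B m))
        tm<n = <-≤-trans t<c (proj₂ ic)
        tc<n = <-≤-trans tc<m (proj₂ im)
        c₀ = suc (t B m)
        c≤hull : c ≤ hull B c₀
        c≤hull = ≤-trans c≤ (≤-reflexive (next-hull tm<n))
        tc₀≤ : t B c₀ ≤ t B c
        tc₀≤ with t B c₀ in e
        ... | zero  = z≤n
        ... | suc k = B.t-sym ik 1≤c (≤-trans c≤hull
            (row-hull ik (s≤s z≤n) (B.t-sym (s≤s z≤n , tm<n) (s≤s z≤n) (≤-reflexive (sym e)))))
          where ik = s≤s z≤n , ≤-trans (≤-reflexive (sym e)) (B.t-upper (s≤s z≤n , tm<n))
        m₀ = suc (t B c)
        tm₀≤ : t B m₀ ≤ t B m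
        tm₀≤ = ≮⇒≥ λ lt → 1+n≰n (≤-trans (B.t-sym (s≤s z≤n , tc<n) (s≤s z≤n) lt) tc₀≤)
        f : ∀ {m′} → In m′ → m′ ≤ t B m₀ → m ≤ t B m′
        f im′ m′≤ = B.t-sym im (proj₁ im′) (≤-trans m′≤ tm₀≤)

    private
      module X = Valid chain-valid

    module _ {m : ℕ} (im′ : In m) (lt : t B m < n) where

      private
        c₀ = suc (t B m)
        ic₀ : In c₀
        ic₀ = s≤s z≤n , lt

      row<m : t B c₀ < m
      row<m = ≰⇒> λ m≤ → 1+n≰n (B.t-sym ic₀ (proj₁ im′) m≤)

      private
        i₀ : In (suc (t B c₀))
        i₀ = s≤s z≤n , ≤-trans row<m (proj₂ im′)

      chain-cell : c₀ ≤ t X (suc (t B c₀))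
      chain-cell = X.t-sym ic₀ (s≤s z≤n) (≤-trans (hull-lower B i₀) (≤-reflexive (sym (next-hull (proj₂ i₀)))))

      closed-i : Closed X (t B c₀)
      closed-i 1≤c c≤ = row-hull ic₀ 1≤c c≤

      closed-j : Closed X (t B m)
      closed-j 1≤c c≤ = row-hull im′ 1≤c c≤

      corner-row≤ : t B (suc (t B c₀)) ≤ t B m
      corner-row≤ = ≮⇒≥ λ l → 1+n≰n (B.t-sym i₀ (s≤s z≤n) l)

      chain-cut-valid : Valid (cut X (t B c₀) (t B m))
      chain-cut-valid = cut-valid chain-valid closed-i closed-j

      -- Takes away again the addable rectangle that the chain put to the right of row `m`; its
      -- corner is the cell in row `suc (t B c₀)` and column `c₀`.
      chain-cut : cut X (t B c₀) (t B m) ⋖ X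
      chain-cut = cut-cover chain-valid i₀ ic₀ chain-cell
        (≤-reflexive (trans (cong (next B) (≤-antisym corner-row≤ (row≤ VB (s≤s z≤n) row<m (proj₂ im′))))
            (next-hull lt)))
        (≤-reflexive (next-hull (proj₂ i₀)))

    shrunk : ∀ {a} → In a → HSlot B a → H B a < hull B a
    shrunk ia s = next≤hull VB ia s

    private
      closed-arc : ∀ {a} → In a → ∀ {c} → a < c → c ≤ H B a → hull B c ≤ H B a
      closed-arc ia a<c c≤ = hull-min B (arc (proj₁ ia) a<c) c≤

    private
      -- Otherwise the chain with only the arc of `a` cut back to `H B a` would lie strictly between
      -- `Y` and the chain.
      cover-H : ∀ {Y a} → Valid Y → Y ⋖ X → In a → H B a ≤ H Y a
      cover-H {Y} {a} VY cov ia = ≮⇒≥ absurd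
        where
        absurd : ¬ H Y a < H B a
        absurd lt = [ (λ l → <⇒≱ lt (≤-trans (≤-reflexive (sym (≔-same (hull B) a (H B a)))) (H-mono l ia)))
                    , shrink-strict chain-valid ia p r u (shrunk ia s) ]′
          (_⋖_.between cov (shrink-valid chain-valid ia p r u)
            (⊑-shrink chain-valid ia p r u (_⋖_.below cov) (<⇒≤ lt)) (shrink-⊑ chain-valid ia p r u))
          where
          s = leaf image ia λ e → <⇒≱ (≤-trans lt (≤-reflexive e)) (Valid.H-lower VY ia)
          p = B.H-lower ia
          r = <⇒≤ (shrunk ia s)
          u : ∀ {c} → a < c → c ≤ H B a → hull B c ≤ H B a
          u = closed-arc ia

      -- If Y misses the last cell (M , k) of B in row M = t k, where k = t m, then removing from the
      -- chain the addable rectangle to the right of that cell gives an element strictly above Y.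
      last-cell : ∀ {Y m} → Valid Y → Y ⋖ X → In m → 1 ≤ t B m → t B m < n → t B m ≤ t Y (t B (t B m))
      last-cell {Y} {m} VY cov im′ 1≤k lt = ≮⇒≥ absurd
        where
        module Y = Valid VY
        k = t B m
        c₀ = suc k
        M = t B k
        m₀ = suc (t B c₀)
        ik : In k
        ik = 1≤k , <⇒≤ lt
        ic₀ : In c₀
        ic₀ = s≤s z≤n , lt
        i₀ : In m₀
        i₀ = s≤s z≤n , ≤-trans (row<m im′ lt) (proj₂ im′)
        iM : In M
        iM = ≤-trans (proj₁ im′) (B.t-sym im′ 1≤k ≤-refl) , B.t-upper ik
        k≤M : k ≤ t B M
        k≤M = B.t-sym ik (proj₁ iM) ≤-refl
        M≤hull : M ≤ hull B m₀
        M≤hull = hull-run ic₀ (proj₂ i₀) (proj₂ iM) λ im″ m″≤ →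
          B.t-sym iM (proj₁ im″) (≤-trans m″≤ (≤-trans (corner-row≤ im′ lt) k≤M))
        k≤cut : k ≤ t (cut X (t B c₀) k) M
        k≤cut = ≤-cut chain-valid (≤-trans k≤M (t-mono B⊑chain iM)) (λ _ → ≤-refl) λ k<M → ≮⇒≥ λ m₀≤k →
          <⇒≱ k<M (≤-trans (row≤ VB (proj₁ i₀) m₀≤k (proj₂ ik)) (corner-row≤ im′ lt))
        absurd : ¬ t Y M < k
        absurd lt′ = [ (λ l → <⇒≱ lt′ (≤-trans k≤cut (t-mono l iM))) , cut-strict chain-valid i₀ (chain-cell im′ lt) ]′
          (_⋖_.between cov (chain-cut-valid im′ lt) (⊑-cut chain-valid VY (_⋖_.below cov) i₀ ic₀ missing)
              (cut-⊑ chain-valid))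
          where
          missing : t Y m₀ ≤ k
          missing = ≮⇒≥ λ l → <⇒≱ lt′ (<⇒≤ (Y.t-sym ic₀ (proj₁ iM)
            (≤-trans M≤hull (t-closed (cover-closed chain-valid VY cov) ic₀ (s≤s z≤n) (Y.t-sym i₀ (s≤s z≤n) l)))))

      -- If row `m` of `Y` misses column `k`, so does every later row, in particular `M`, the last
      -- row of `B` to reach `k`.
      cover-t : ∀ {Y m} → Valid Y → Y ⋖ X → In m → t B m ≤ t Y m
      cover-t {Y} {m} VY cov im′ = ≮⇒≥ absurd
        where
        module Y = Valid VY
        k = t B m
        M = t B k
        absurd : ¬ t Y m < k
        absurd lt = missing present
          where
          ik : In k
          ik = ≤-trans (s≤s z≤n) lt , B.t-upper im′
          m≤M : m ≤ M
          m≤M = B.t-sym im′ (proj₁ ik) ≤-refl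
          iM : In M
          iM = ≤-trans (proj₁ im′) m≤M , B.t-upper ik
          missing : ¬ k ≤ t Y M
          missing p = <⇒≱ lt (Y.t-sym ik (proj₁ im′) (≤-trans m≤M (Y.t-sym iM (proj₁ ik) p)))
          present : k ≤ t Y M
          present with m≤n⇒m<n∨m≡n (proj₂ ik)
          ... | inj₁ k<n = last-cell VY cov im′ (proj₁ ik) k<n
          -- There is no room to the right of column n. The transposed cell (n , M) lies in row n,
          -- which is shorter than n because `t B` is not full.
          ... | inj₂ k≡n = ≤-trans (B.t-sym ik (proj₁ iM) ≤-refl) (Y.t-sym i′ (proj₁ iM)
                  (last-cell VY cov ik (proj₁ iM) (subst (λ z → t B z < n) (sym k≡n) (notFull image))))
            where
            i′ : In (t B M)
            i′ = ≤-trans (proj₁ ik) (B.t-sym ik (proj₁ iM) ≤-refl) , B.t-upper iM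

    chain-pop : IsPop X B
    chain-pop = record
      { pop-⊑ = B⊑chain
      ; pop-⋖ = λ VY cov → cover-H VY cov , cover-t VY cov
      ; pop-greatest = λ VW W⊑X W⊑ → (λ ia → W-H VW W⊑X W⊑ ia) , (λ im′ → W-t VW W⊑X W⊑ im′)
      }
      where
      W-H : ∀ {W a} → Valid W → W ⊑ X → (∀ {Y} → Valid Y → Y ⋖ X → W ⊑ Y) → In a → H W a ≤ H B a
      W-H {W} {a} VW W⊑X W⊑ ia with hull B a ≟ H B a
      ... | yes e = ≤-trans (H-mono W⊑X ia) (≤-reflexive e)
      ... | no s  = ≤-trans (H-mono (W⊑ (shrink-valid chain-valid ia p r u)
          (shrink-cover chain-valid ia p r u (shrunk ia s) (hull-sibling VB ia s))) ia)
                      (≤-reflexive (≔-same (hull B) a (H B a)))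
        where
        p = B.H-lower ia
        r = <⇒≤ (shrunk ia s)
        u : ∀ {c} → a < c → c ≤ H B a → hull B c ≤ H B a
        u = closed-arc ia
      W-t : ∀ {W m} → Valid W → W ⊑ X → (∀ {Y} → Valid Y → Y ⋖ X → W ⊑ Y) → In m → t W m ≤ t B m
      W-t {W} {m} VW W⊑X W⊑ im′ = ≮⇒≥ λ lt →
        let lt′ = <-≤-trans lt (Valid.t-upper VW im′) in
        <⇒≱ lt (≤-trans (t-mono (W⊑ (chain-cut-valid im′ lt′) (chain-cut im′ lt′)) im′)
                        (proj₁ (proj₂ (≤-cut⁻ chain-valid ≤-refl)) (row<m im′ lt′)))

-- Translation between the Boolean definitions and `Data`.

module _ {A : Set} (p q : A → Bool) where

  all-implies⁻ : ∀ {w xs} → T (all (λ w → not (p w) ∨ q w) xs) → w ∈ xs → T (p w) → T (q w)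
  all-implies⁻ {w} {xs} a w∈ pw with to (T-∨ {not (p w)}) (All.lookup (all⁺ (λ w → not (p w) ∨ q w) xs a) w∈)
  ... | inj₁ ¬pw = contradiction pw (T-not⁻ ¬pw)
  ... | inj₂ qw  = qw

  all-implies⁺ : ∀ xs → (∀ {w} → w ∈ xs → T (p w) → T (q w)) → T (all (λ w → not (p w) ∨ q w) xs)
  all-implies⁺ xs f = all⁻ (λ w → not (p w) ∨ q w) {xs = xs} (All.tabulate go)
    where
    go : ∀ {w} → w ∈ xs → T (not (p w) ∨ q w)
    go {w} w∈ with p w in e
    ... | false = _
    ... | true  = f w∈ (from T-≡ e)

module Link (n : ℕ) where
  open Lower n public

  _≈_ : Data → Data → Set
  D ≈ E = D ⊑ E × E ⊑ D

  realise : ∀ {D} → Valid D → ∃[ x ] Tamari x × encode x ≈ D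
  realise V = word V , word-tamari V , encode-word-⊑ V , ⊑-encode-word V

  eqW⁻ : ∀ {x y} → T (eqW x y) → x ≡ y
  eqW⁻ {x} {y} = toWitness {a? = ≡-dec _≟_ x y}

  eqW⁺ : ∀ {x y} → x ≡ y → T (eqW x y)
  eqW⁺ {x} {y} = fromWitness {a? = ≡-dec _≟_ x y}

  ltT⁺ : ∀ {x y} → Tamari x → Tamari y → encode x ⊑ encode y → ¬ encode y ⊑ encode x → T (ltT n x y)
  ltT⁺ {x} {y} tx ty l ¬l = from T-∧
      (⊑⇒leq tx ty l , T-not⁺ λ e → ¬l (subst (λ z → encode z ⊑ encode x) (eqW⁻ {x} {y} e) ⊑-refl))

  ltT⁻ : ∀ {x y} → Tamari x → Tamari y → T (ltT n x y) → encode x ⊑ encode y × ¬ encode y ⊑ encode x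
  ltT⁻ {x} {y} tx ty lt with p , q ← to (T-∧ {leqT n x y}) lt =
    l , λ l′ → T-not⁻ q (eqW⁺ {x} {y} (⊑-antisym-perm tx ty l l′))
    where l = leq⇒⊑ tx ty (proj₁ (to (T-∧ {leqT n x y}) lt))

  ⊑? : ∀ {x y} → Tamari x → Tamari y → Dec (encode x ⊑ encode y)
  ⊑? {x} {y} tx ty with T? (leqT n x y)
  ... | yes l = yes (leq⇒⊑ tx ty l)
  ... | no ¬l = no λ l → ¬l (⊑⇒leq tx ty l)

  coversT⁻ : ∀ {x y} → Tamari x → Tamari y → T (coversT n x y) → encode x ⋖ encode y
  coversT⁻ {x} {y} tx ty c with lt , none ← to (T-∧ {ltT n x y}) c with l , ¬l ← ltT⁻ tx ty lt = record
    { below = l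
    ; strict = ¬l
    ; between = between
    }
    where
    between : ∀ {Z} → Valid Z → encode x ⊑ Z → Z ⊑ encode y → Z ⊑ encode x ⊎ encode y ⊑ Z
    between VZ p q with z , tz , z⊑ , ⊑z ← realise VZ with ⊑? tz tx | ⊑? ty tz
    ... | yes r | _     = inj₁ (⊑-trans ⊑z r)
    ... | _     | yes r = inj₂ (⊑-trans r z⊑)
    ... | no r  | no s  = contradiction
      (∈-any⁺ (λ z → ltT n x z ∧ ltT n z y) (tamari⁺ tz)
        (from T-∧ (ltT⁺ tx tz (⊑-trans p ⊑z) r , ltT⁺ tz ty (⊑-trans z⊑ q) s)))
      (T-not⁻ none)

  coversT⁺ : ∀ {x y} → Tamari x → Tamari y → encode x ⋖ encode y → T (coversT n x y)
  coversT⁺ {x} {y} tx ty c = from T-∧ (ltT⁺ tx ty below strict , T-not⁺ none)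
    where
    open _⋖_ c
    none : ¬ T (any (λ z → ltT n x z ∧ ltT n z y) (Tam n))
    none a with z , z∈ , t ← ∈-any⁻ (λ z → ltT n x z ∧ ltT n z y) {Tam n} a with p , q ← to (T-∧ {ltT n x z}) t
           with p₁ , p₂ ← ltT⁻ tx (tamari⁻ z∈) p | q₁ , q₂ ← ltT⁻ (tamari⁻ z∈) ty q =
      [ p₂ , q₂ ]′ (between (encode-valid (tamari⁻ z∈)) p₁ q₁)

  ≈-⋖ʳ : ∀ {D E F} → D ⋖ E → E ≈ F → D ⋖ F
  ≈-⋖ʳ c (p , q) = record
    { below = ⊑-trans (_⋖_.below c) p
    ; strict = λ l → _⋖_.strict c (⊑-trans p l)
    ; between = λ VZ l l′ → [ inj₁ , (λ r → inj₂ (⊑-trans q r)) ]′ (_⋖_.between c VZ l (⊑-trans l′ q))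
    }

  ≈-⋖ˡ : ∀ {D E F} → D ⋖ E → D ≈ F → F ⋖ E
  ≈-⋖ˡ c (p , q) = record
    { below = ⊑-trans q (_⋖_.below c)
    ; strict = λ l → _⋖_.strict c (⊑-trans l q)
    ; between = λ VZ l l′ → [ (λ r → inj₁ (⊑-trans r p)) , inj₂ ]′ (_⋖_.between c VZ (⊑-trans p l) l′)
    }

  HSlot? : ∀ D a → Dec (HSlot D a)
  HSlot? D a = ¬? (hull D a ≟ H D a)

  TSlot? : ∀ D x → Dec (TSlot D x)
  TSlot? D x = t D x <? x ×-dec suc (t D (suc (t D x))) ≟ x

  slots : Data → List (ℕ ⊎ ℕ)
  slots D = map inj₁ (filter (HSlot? D) (oneTo n)) ++ map inj₂ (filter (TSlot? D) (oneTo n))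

  slots-unique : ∀ D → Unique (slots D)
  slots-unique D = Unique.++⁺ (Unique.map⁺ inj₁-injective (Unique.filter⁺ (HSlot? D) (oneTo-unique n)))
                              (Unique.map⁺ inj₂-injective (Unique.filter⁺ (TSlot? D) (oneTo-unique n)))
    λ (p , q) → let _ , _ , e = ∈-map⁻ inj₁ p ; _ , _ , e′ = ∈-map⁻ inj₂ q in
      contradiction (trans (sym e) e′) λ ()

  ∈-slots⁺ : ∀ {D s} → Slot D s → s ∈ slots D
  ∈-slots⁺ {D} (H-slot (1≤a , a≤n) p) = ∈-++⁺ˡ (∈-map⁺ inj₁ (∈-filter⁺ (HSlot? D) (∈-oneTo⁺ 1≤a a≤n) p))
  ∈-slots⁺ {D} (T-slot (1≤a , a≤n) p) =
    ∈-++⁺ʳ (map inj₁ (filter (HSlot? D) (oneTo n))) (∈-map⁺ inj₂ (∈-filter⁺ (TSlot? D) (∈-oneTo⁺ 1≤a a≤n) p))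

  ∈-slots⁻ : ∀ {D s} → s ∈ slots D → Slot D s
  ∈-slots⁻ {D} s∈ with ∈-++⁻ (map inj₁ (filter (HSlot? D) (oneTo n))) s∈
  ... | inj₁ p with a , q , refl ← ∈-map⁻ inj₁ p with a∈ , h ← ∈-filter⁻ (HSlot? D) {xs = oneTo n} q = H-slot (∈-oneTo⁻ a∈) h
  ... | inj₂ p with a , q , refl ← ∈-map⁻ inj₂ p with a∈ , h ← ∈-filter⁻ (TSlot? D) {xs = oneTo n} q = T-slot (∈-oneTo⁻ a∈) h

  ∈-upperCovers⁻ : ∀ {x y} → Tamari x → y ∈ upperCovers n x → Tamari y × encode x ⋖ encode y
  ∈-upperCovers⁻ {x} tx y∈ with y∈T , c ← ∈-filter⁻ (T? ∘ coversT n x) {xs = Tam n} y∈ =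
    tamari⁻ y∈T , coversT⁻ tx (tamari⁻ y∈T) c

  ∈-lowerCovers⁻ : ∀ {x y} → Tamari x → y ∈ lowerCovers n x → Tamari y × encode y ⋖ encode x
  ∈-lowerCovers⁻ {x} tx y∈ with y∈T , c ← ∈-filter⁻ (T? ∘ (λ z → coversT n z x)) {xs = Tam n} y∈ =
    tamari⁻ y∈T , coversT⁻ (tamari⁻ y∈T) tx c

  length-upperCovers : ∀ {x} → Tamari x → length (upperCovers n x) ≡
    length (filter (HSlot? (encode x)) (oneTo n)) + length (filter (TSlot? (encode x)) (oneTo n))
  length-upperCovers {x} tx = trans
    (length-bijection (λ y s → encode y ≈ up D s) (Unique.filter⁺ (T? ∘ coversT n x) Tam-unique) (slots-unique D)
      (λ y∈ → let ty , c = ∈-upperCovers⁻ tx y∈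
                  s , σ , p , q = cover-up V (encode-valid ty) c in s , ∈-slots⁺ σ , p , q)
      (λ {s} s∈ → let σ = ∈-slots⁻ s∈
                      y , ty , p , q = realise (up-valid V σ) in
        y , ∈-filter⁺ (T? ∘ coversT n x) (tamari⁺ ty) (coversT⁺ tx ty (≈-⋖ʳ (up-cover V σ) (q , p))) , p , q)
      (λ y∈ y′∈ (p , q) (p′ , q′) → ⊑-antisym-perm (proj₁ (∈-upperCovers⁻ tx y∈))
          (proj₁ (∈-upperCovers⁻ tx y′∈)) (⊑-trans p q′) (⊑-trans p′ q))
      (λ s∈ s′∈ (p , q) (p′ , q′) → up-injective V (∈-slots⁻ s∈) (∈-slots⁻ s′∈) (⊑-trans q p′)))
    (trans (length-++ (map inj₁ (filter (HSlot? D) (oneTo n))))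
      (cong₂ _+_ (length-map inj₁ (filter (HSlot? D) (oneTo n))) (length-map inj₂ (filter (TSlot? D) (oneTo n)))))
    where
    D = encode x
    V = encode-valid tx

  meet : Data → List (List ℕ) → Data
  meet D []       = D
  meet D (y ∷ ys) = encode y ∧ᴰ meet D ys

  module _ {X : Data} (VX : Valid X) where

    meet-valid : ∀ {ys} → All Tamari ys → Valid (meet X ys)
    meet-valid []         = VX
    meet-valid (ty ∷ tys) = ∧ᴰ-valid (encode-valid ty) (meet-valid tys)

    meet-closed : ∀ {ys} → All (λ y → ArcClosed X (encode y)) ys → ArcClosed X (meet X ys)
    meet-closed []       = self-closed VX
    meet-closed (p ∷ ps) = ∧ᴰ-closed p (meet-closed ps)

    meet-⊑ : ∀ ys → meet X ys ⊑ X
    meet-⊑ []       = ⊑-refl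
    meet-⊑ (y ∷ ys) = ⊑-trans (∧ᴰ-⊑ʳ (encode y) _) (meet-⊑ ys)

    meet-⊑∈ : ∀ {y ys} → y ∈ ys → meet X ys ⊑ encode y
    meet-⊑∈ {ys = z ∷ zs} (here refl) = ∧ᴰ-⊑ˡ (encode z) (meet X zs)
    meet-⊑∈ {ys = z ∷ zs} (there y∈)  = ⊑-trans (∧ᴰ-⊑ʳ (encode z) (meet X zs)) (meet-⊑∈ y∈)

    meet-greatest : ∀ {W} ys → W ⊑ X → (∀ {y} → y ∈ ys → W ⊑ encode y) → W ⊑ meet X ys
    meet-greatest []       p f = p
    meet-greatest (y ∷ ys) p f = ∧ᴰ-greatest (f (here refl)) (meet-greatest ys p (f ∘ there))

  ArcClosed-≈ : ∀ {X D E} → D ≈ E → Valid E → ArcClosed X D → ArcClosed X E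
  ArcClosed-≈ (p , q) VE c = record
    { H-closed = λ ia a<c c≤ → ≤-trans (ArcClosed.H-closed c ia a<c (≤-trans c≤ (H-mono q ia))) (H-mono p ia)
    ; t-closed = λ im 1≤c c≤ → ≤-trans (ArcClosed.t-closed c im 1≤c (≤-trans c≤ (t-mono q im))) (t-mono p im)
    }

  module _ (1≤n : 1 ≤ n) {x b : List ℕ} (tx : Tamari x) (tb : Tamari b) (pop : T (isPopOf n x b)) where

    private
      X = encode x
      VX = encode-valid tx
      S : List (List ℕ)
      S = x ∷ lowerCovers n x
      ys = lowerCovers n x
      M = meet X ys
      lower : T (all (λ s → leqT n b s) S)
      lower = proj₁ (to (T-∧ {all (λ s → leqT n b s) S}) pop)
      maximal : T (all (λ w → not (all (λ s → leqT n w s) S) ∨ leqT n w b) (Tam n))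
      maximal = proj₂ (to (T-∧ {all (λ s → leqT n b s) S}) pop)
      tS : ∀ {s} → s ∈ S → Tamari s
      tS (here refl) = tx
      tS (there s∈)  = proj₁ (∈-lowerCovers⁻ tx s∈)
      below-all : ∀ {s} → s ∈ S → encode b ⊑ encode s
      below-all s∈ = leq⇒⊑ tb (tS s∈) (All.lookup (all⁺ (λ s → leqT n b s) S lower) s∈)
      below-cover : ∀ {Y} → Valid Y → Y ⋖ X → encode b ⊑ Y
      below-cover VY c with y , ty , p , q ← realise VY =
        ⊑-trans (below-all (there (∈-filter⁺ (T? ∘ (λ z → coversT n z x)) (tamari⁺ ty)
            (coversT⁺ ty tx (≈-⋖ˡ c (q , p)))))) p
      VM : Valid M
      VM = meet-valid VX (All.tabulate (tS ∘ there))
      M⊑ : ∀ {s} → s ∈ S → M ⊑ encode s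
      M⊑ (here refl) = meet-⊑ VX ys
      M⊑ (there s∈)  = meet-⊑∈ VX s∈
      M⊑b : M ⊑ encode b
      M⊑b = let w , tw , p , q = realise VM in
        ⊑-trans q (leq⇒⊑ tw tb (all-implies⁻ (λ w → all (λ s → leqT n w s) S) (λ w → leqT n w b)
            {xs = Tam n} maximal (tamari⁺ tw)
          (all⁻ (λ s → leqT n w s) {xs = S} (All.tabulate λ s∈ → ⊑⇒leq tw (tS s∈) (⊑-trans p (M⊑ s∈))))))
      -- The componentwise meet is realised in Tam(B_n), so it is `encode b` up to `≈`; each of its
      -- factors is closed under the arcs of `X`.
      closed : ArcClosed X (encode b)
      closed = ArcClosed-≈ (M⊑b , meet-greatest VX ys (below-all (here refl)) (below-all ∘ there)) (encode-valid tb)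
        (meet-closed VX (All.tabulate λ y∈ → cover-closed VX (encode-valid (tS (there y∈)))
            (proj₂ (∈-lowerCovers⁻ tx y∈))))

    isPopOf⇒image : Image (encode b)
    isPopOf⇒image = pop⇒image VX (encode-valid tb) 1≤n closed (below-all (here refl)) below-cover

  inPopImage⁻ : 1 ≤ n → ∀ {b} → Tamari b → T (inPopImage n b) → Image (encode b)
  inPopImage⁻ 1≤n {b} tb i =
    let x , x∈ , pop = ∈-any⁻ (λ x → isPopOf n x b) {Tam n} i in isPopOf⇒image 1≤n (tamari⁻ x∈) tb pop

  module _ {x b : List ℕ} (tx : Tamari x) (tb : Tamari b) (image : Image (encode b))
           (x≈ : encode x ≈ chain (encode b)) where

    private
      open IsPop (Chain.chain-pop (encode-valid tb) image)
      S : List (List ℕ)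
      S = x ∷ lowerCovers n x
      tS : ∀ {s} → s ∈ S → Tamari s
      tS (here refl) = tx
      tS (there s∈)  = proj₁ (∈-lowerCovers⁻ tx s∈)
      lower : ∀ {s} → s ∈ S → encode b ⊑ encode s
      lower (here refl) = ⊑-trans pop-⊑ (proj₂ x≈)
      lower (there s∈)  = pop-⋖ (encode-valid (tS (there s∈))) (≈-⋖ʳ (proj₂ (∈-lowerCovers⁻ tx s∈)) x≈)
      maximal : ∀ {w} → w ∈ Tam n → T (all (λ s → leqT n w s) S) → T (leqT n w b)
      maximal {w} w∈ a = ⊑⇒leq tw tb (pop-greatest (encode-valid tw) (⊑-trans (w⊑ (here refl)) (proj₁ x≈)) λ VY c →
          let y , ty , p′ , q′ = realise VY in
          ⊑-trans (w⊑ (there (∈-filter⁺ (T? ∘ (λ z → coversT n z x)) (tamari⁺ ty)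
              (coversT⁺ ty tx (≈-⋖ˡ (≈-⋖ʳ c (proj₂ x≈ , proj₁ x≈)) (q′ , p′)))))) p′)
        where
        tw = tamari⁻ w∈
        w⊑ : ∀ {s} → s ∈ S → encode w ⊑ encode s
        w⊑ s∈ = leq⇒⊑ tw (tS s∈) (All.lookup (all⁺ (λ s → leqT n w s) S a) s∈)

    chain⇒isPopOf : T (isPopOf n x b)
    chain⇒isPopOf = from (T-∧ {all (λ s → leqT n b s) S})
      ( all⁻ (λ s → leqT n b s) {xs = S} (All.tabulate λ s∈ → ⊑⇒leq tb (tS s∈) (lower s∈))
      , all-implies⁺ (λ w → all (λ s → leqT n w s) S) (λ w → leqT n w b) (Tam n) maximal)

  inPopImage⁺ : ∀ {b} → Tamari b → Image (encode b) → T (inPopImage n b)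
  inPopImage⁺ {b} tb image =
    let x , tx , x≈ = realise (Chain.chain-valid (encode-valid tb) image) in
    ∈-any⁺ (λ x → isPopOf n x b) (tamari⁺ tx) (chain⇒isPopOf tx tb image x≈)

-- Counting the image

-- A nonempty list of siblings, the last of which is a leaf.
data Siblings : Set where
  last : Siblings
  leaf : Siblings → Siblings
  node : (children later : Siblings) → Siblings

size : Siblings → ℕ
size last       = 1
size (leaf s)   = suc (size s)
size (node c s) = suc (size c + size s)

inner : Siblings → ℕ
inner last       = 0
inner (leaf s)   = inner s
inner (node c s) = suc (inner c + inner s)

sizes inners : List Siblings → ℕ
sizes  = foldr (λ s k → size s + k) 0
inners = foldr (λ s k → inner s + k) 0

data Step : Set where
  rise stay fall : Step

-- The east runs and the (nonempty) north runs, the ones next to the diagonal first.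
record Runs : Set where
  constructor runs
  field
    easts  : List Siblings
    head   : Siblings
    norths : List Siblings
open Runs public

-- With step, every size n + 1 is reached from size n in exactly three ways: when rise finds a single
-- north run, it moves it to the east runs and starts a new north run.
step : Step → Runs → Runs
step fall (runs es s ns)       = runs es last (s ∷ ns)
step stay (runs es s ns)       = runs es (leaf s) ns
step rise (runs es s [])       = runs (s ∷ es) last []
step rise (runs es s (r ∷ ns)) = runs es (node s r) ns

build : List Step → Runs
build = foldr step (runs [] last [])

weight : Runs → ℕ
weight (runs es s ns) = sizes es + (size s + sizes ns)

weight-step : ∀ x r → weight (step x r) ≡ suc (weight r)
weight-step fall (runs es s ns)       = +-suc (sizes es) _
weight-step stay (runs es s ns)       = +-suc (sizes es) _
weight-step rise (runs es s [])       =
  trans (+-comm (size s + sizes es) 1)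
      (cong suc (trans (+-comm (size s) (sizes es)) (cong (sizes es +_) (sym (+-identityʳ (size s))))))
weight-step rise (runs es s (r ∷ ns)) =
  trans (+-suc (sizes es) _) (cong (λ k → suc (sizes es + k)) (+-assoc (size s) (size r) (sizes ns)))

weight-build : ∀ v → weight (build v) ≡ suc (length v)
weight-build []      = refl
weight-build (x ∷ v) = trans (weight-step x (build v)) (cong suc (weight-build v))

#rise #fall : List Step → ℕ
#rise []      = 0
#rise (rise ∷ v) = suc (#rise v)
#rise (stay ∷ v) = #rise v
#rise (fall ∷ v) = #rise v
#fall []      = 0
#fall (rise ∷ v) = #fall v
#fall (stay ∷ v) = #fall v
#fall (fall ∷ v) = suc (#fall v)

-- This is n minus the number of upper covers. Every list of siblings, one per inner node and one
-- per run, has a last member without a slot; every north run makes up for its own by an addable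
-- rectangle.
rank : Runs → ℕ
rank (runs es s ns) = inners es + (inner s + inners ns) + length es

rank-build : ∀ v → rank (build v) ≡ #rise v
rank-build []      = refl
rank-build (fall ∷ v) = rank-build v
rank-build (stay ∷ v) = rank-build v
rank-build (rise ∷ v) with build v | rank-build v
... | runs es s [] | e = trans (+-suc (inner s + inners es + 0) (length es)) (cong suc (trans (cong (_+ length es)
      (trans (+-identityʳ _) (trans (+-comm (inner s) (inners es))
          (cong (inners es +_) (sym (+-identityʳ (inner s))))))) e))
... | runs es s (r ∷ ns) | e = trans (cong (_+ length es) (+-suc (inners es) _)) (cong suc (trans
      (cong (λ k → inners es + k + length es) (+-assoc (inner s) (inner r) (inners ns))) e))

-- `norths` omits the head: `fall` adds a north run, and `rise` uses one up or, if none is left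
-- besides the head, adds an east run.
balance-build : ∀ v → length (norths (build v)) + #rise v ≡ #fall v + length (easts (build v))
balance-build []      = refl
balance-build (fall ∷ v) = cong suc (balance-build v)
balance-build (stay ∷ v) = balance-build v
balance-build (rise ∷ v) with build v | balance-build v
... | runs es s []       | e = trans (cong suc e) (sym (+-suc (#fall v) (length es)))
... | runs es s (r ∷ ns) | e = trans (+-suc (length ns) (#rise v)) e

step-injective : ∀ x y r r′ → step x r ≡ step y r′ → (x ≡ y) × (r ≡ r′)
step-injective fall fall (runs _ _ _) (runs _ _ _) refl = refl , refl
step-injective stay stay (runs _ _ _) (runs _ _ _) refl = refl , refl
step-injective rise rise (runs _ _ []) (runs _ _ []) refl = refl , refl
step-injective rise rise (runs _ _ (_ ∷ _)) (runs _ _ (_ ∷ _)) refl = refl , refl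
step-injective rise rise (runs _ _ []) (runs _ _ (_ ∷ _)) ()
step-injective rise rise (runs _ _ (_ ∷ _)) (runs _ _ []) ()
step-injective fall stay (runs _ _ _) (runs _ _ _) ()
step-injective stay fall (runs _ _ _) (runs _ _ _) ()
step-injective fall rise (runs _ _ _) (runs _ _ []) ()
step-injective fall rise (runs _ _ _) (runs _ _ (_ ∷ _)) ()
step-injective rise fall (runs _ _ []) (runs _ _ _) ()
step-injective rise fall (runs _ _ (_ ∷ _)) (runs _ _ _) ()
step-injective stay rise (runs _ _ _) (runs _ _ []) ()
step-injective stay rise (runs _ _ _) (runs _ _ (_ ∷ _)) ()
step-injective rise stay (runs _ _ []) (runs _ _ _) ()
step-injective rise stay (runs _ _ (_ ∷ _)) (runs _ _ _) ()

size>0 : ∀ s → 0 < size s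
size>0 last       = s≤s z≤n
size>0 (leaf s)   = s≤s z≤n
size>0 (node c s) = s≤s z≤n

step-nonempty : ∀ x r → step x r ≢ runs [] last []
step-nonempty fall (runs es s ns)       ()
step-nonempty stay (runs es s ns)       ()
step-nonempty rise (runs es s [])       ()
step-nonempty rise (runs es s (r ∷ ns)) ()

build-injective : ∀ v v′ → build v ≡ build v′ → v ≡ v′
build-injective []      []       _ = refl
build-injective []      (y ∷ v′) e = contradiction (sym e) (step-nonempty y (build v′))
build-injective (x ∷ v) []       e = contradiction e (step-nonempty x (build v))
build-injective (x ∷ v) (y ∷ v′) e with refl , e′ ← step-injective x y (build v) (build v′) e =
  cong (x ∷_) (build-injective v v′ e′)

-- The last letter shows in the head: `leaf` means stay and `node` rise; a head `last` comes from
-- fall if further north runs exist, and from rise otherwise.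
unstep : ∀ r → (r ≡ runs [] last []) ⊎ ∃[ x ] ∃[ r′ ] r ≡ step x r′
unstep (runs [] last [])             = inj₁ refl
unstep (runs (e ∷ es) last [])       = inj₂ (rise , runs es e [] , refl)
unstep (runs es last (n ∷ ns))       = inj₂ (fall , runs es n ns , refl)
unstep (runs es (leaf s) ns)         = inj₂ (stay , runs es s ns , refl)
unstep (runs es (node c s) ns)       = inj₂ (rise , runs es c (s ∷ ns) , refl)

build-surjective : ∀ k r → weight r ≡ suc k → ∃[ v ] length v ≡ k × build v ≡ r
build-surjective k r e with unstep r
build-surjective zero    _ e | inj₁ refl = [] , refl , refl
build-surjective (suc k) _ () | inj₁ refl
build-surjective (suc k) _ e | inj₂ (x , r′ , refl) with v , l , b ← build-surjective k r′ (suc-injective (trans (sym (weight-step x r′)) e)) =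
  x ∷ v , cong suc l , cong (step x) b
build-surjective zero    _ e | inj₂ (x , r′ , refl) =
  contradiction (suc-injective (trans (sym (weight-step x r′)) e)) (>⇒≢ (positive r′))
  where
  positive : ∀ r → 0 < weight r
  positive (runs es s ns) = ≤-trans (size>0 s) (≤-trans (m≤m+n (size s) (sizes ns)) (m≤n+m _ (sizes es)))

data Side : Set where
  east north : Side

eastᵇ northᵇ : Side → ℕ
eastᵇ east  = 1
eastᵇ north = 0
northᵇ east  = 0
northᵇ north = 1

-- `centre` is the side of the first run off the diagonal, `outer` the side on which the path would
-- continue after its end.
record Code : Set where
  constructor code
  field
    steps        : List Step
    outer centre : Side
open Code public

-- A `north` outer side and an `east` centre count as falls; then alternation of the runs becomes
-- equality of `#rise` and `#down`.
#down : Code → ℕ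
#down (code v f τ) = #fall v + (northᵇ f + eastᵇ τ)

push : Step → Code → Code
push x (code v f τ) = code (x ∷ v) f τ

codes : ℕ → List Code
codes zero    = code [] east east ∷ code [] east north ∷ code [] north east ∷ code [] north north ∷ []
codes (suc k) = map (push rise) (codes k) ++ (map (push stay) (codes k) ++ map (push fall) (codes k))

push-injective : ∀ {x c c′} → push x c ≡ push x c′ → c ≡ c′
push-injective {c = code _ _ _} {code _ _ _} refl = refl

∈-codes⁺ : ∀ v f τ → code v f τ ∈ codes (length v)
∈-codes⁺ []      east  east  = here refl
∈-codes⁺ []      east  north = there (here refl)
∈-codes⁺ []      north east  = there (there (here refl))
∈-codes⁺ []      north north = there (there (there (here refl)))
∈-codes⁺ (rise ∷ v) f τ = ∈-++⁺ˡ (∈-map⁺ (push rise) (∈-codes⁺ v f τ))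
∈-codes⁺ (stay ∷ v) f τ = ∈-++⁺ʳ (map (push rise) (codes (length v))) (∈-++⁺ˡ (∈-map⁺ (push stay) (∈-codes⁺ v f τ)))
∈-codes⁺ (fall ∷ v) f τ = ∈-++⁺ʳ (map (push rise) (codes (length v)))
    (∈-++⁺ʳ (map (push stay) (codes (length v))) (∈-map⁺ (push fall) (∈-codes⁺ v f τ)))

∈-codes⁻ : ∀ k {c} → c ∈ codes k → length (steps c) ≡ k
∈-codes⁻ zero (here refl) = refl
∈-codes⁻ zero (there (here refl)) = refl
∈-codes⁻ zero (there (there (here refl))) = refl
∈-codes⁻ zero (there (there (there (here refl)))) = refl
∈-codes⁻ (suc k) c∈ with ∈-++⁻ (map (push rise) (codes k)) c∈
... | inj₁ p with _ , q , refl ← ∈-map⁻ (push rise) p = cong suc (∈-codes⁻ k q)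
... | inj₂ p with ∈-++⁻ (map (push stay) (codes k)) p
...   | inj₁ p′ with _ , q , refl ← ∈-map⁻ (push stay) p′ = cong suc (∈-codes⁻ k q)
...   | inj₂ p′ with _ , q , refl ← ∈-map⁻ (push fall) p′ = cong suc (∈-codes⁻ k q)

push-disjoint : ∀ {x y} k → x ≢ y → Disjoint (map (push x) (codes k)) (map (push y) (codes k))
push-disjoint {x} {y} k x≢y (p , q) with _ , _ , refl ← ∈-map⁻ (push x) p with _ , _ , refl ← ∈-map⁻ (push y) q =
  x≢y refl

codes-unique : ∀ k → Unique (codes k)
codes-unique zero = ((λ ()) ∷ (λ ()) ∷ (λ ()) ∷ []) ∷ ((λ ()) ∷ (λ ()) ∷ []) ∷ ((λ ()) ∷ []) ∷ [] ∷ []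
codes-unique (suc k) = Unique.++⁺ (u rise) (Unique.++⁺ (u stay) (u fall) (push-disjoint k λ ()))
  λ (p , q) → [ (λ q′ → push-disjoint {rise} {stay} k (λ ()) (p , q′)) ,
      (λ q′ → push-disjoint {rise} {fall} k (λ ()) (p , q′)) ]′ (∈-++⁻ (map (push stay) (codes k)) q)
  where
  u : ∀ x → Unique (map (push x) (codes k))
  u x = Unique.map⁺ push-injective (codes-unique k)

-- Counting words by their rises and falls.

count : {A : Set} → (A → Bool) → List A → ℕ
count p xs = length (filterᵇ p xs)

module _ {A : Set} where

  count-++ : ∀ (p : A → Bool) xs ys → count p (xs ++ ys) ≡ count p xs + count p ys
  count-++ p xs ys = trans (cong length (filter-++ (T? ∘ p) xs ys)) (length-++ (filterᵇ p xs))

  count-map : ∀ {B : Set} (p : B → Bool) (f : A → B) xs → count p (map f xs) ≡ count (p ∘ f) xs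
  count-map p f []       = refl
  count-map p f (x ∷ xs) with p (f x)
  ... | true  = cong suc (count-map p f xs)
  ... | false = count-map p f xs

  count-cong : ∀ {p q : A → Bool} → (∀ x → p x ≡ q x) → ∀ xs → count p xs ≡ count q xs
  count-cong e []       = refl
  count-cong {p} {q} e (x ∷ xs) with p x | q x | e x
  ... | true  | _ | refl = cong suc (count-cong e xs)
  ... | false | _ | refl = count-cong e xs

  count-none : ∀ (xs : List A) → count (λ _ → false) xs ≡ 0
  count-none []       = refl
  count-none (x ∷ xs) = count-none xs

hasStats : ℕ → ℕ → Code → Bool
hasStats u d c = (#rise (steps c) ≡ᵇ u) ∧ (#down c ≡ᵇ d)

codes-with : ℕ → ℕ → ℕ → ℕ
codes-with k u d = count (hasStats u d) (codes k)

-- The two sides act as two extra letters, each either stay or fall: the u letters rise occupy some of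
-- the first k positions, and the d letters fall some of the remaining k + 2 - u.
module _ where

  private
    rise-part stay-part fall-part : ℕ → ℕ → ℕ → ℕ
    rise-part k zero    d = 0
    rise-part k (suc u) d = codes-with k u d
    stay-part = codes-with
    fall-part k u zero    = 0
    fall-part k u (suc d) = codes-with k u d

    split : ∀ k u d → codes-with (suc k) u d ≡ rise-part k u d + (stay-part k u d + fall-part k u d)
    split k u d =
      trans (count-++ P (map (push rise) cs) _) (cong₂ _+_ (part-rise u)
        (trans (count-++ P (map (push stay) cs) _) (cong₂ _+_ (count-map P (push stay) cs) (part-fall d))))
      where
      cs = codes k
      P = hasStats u d
      part-rise : ∀ u → count (hasStats u d) (map (push rise) cs) ≡ rise-part k u d
      part-rise zero    = trans (count-map (hasStats 0 d) (push rise) cs) (count-none cs)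
      part-rise (suc u) = count-map (hasStats (suc u) d) (push rise) cs
      part-fall : ∀ d → count (hasStats u d) (map (push fall) cs) ≡ fall-part k u d
      part-fall zero    = trans (count-map (hasStats u 0) (push fall) cs)
        (trans (count-cong (λ c → ∧-zeroʳ (#rise (steps c) ≡ᵇ u)) cs) (count-none cs))
      part-fall (suc d) = count-map (hasStats u (suc d)) (push fall) cs

    pascal : ∀ m d → (m C d) + (m C suc d) ≡ suc m C suc d
    pascal m d = nCk+nC[k+1]≡[n+1]C[k+1] m d

  codes-count : ∀ k u d → codes-with k u d ≡ (k C u) * ((2 + k ∸ u) C d)
  codes-count zero    zero    zero                = refl
  codes-count zero    zero    (suc zero)          = refl
  codes-count zero    zero    (suc (suc zero))    = refl
  codes-count zero    zero    (suc (suc (suc d))) = sym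
      (trans (+-identityʳ _) (k>n⇒nCk≡0 {2} {suc (suc (suc d))} (s≤s (s≤s (s≤s z≤n)))))
  codes-count zero    (suc u) d                   = sym (cong (_* ((2 ∸ suc u) C d)) (k>n⇒nCk≡0 {0} {suc u} (s≤s z≤n)))
  codes-count (suc k) u       d = trans (split k u d) (trans (cong (rise-part k u d +_) (lower d)) (finish u))
    where
    lower : ∀ d → stay-part k u d + fall-part k u d ≡ (k C u) * ((3 + k ∸ u) C d)
    lower zero = trans (+-identityʳ _) (codes-count k u 0)
    lower (suc d) with ≤-<-connex u k
    ... | inj₁ u≤k = trans (cong₂ _+_ (codes-count k u (suc d)) (codes-count k u d))
        (trans (sym (*-distribˡ-+ (k C u) _ _))
            (cong ((k C u) *_) (trans (+-comm ((2 + k ∸ u) C suc d) _) (trans (pascal (2 + k ∸ u) d)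
              (cong (_C suc d) (sym (+-∸-assoc 1 (≤-trans u≤k (m≤n+m k 2)))))))))
    -- Truncated subtraction may break Pascal's rule here, but the factor `k C u` vanishes on both
    -- sides.
    ... | inj₂ k<u = trans (cong₂ _+_ (codes-count k u (suc d)) (codes-count k u d))
            (trans (cong₂ _+_ (vanish (2 + k ∸ u) (suc d)) (vanish (2 + k ∸ u) d)) (sym (vanish (3 + k ∸ u) (suc d))))
      where
      vanish : ∀ m d → (k C u) * (m C d) ≡ 0
      vanish m d = cong (_* (m C d)) (k>n⇒nCk≡0 k<u)
    finish : ∀ u → rise-part k u d + (k C u) * ((3 + k ∸ u) C d) ≡ (suc k C u) * ((3 + k ∸ u) C d)
    finish zero    = refl
    finish (suc u) = trans (cong (_+ (k C suc u) * ((2 + k ∸ u) C d)) (codes-count k u d))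
      (trans (sym (*-distribʳ-+ ((2 + k ∸ u) C d) (k C u) (k C suc u))) (cong (_* ((2 + k ∸ u) C d)) (pascal k u)))

sum-none : ∀ (e : ℕ → Bool) (g : ℕ → ℕ) ks → (∀ {k} → k ∈ ks → ¬ T (e k)) → sum
    (map (λ k → if e k then g k else 0) ks) ≡ 0
sum-none e g []       _ = refl
sum-none e g (k ∷ ks) f with e k in eq
... | true  = contradiction (from T-≡ eq) (f (here refl))
... | false = sum-none e g ks (f ∘ there)

sum-single : ∀ (e : ℕ → Bool) (g : ℕ → ℕ) {k₀} ks → Unique ks → k₀ ∈ ks → T (e k₀) →
    (∀ {k} → k ∈ ks → T (e k) → k ≡ k₀) →
             sum (map (λ k → if e k then g k else 0) ks) ≡ g k₀
sum-single e g (k ∷ ks) u (here refl) t f with e k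
... | true = trans (cong (g k +_) (sum-none e g ks λ k′∈ t′ → head∉ u (subst (_∈ ks) (f (there k′∈) t′) k′∈)))
    (+-identityʳ (g k))
sum-single e g (k ∷ ks) uu@(_ ∷ u) (there k₀∈) t f with e k in eq
... | true  = contradiction (subst (_∈ ks) (sym (f (here refl) (from T-≡ eq))) k₀∈) (head∉ uu)
... | false = sum-single e g ks u k₀∈ t (f ∘ there)

-- The arcs of H on (o , v] are those of the preorder traversal of a list of siblings.
data Fits (H : ℕ → ℕ) : ℕ → Siblings → ℕ → Set where
  last : ∀ {o} → H (suc o) ≡ suc o → Fits H o last (suc o)
  leaf : ∀ {o s v} → H (suc o) ≡ suc o → Fits H (suc o) s v → Fits H o (leaf s) v
  node : ∀ {o c s v} → Fits H (suc o) c (H (suc o)) → Fits H (H (suc o)) s v → Fits H o (node c s) v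

module _ {H : ℕ → ℕ} where

  fits-< : ∀ {o s v} → Fits H o s v → o < v
  fits-< (last _)   = ≤-refl
  fits-< (leaf _ q) = <⇒≤ (fits-< q)
  fits-< (node p q) = <⇒≤ (<-trans (fits-< p) (fits-< q))

  fits-size : ∀ {o s v} → Fits H o s v → v ≡ o + size s
  fits-size {o} (last _)   = +-comm 1 o
  fits-size {o} (leaf _ q) = trans (fits-size q) (sym (+-suc o _))
  fits-size {o} {node c s} (node p q) = trans (fits-size q) (trans (cong (_+ size s) (fits-size p))
      (assoc o (size c) (size s)))
    where
    assoc : ∀ o c s → suc (o + c) + s ≡ o + suc (c + s)
    assoc = solve-∀

  fits-range : ∀ {o s v x} → Fits H o s v → o < x → x ≤ v → x ≤ H x × H x ≤ v
  fits-range (last e) o<x x≤v with refl ← ≤-antisym o<x x≤v = ≤-reflexive (sym e) , ≤-reflexive e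
  fits-range (leaf e q) o<x x≤v with m≤n⇒m<n∨m≡n o<x
  ... | inj₁ lt   = fits-range q lt x≤v
  ... | inj₂ refl = ≤-reflexive (sym e) , ≤-trans (≤-reflexive e) x≤v
  fits-range {o} {x = x} (node p q) o<x x≤v with m≤n⇒m<n∨m≡n o<x
  ... | inj₂ refl = <⇒≤ (fits-< p) , <⇒≤ (fits-< q)
  ... | inj₁ lt with ≤-<-connex x (H (suc o))
  ...   | inj₁ le = let a , b = fits-range p lt le in a , ≤-trans b (<⇒≤ (fits-< q))
  ...   | inj₂ gt = fits-range q gt x≤v

  fits-nest : ∀ {o s v x c} → Fits H o s v → o < x → x ≤ v → x < c → c ≤ H x → H c ≤ H x
  fits-nest (last e) o<x x≤v x<c c≤ with refl ← ≤-antisym o<x x≤v = contradiction (≤-trans c≤ (≤-reflexive e)) (<⇒≱ x<c)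
  fits-nest (leaf e q) o<x x≤v x<c c≤ with m≤n⇒m<n∨m≡n o<x
  ... | inj₁ lt   = fits-nest q lt x≤v x<c c≤
  ... | inj₂ refl = contradiction (≤-trans c≤ (≤-reflexive e)) (<⇒≱ x<c)
  fits-nest {o} {x = x} (node p q) o<x x≤v x<c c≤ with m≤n⇒m<n∨m≡n o<x
  ... | inj₂ refl = proj₂ (fits-range p x<c c≤)
  ... | inj₁ lt with ≤-<-connex x (H (suc o))
  ...   | inj₁ le = fits-nest p lt le x<c c≤
  ...   | inj₂ gt = fits-nest q gt x≤v x<c c≤

  -- Whether `suc o` is a leaf, and whether it is the end `v`, decides the constructor at each node.
  fits-functional : ∀ {o s s′ v} → Fits H o s v → Fits H o s′ v → s ≡ s′
  fits-functional (last _)   (last _)     = refl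
  fits-functional (last _)   (leaf _ q)   = contradiction (fits-< q) (<-irrefl refl)
  fits-functional (last e)   (node p q)   = contradiction (fits-< p) (<⇒≱ (s≤s (≤-reflexive e)))
  fits-functional (leaf _ q) (last _)     = contradiction (fits-< q) (<-irrefl refl)
  fits-functional (leaf _ q) (leaf _ q′)  = cong leaf (fits-functional q q′)
  fits-functional (leaf e _) (node p q)   = contradiction (fits-< p) (<⇒≱ (s≤s (≤-reflexive e)))
  fits-functional (node p q) (last e)     = contradiction (fits-< p) (<⇒≱ (s≤s (≤-reflexive e)))
  fits-functional (node p q) (leaf e _)   = contradiction (fits-< p) (<⇒≱ (s≤s (≤-reflexive e)))
  fits-functional (node p q) (node p′ q′) = cong₂ node (fits-functional p p′) (fits-functional q q′)

fits-agree : ∀ {H H′ o s v} → Fits H o s v → Fits H′ o s v → ∀ {x} → o < x → x ≤ v → H x ≡ H′ x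
fits-agree (last e) (last e′) o<x x≤v with refl ← ≤-antisym o<x x≤v = trans e (sym e′)
fits-agree (leaf e q) (leaf e′ q′) o<x x≤v with m≤n⇒m<n∨m≡n o<x
... | inj₁ lt   = fits-agree q q′ lt x≤v
... | inj₂ refl = trans e (sym e′)
fits-agree {H} {H′} {o} (node p q) (node p′ q′) {x} o<x x≤v with w≡ ← trans (fits-size p) (sym (fits-size p′)) with m≤n⇒m<n∨m≡n o<x
... | inj₂ refl = w≡
... | inj₁ lt with ≤-<-connex x (H (suc o))
...   | inj₁ le = fits-agree p (subst (Fits H′ (suc o) _) (sym w≡) p′) lt le
...   | inj₂ gt = fits-agree q (subst (λ w → Fits H′ w _ _) (sym w≡) q′) gt x≤v

fits-cong : ∀ {H H′ o s v} → (∀ {x} → o < x → x ≤ v → H x ≡ H′ x) → Fits H o s v → Fits H′ o s v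
fits-cong f (last e)   = last (trans (sym (f ≤-refl ≤-refl)) e)
fits-cong f (leaf e q) = leaf (trans (sym (f ≤-refl (<⇒≤ (fits-< q)))) e) (fits-cong (λ l → f (<⇒≤ l)) q)
fits-cong {H} {H′} {o} {node c s} {v} f (node p q) = node
  (subst (Fits H′ (suc o) c) e (fits-cong (λ l u → f (<⇒≤ l) (≤-trans u (<⇒≤ (fits-< q)))) p))
  (subst (λ w → Fits H′ w s v) e (fits-cong (λ l u → f (<⇒≤ (<-trans (fits-< p) l)) u) q))
  where
  e : H (suc o) ≡ H′ (suc o)
  e = f ≤-refl (<⇒≤ (<-trans (fits-< p) (fits-< q)))

paste : ℕ → (ℕ → ℕ) → (ℕ → ℕ) → ℕ → ℕ
paste w f g x with x ≤? w
... | yes _ = f x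
... | no  _ = g x

paste-≤ : ∀ {w} f g {x} → x ≤ w → paste w f g x ≡ f x
paste-≤ {w} f g {x} x≤w with x ≤? w
... | yes _  = refl
... | no x≰w = contradiction x≤w x≰w

paste-> : ∀ {w} f g {x} → w < x → paste w f g x ≡ g x
paste-> {w} f g {x} w<x with x ≤? w
... | yes x≤w = contradiction x≤w (<⇒≱ w<x)
... | no _    = refl

arcs : Siblings → ℕ → ℕ → ℕ
arcs last       o = id
arcs (leaf s)   o = paste (suc o) id (arcs s (suc o))
arcs (node c s) o = paste (suc o) (λ _ → suc o + size c)
                      (paste (suc o + size c) (arcs c (suc o)) (arcs s (suc o + size c)))

fits-arcs : ∀ s o → Fits (arcs s o) o s (o + size s)
fits-arcs last       o = subst (Fits id o last) (+-comm 1 o) (last refl)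
fits-arcs (leaf s)   o = subst (Fits (arcs (leaf s) o) o (leaf s)) (sym (+-suc o (size s)))
  (leaf (paste-≤ id (arcs s (suc o)) ≤-refl) (fits-cong (λ l _ → sym (paste-> id (arcs s (suc o)) l))
      (fits-arcs s (suc o))))
fits-arcs (node c s) o = subst (Fits h o (node c s)) (assoc o (size c) (size s))
  (node (subst (Fits h (suc o) c) (sym e)
      (fits-cong (λ l u → sym (trans (paste-> (λ _ → w) g l) (paste-≤ (arcs c (suc o)) (arcs s w) u)))
      (fits-arcs c (suc o))))
        (subst (λ z → Fits h z s (w + size s)) (sym e)
          (fits-cong (λ l _ → sym (trans (paste-> (λ _ → w) g (≤-trans (s≤s (m≤m+n (suc o) (size c))) l))
              (paste-> (arcs c (suc o)) (arcs s w) l))) (fits-arcs s w))))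
  where
  w = suc o + size c
  h = arcs (node c s) o
  g = paste w (arcs c (suc o)) (arcs s w)
  e : h (suc o) ≡ w
  e = paste-≤ {suc o} (λ _ → w) g ≤-refl
  assoc : ∀ o c s → suc (o + c) + s ≡ o + suc (c + s)
  assoc = solve-∀

tally : ∀ {P : ℕ → Set} → (∀ x → Dec (P x)) → ℕ → ℕ
tally P? zero    = 0
tally P? (suc m) with P? (suc m)
... | yes _ = suc (tally P? m)
... | no  _ = tally P? m

module _ {P : ℕ → Set} (P? : ∀ x → Dec (P x)) where

  tally-yes : ∀ {m} → P (suc m) → tally P? (suc m) ≡ suc (tally P? m)
  tally-yes {m} p with P? (suc m)
  ... | yes _ = refl
  ... | no ¬p = contradiction p ¬p

  tally-no : ∀ {m} → ¬ P (suc m) → tally P? (suc m) ≡ tally P? m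
  tally-no {m} ¬p with P? (suc m)
  ... | yes p = contradiction p ¬p
  ... | no _  = refl

  tally-none : ∀ {o v} → o ≤ v → (∀ {x} → o < x → x ≤ v → ¬ P x) → tally P? v ≡ tally P? o
  tally-none {o} {zero}  z≤n _ = refl
  tally-none {o} {suc v} o≤v f with m≤n⇒m<n∨m≡n o≤v
  ... | inj₂ refl = refl
  ... | inj₁ o<   = trans (tally-no (f o< ≤-refl)) (tally-none (s≤s⁻¹ o<) (λ l u → f l (m≤n⇒m≤1+n u)))

  private
    oneTo-suc : ∀ m → oneTo (suc m) ≡ oneTo m ++ [ suc m ]
    oneTo-suc m = trans (cong (map suc) (sym (upTo-∷ʳ m))) (map-++ suc (upTo m) [ m ])

  length-oneTo : ∀ m → length (filter P? (oneTo m)) ≡ tally P? m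
  length-oneTo zero    = refl
  length-oneTo (suc m) = trans (cong (length ∘ filter P?) (oneTo-suc m))
      (trans (cong length (filter-++ P? (oneTo m) [ suc m ]))
    (trans (length-++ (filter P? (oneTo m))) (trans (cong (_+ length (filter P? [ suc m ])) (length-oneTo m)) end)))
    where
    end : tally P? m + length (filter P? [ suc m ]) ≡ tally P? (suc m)
    end with P? (suc m)
    ... | yes _ = +-comm (tally P? m) 1
    ... | no _  = +-identityʳ (tally P? m)

-- The lattice path of runs.

module Boundary (n : ℕ) where
  open Link n public

  -- Walks outwards from the diagonal: the roots ≤ s and > u remain to be treated, and the next
  -- run is on side τ.  An east run (s′ , s] has rows of length u, a north run (u , u′] rows of length s.
  -- At the end, the next run would be on side f.
  data Outer (D : Data) (f : Side) : Side → ℕ → ℕ → List Siblings → List Siblings → Set where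
    done  : Outer D f f 0 n [] []
    north : ∀ {s u u′ r es ns} → Fits (H D) u r u′ → (∀ {x} → u < x → x ≤ u′ → t D x ≡ s) →
            Outer D f east s u′ es ns → Outer D f north s u es (r ∷ ns)
    east  : ∀ {s s′ u r es ns} → Fits (H D) s′ r s → (∀ {x} → s′ < x → x ≤ s → t D x ≡ u) →
            Outer D f north s′ u es ns → Outer D f east s u (r ∷ es) ns

  outer-≤n : ∀ {D f τ s u es ns} → Outer D f τ s u es ns → u ≤ n
  outer-≤n done          = ≤-refl
  outer-≤n (north p _ o) = ≤-trans (<⇒≤ (fits-< p)) (outer-≤n o)
  outer-≤n (east _ _ o)  = outer-≤n o

  outer-sizes : ∀ {D f τ s u es ns} → Outer D f τ s u es ns → s ≡ sizes es × n ≡ u + sizes ns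
  outer-sizes done = refl , sym (+-identityʳ n)
  outer-sizes {u = u} {ns = r ∷ ns} (north p _ o) with a , b ← outer-sizes o =
    a , trans b (trans (cong (_+ sizes ns) (fits-size p)) (+-assoc u (size r) (sizes ns)))
  outer-sizes {es = r ∷ es} (east {s′ = s′} p _ o) with a , b ← outer-sizes o =
    trans (fits-size p) (trans (cong (_+ size r) a) (+-comm (sizes es) (size r))) , b

  -- East and north runs alternate, so only the sides at the two ends decide which kind is ahead.
  outer-balance : ∀ {D f τ s u es ns} → Outer D f τ s u es ns → length ns + northᵇ f ≡ length es + northᵇ τ
  outer-balance done = refl
  outer-balance {es = es} (north _ _ o) = trans (cong suc (outer-balance o)) (sym (+-suc (length es) 0))
  outer-balance {es = _ ∷ es} (east _ _ o) = trans (outer-balance o) (+-suc (length es) 0)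

  -- The nodes that a given `Outer` describes; for s = u, on the diagonal, these are all.
  Done : ℕ → ℕ → ℕ → Set
  Done s u x = In x × (x ≤ s ⊎ u < x)

  done-empty : ∀ {x} → ¬ Done 0 n x
  done-empty ((1≤x , _) , inj₁ x≤0) = <⇒≱ 1≤x x≤0
  done-empty ((_ , x≤n) , inj₂ n<x) = <⇒≱ n<x x≤n

  outer-low : ∀ {D f τ s u es ns x} → Outer D f τ s u es ns → 1 ≤ x → x ≤ s → u ≤ t D x
  outer-low done 1≤x x≤0 = contradiction (≤-trans 1≤x x≤0) λ ()
  outer-low (north p _ o) 1≤x x≤s = ≤-trans (<⇒≤ (fits-< p)) (outer-low o 1≤x x≤s)
  outer-low {x = x} (east {s′ = s′} _ f o) 1≤x x≤s with ≤-<-connex x s′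
  ... | inj₁ le = outer-low o 1≤x le
  ... | inj₂ gt = ≤-reflexive (sym (f gt x≤s))

  outer-high : ∀ {D f τ s u es ns x} → Outer D f τ s u es ns → u < x → x ≤ n → t D x ≤ s
  outer-high done u<x x≤n = contradiction x≤n (<⇒≱ u<x)
  outer-high {x = x} (north {u′ = u′} _ f o) u<x x≤n with ≤-<-connex x u′
  ... | inj₁ le = ≤-reflexive (f u<x le)
  ... | inj₂ gt = outer-high o gt x≤n
  outer-high (east p _ o) u<x x≤n = ≤-trans (outer-high o u<x x≤n) (<⇒≤ (fits-< p))

  outer-H-low : ∀ {D f τ s u es ns x} → Outer D f τ s u es ns → 1 ≤ x → x ≤ s → x ≤ H D x × H D x ≤ s
  outer-H-low done 1≤x x≤0 = contradiction (≤-trans 1≤x x≤0) λ ()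
  outer-H-low (north _ _ o) 1≤x x≤s = outer-H-low o 1≤x x≤s
  outer-H-low {x = x} (east {s′ = s′} p _ o) 1≤x x≤s with ≤-<-connex x s′
  ... | inj₁ le = let a , b = outer-H-low o 1≤x le in a , ≤-trans b (<⇒≤ (fits-< p))
  ... | inj₂ gt = fits-range p gt x≤s

  outer-H-high : ∀ {D f τ s u es ns x} → Outer D f τ s u es ns → u < x → x ≤ n → x ≤ H D x × H D x ≤ n
  outer-H-high done u<x x≤n = contradiction x≤n (<⇒≱ u<x)
  outer-H-high {x = x} (north {u′ = u′} p _ o) u<x x≤n with ≤-<-connex x u′
  ... | inj₁ le = let a , b = fits-range p u<x le in a , ≤-trans b (outer-≤n o)
  ... | inj₂ gt = outer-H-high o gt x≤n
  outer-H-high (east _ _ o) u<x x≤n = outer-H-high o u<x x≤n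

  outer-H-nest : ∀ {D f τ s u es ns x c} → Outer D f τ s u es ns → Done s u x → x < c → c ≤ H D x → H D c ≤ H D x
  outer-H-nest done d = ⊥-elim (done-empty d)
  outer-H-nest (north p _ o) (ix , inj₁ x≤s) = outer-H-nest o (ix , inj₁ x≤s)
  outer-H-nest {x = x} (north {u′ = u′} p _ o) (ix , inj₂ u<x) with ≤-<-connex x u′
  ... | inj₁ le = fits-nest p u<x le
  ... | inj₂ gt = outer-H-nest o (ix , inj₂ gt)
  outer-H-nest (east p _ o) (ix , inj₂ u<x) = outer-H-nest o (ix , inj₂ u<x)
  outer-H-nest {x = x} (east {s′ = s′} p _ o) (ix , inj₁ x≤s) with ≤-<-connex x s′
  ... | inj₁ le = outer-H-nest o (ix , inj₁ le)
  ... | inj₂ gt = fits-nest p gt x≤s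

  Closed-north : ∀ {D u u′ r} → Fits (H D) u r u′ → Closed D u → Closed D u′
  Closed-north {u = u} p cl {c} 1≤c c≤ with ≤-<-connex c u
  ... | inj₁ le = ≤-trans (cl 1≤c le) (<⇒≤ (fits-< p))
  ... | inj₂ gt = proj₂ (fits-range p gt c≤)

  -- `Closed D u` supplies what `Outer` does not record, the arcs between s and u.
  outer-t-nest : ∀ {D f τ s u es ns m c} → Outer D f τ s u es ns → Closed D u → Done s u m →
                 1 ≤ c → c ≤ t D m → H D c ≤ t D m
  outer-t-nest done _ d = ⊥-elim (done-empty d)
  outer-t-nest {D} (north p _ o) cl (im , inj₁ m≤s) = outer-t-nest o (Closed-north {D} p cl) (im , inj₁ m≤s)
  outer-t-nest {D} {m = m} {c} (north {u′ = u′} p f o) cl (im , inj₂ u<m) 1≤c c≤ with ≤-<-connex m u′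
  ... | inj₂ gt = outer-t-nest o (Closed-north {D} p cl) (im , inj₂ gt) 1≤c c≤
  ... | inj₁ le = ≤-trans (proj₂ (outer-H-low o 1≤c (≤-trans c≤ (≤-reflexive (f u<m le)))))
      (≤-reflexive (sym (f u<m le)))
  outer-t-nest (east p _ o) cl (im , inj₂ u<m) = outer-t-nest o cl (im , inj₂ u<m)
  outer-t-nest {m = m} (east {s′ = s′} p f o) cl (im , inj₁ m≤s) 1≤c c≤ with ≤-<-connex m s′
  ... | inj₁ le = outer-t-nest o cl (im , inj₁ le) 1≤c c≤
  ... | inj₂ gt = ≤-trans (cl 1≤c (≤-trans c≤ (≤-reflexive (f gt m≤s)))) (≤-reflexive (sym (f gt m≤s)))

  outer-t-≤n : ∀ {D f τ s u es ns m} → Outer D f τ s u es ns → s ≤ u → Done s u m → t D m ≤ n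
  outer-t-≤n done _ d = ⊥-elim (done-empty d)
  outer-t-≤n o@(north _ _ _) s≤u ((_ , m≤n) , inj₂ u<m) = ≤-trans (outer-high o u<m m≤n) (≤-trans s≤u (outer-≤n o))
  outer-t-≤n (north p _ o) s≤u (im , inj₁ m≤s) = outer-t-≤n o (≤-trans s≤u (<⇒≤ (fits-< p))) (im , inj₁ m≤s)
  outer-t-≤n (east p _ o) s≤u (im , inj₂ u<m) = outer-t-≤n o (≤-trans (<⇒≤ (fits-< p)) s≤u) (im , inj₂ u<m)
  outer-t-≤n {m = m} (east {s′ = s′} p f o) s≤u (im , inj₁ m≤s) with ≤-<-connex m s′
  ... | inj₁ le = outer-t-≤n o (≤-trans (<⇒≤ (fits-< p)) s≤u) (im , inj₁ le)
  ... | inj₂ gt = ≤-trans (≤-reflexive (f gt m≤s)) (outer-≤n o)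

  outer-t-sym : ∀ {D f τ s u es ns m c} → Outer D f τ s u es ns → s ≤ u → Done s u m → Done s u c → c ≤ t D m →
      m ≤ t D c
  outer-t-sym done _ d = ⊥-elim (done-empty d)
  outer-t-sym {D} {f} {s = s} {m = m} {c} o₀@(north {u = u} {u′} p f₀ o) s≤u (im , dm) (ic , dc) c≤ = go dm dc
    where
    s≤u′ = ≤-trans s≤u (<⇒≤ (fits-< p))
    go : m ≤ s ⊎ u < m → c ≤ s ⊎ u < c → m ≤ t D c
    go (inj₁ m≤s) (inj₁ c≤s) = outer-t-sym o s≤u′ (im , inj₁ m≤s) (ic , inj₁ c≤s) c≤
    go (inj₁ m≤s) (inj₂ u<c) with ≤-<-connex c u′
    ... | inj₁ le = ≤-trans m≤s (≤-reflexive (sym (f₀ u<c le)))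
    ... | inj₂ gt = outer-t-sym o s≤u′ (im , inj₁ m≤s) (ic , inj₂ gt) c≤
    go (inj₂ u<m) (inj₂ u<c) = contradiction (≤-trans c≤ (≤-trans (outer-high o₀ u<m (proj₂ im)) s≤u)) (<⇒≱ u<c)
    go (inj₂ u<m) (inj₁ c≤s) with ≤-<-connex m u′
    ... | inj₁ le = ≤-trans le (outer-low o (proj₁ ic) c≤s)
    ... | inj₂ gt = outer-t-sym o s≤u′ (im , inj₂ gt) (ic , inj₁ c≤s) c≤
  outer-t-sym {D} {m = m} {c} o₀@(east {s} {s′} {u} p f₀ o) s≤u (im , dm) (ic , dc) c≤ = go dm dc
    where
    s′≤u = ≤-trans (<⇒≤ (fits-< p)) s≤u
    go : m ≤ s ⊎ u < m → c ≤ s ⊎ u < c → m ≤ t D c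
    go (inj₁ m≤s) (inj₁ c≤s) = ≤-trans (≤-trans m≤s s≤u) (outer-low o₀ (proj₁ ic) c≤s)
    go (inj₁ m≤s) (inj₂ u<c) with ≤-<-connex m s′
    ... | inj₁ le = outer-t-sym o s′≤u (im , inj₁ le) (ic , inj₂ u<c) c≤
    ... | inj₂ gt = contradiction (≤-trans c≤ (≤-reflexive (f₀ gt m≤s))) (<⇒≱ u<c)
    go (inj₂ u<m) (inj₂ u<c) = contradiction (≤-trans c≤ (≤-trans (outer-high o₀ u<m (proj₂ im)) s≤u)) (<⇒≱ u<c)
    go (inj₂ u<m) (inj₁ c≤s) = outer-t-sym o s′≤u (im , inj₂ u<m)
      (ic , inj₁ (≤-trans c≤ (outer-high o u<m (proj₂ im)))) c≤

  all-done : ∀ {p x} → In x → Done p p x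
  all-done {p} {x} ix = ix , ≤-<-connex x p

  outer-valid : ∀ {D f τ p es ns} → Outer D f τ p p es ns → Valid D
  outer-valid {D} {p = p} o = record
    { H-lower = λ ix → proj₁ (range ix)
    ; H-upper = λ ix → proj₂ (range ix)
    ; t-upper = λ im → outer-t-≤n o ≤-refl (all-done im)
    ; H-nest = λ ix → outer-H-nest o (all-done ix)
    ; t-nest = λ im → outer-t-nest o (λ 1≤c c≤ → proj₂ (outer-H-low o 1≤c c≤)) (all-done im)
    ; t-sym = λ im 1≤c c≤ → outer-t-sym o ≤-refl (all-done im)
        (all-done (1≤c , ≤-trans c≤ (outer-t-≤n o ≤-refl (all-done im)))) c≤
    }
    where
    range : ∀ {x} → In x → x ≤ H D x × H D x ≤ n
    range {x} (1≤x , x≤n) with ≤-<-connex x p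
    ... | inj₁ le = let a , b = outer-H-low o 1≤x le in a , ≤-trans b (≤-trans (outer-≤n o) ≤-refl)
    ... | inj₂ gt = outer-H-high o gt x≤n

  outer-cong : ∀ {D D′ f τ s u es ns} → s ≤ u → (∀ {x} → Done s u x → H D x ≡ H D′ x × t D x ≡ t D′ x) →
               Outer D f τ s u es ns → Outer D′ f τ s u es ns
  outer-cong s≤u g done = done
  outer-cong s≤u g (north p f o) = north
    (fits-cong (λ l u → proj₁ (g ((≤-trans (s≤s z≤n) l , ≤-trans u (outer-≤n o)) , inj₂ l))) p)
    (λ l u → trans (sym (proj₂ (g ((≤-trans (s≤s z≤n) l , ≤-trans u (outer-≤n o)) , inj₂ l)))) (f l u))
    (outer-cong (≤-trans s≤u (<⇒≤ (fits-< p)))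
        (λ (ix , d) → g (ix , [ inj₁ , (λ l → inj₂ (<-trans (fits-< p) l)) ]′ d)) o)
  outer-cong s≤u g (east p f o) = east
    (fits-cong (λ l u → proj₁ (g ((≤-trans (s≤s z≤n) l , ≤-trans u (≤-trans s≤u (outer-≤n o))) , inj₁ u))) p)
    (λ l u → trans (sym (proj₂ (g ((≤-trans (s≤s z≤n) l , ≤-trans u (≤-trans s≤u (outer-≤n o))) , inj₁ u)))) (f l u))
    (outer-cong (≤-trans (<⇒≤ (fits-< p)) s≤u)
        (λ (ix , d) → g (ix , [ (λ l → inj₁ (≤-trans l (<⇒≤ (fits-< p)))) , inj₂ ]′ d)) o)

  outer-agree : ∀ {D D′ f τ s u es ns x} → Outer D f τ s u es ns → Outer D′ f τ s u es ns →
                Done s u x → H D x ≡ H D′ x × t D x ≡ t D′ x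
  outer-agree done done d = ⊥-elim (done-empty d)
  outer-agree {x = x} (north {u′ = u′} p f o) (north p′ f′ o′) (ix , d)
    with refl ← trans (fits-size p) (sym (fits-size p′)) with d
  ... | inj₁ x≤s = outer-agree o o′ (ix , inj₁ x≤s)
  ... | inj₂ u<x with ≤-<-connex x u′
  ...   | inj₁ le = fits-agree p p′ u<x le , trans (f u<x le) (sym (f′ u<x le))
  ...   | inj₂ gt = outer-agree o o′ (ix , inj₂ gt)
  outer-agree {x = x} (east {s′ = s′} {r = r} p f o) (east p′ f′ o′) (ix , d)
    with refl ← +-cancelʳ-≡ (size r) _ _ (trans (sym (fits-size p)) (fits-size p′)) with d
  ... | inj₂ u<x = outer-agree o o′ (ix , inj₂ u<x)
  ... | inj₁ x≤s with ≤-<-connex x s′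
  ...   | inj₁ le = outer-agree o o′ (ix , inj₁ le)
  ...   | inj₂ gt = fits-agree p p′ gt x≤s , trans (f gt x≤s) (sym (f′ gt x≤s))

  -- The recursive call provides the outer runs, and the present run is pasted into the gap that
  -- they leave. The balance equation excludes the cases where a run is missing on the side whose
  -- turn it is.
  realise-runs : ∀ f τ u es ns → sizes es ≤ u → n ≡ u + sizes ns → length ns + northᵇ f ≡ length es + northᵇ τ →
                 ∃[ D ] Outer D f τ (sizes es) u es ns
  realise-runs north north u [] []       _ e _ = ⟨ id , id ⟩ , subst (λ z → Outer _ north north 0 z [] [])
      (trans e (+-identityʳ u)) done
  realise-runs east  east  u [] []       _ e _ = ⟨ id , id ⟩ , subst (λ z → Outer _ east east 0 z [] [])
      (trans e (+-identityʳ u)) done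
  realise-runs east  north u [] []       _ _ ()
  realise-runs north north u (_ ∷ es) [] _ _ b = contradiction (trans (suc-injective b) (+-comm (length es) 1)) λ ()
  realise-runs east  north u (_ ∷ es) [] _ _ ()
  realise-runs north east  u [] []       _ _ ()
  realise-runs f     east  u [] (_ ∷ ns) _ _ ()
  realise-runs f     north u es (r ∷ ns) le e b
    with D , o ← realise-runs f east (u + size r) es ns (≤-trans le (m≤m+n u (size r))) (trans e (sym (+-assoc u (size r) (sizes ns))))
                   (suc-injective (trans b (+-suc (length es) 0))) =
    D′ , north (fits-cong (λ l v → sym (trans (paste-> (H D) h l) (paste-≤ (arcs r u) (H D) v))) (fits-arcs r u))
               (λ l v → trans (paste-> (t D) k l) (paste-≤ (λ _ → sizes es) (t D) v))
               (outer-cong (≤-trans le (m≤m+n u (size r))) agree o)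
    where
    h = paste (u + size r) (arcs r u) (H D)
    k = paste (u + size r) (λ _ → sizes es) (t D)
    D′ = ⟨ paste u (H D) h , paste u (t D) k ⟩
    agree : ∀ {x} → Done (sizes es) (u + size r) x → H D x ≡ H D′ x × t D x ≡ t D′ x
    agree (ix , inj₁ x≤) = sym (paste-≤ (H D) h (≤-trans x≤ le)) , sym (paste-≤ (t D) k (≤-trans x≤ le))
    agree (ix , inj₂ x>) =
      sym (trans (paste-> (H D) h (≤-<-trans (m≤m+n u (size r)) x>)) (paste-> (arcs r u) (H D) x>)) ,
      sym (trans (paste-> (t D) k (≤-<-trans (m≤m+n u (size r)) x>)) (paste-> (λ _ → sizes es) (t D) x>))
  realise-runs f     east  u (r ∷ es) ns le e b
    with D , o ← realise-runs f north u es ns (≤-trans (m≤n+m (sizes es) (size r)) le) e (trans b (sym (+-suc (length es) 0))) =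
    D′ , east (subst (Fits (H D′) (sizes es) r) (+-comm (sizes es) (size r))
                (fits-cong (λ l v → sym (trans (paste-> (H D) h l)
                    (paste-≤ (arcs r (sizes es)) (H D) (≤-trans v (≤-reflexive (+-comm (sizes es) (size r)))))))
                  (fits-arcs r (sizes es))))
              (λ l v → trans (paste-> (t D) k l) (paste-≤ (λ _ → u) (t D) v))
              (outer-cong (≤-trans (m≤n+m (sizes es) (size r)) le) agree o)
    where
    w = size r + sizes es
    h = paste w (arcs r (sizes es)) (H D)
    k = paste w (λ _ → u) (t D)
    D′ = ⟨ paste (sizes es) (H D) h , paste (sizes es) (t D) k ⟩
    agree : ∀ {x} → Done (sizes es) u x → H D x ≡ H D′ x × t D x ≡ t D′ x
    agree (ix , inj₁ x≤) = sym (paste-≤ (H D) h x≤) , sym (paste-≤ (t D) k x≤)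
    agree (ix , inj₂ x>) =
      sym (trans (paste-> (H D) h (≤-<-trans (≤-trans (m≤n+m (sizes es) (size r)) le) x>))
          (paste-> (arcs r (sizes es)) (H D) (≤-<-trans le x>))) ,
      sym (trans (paste-> (t D) k (≤-<-trans (≤-trans (m≤n+m (sizes es) (size r)) le) x>))
          (paste-> (λ _ → u) (t D) (≤-<-trans le x>)))

-- Slots along the path, and uniqueness of the path.

module Analysis (n : ℕ) where
  open Boundary n public

  tallyH tallyT : Data → ℕ → ℕ
  tallyH D = tally (HSlot? D)
  tallyT D = tally (TSlot? D)

  module _ {D : Data} (V : Valid D) where
    open Valid V

    private
      sibling-hull : ∀ {a v w} → In a → H D a ≡ w → hull D a ≡ v → w < v → HSlot D a × hull D (suc w) ≡ v
      sibling-hull ia refl refl w<v = slot , hull-sibling V ia slot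
        where
        slot : HSlot D _
        slot e = <-irrefl (sym e) w<v

    fits-slot : ∀ {o s v x} → Fits (H D) o s v → v ≤ n → hull D (suc o) ≡ v → o < x → x ≤ v → H D x ≢ x → HSlot D x
    fits-slot (last e) v≤n h o<x x≤v H≢ with refl ← ≤-antisym o<x x≤v = contradiction e H≢
    fits-slot {o} (leaf e q) v≤n h o<x x≤v H≢ with m≤n⇒m<n∨m≡n o<x
    ... | inj₁ lt   = fits-slot q v≤n
        (proj₂ (sibling-hull (s≤s z≤n , ≤-trans o<x (≤-trans x≤v v≤n)) e h (fits-< q))) lt x≤v H≢
    ... | inj₂ refl = contradiction e H≢
    fits-slot {o} {x = x} (node p q) v≤n h o<x x≤v H≢ with m≤n⇒m<n∨m≡n o<x
    ... | inj₂ refl = proj₁ (sibling-hull (s≤s z≤n , ≤-trans x≤v v≤n) refl h (fits-< q))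
    ... | inj₁ lt with ≤-<-connex x (H D (suc o))
    ...   | inj₁ le = fits-slot p (≤-trans (<⇒≤ (fits-< q)) v≤n)
        (hull-child V (s≤s z≤n , ≤-trans (<⇒≤ lt) (≤-trans x≤v v≤n)) (fits-< p)) lt le H≢
    ...   | inj₂ gt = fits-slot q v≤n
        (proj₂ (sibling-hull (s≤s z≤n , ≤-trans (<⇒≤ lt) (≤-trans x≤v v≤n)) refl h (fits-< q))) gt x≤v H≢

    -- Free of subtraction: of the v - o nodes all have a slot except the last of each list of
    -- siblings, and there are `inner s` + 1 such lists.
    fits-tally : ∀ {o s v} → Fits (H D) o s v → v ≤ n → hull D (suc o) ≡ v → tallyH D v + (inner s + suc o)
        ≡ tallyH D o + v
    fits-tally {o} (last e) v≤n h = cong (_+ suc o) (tally-no (HSlot? D) (λ slot → slot (trans h (sym e))))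
    fits-tally {o} {leaf s} {v} (leaf e q) v≤n h with slot , h′ ← sibling-hull (s≤s z≤n , ≤-trans (<⇒≤ (fits-< q)) v≤n) e h (fits-< q) =
      arith (tallyH D v) (tallyH D (suc o)) (inner s) o v (tallyH D o) (fits-tally q v≤n h′) (tally-yes (HSlot? D) slot)
      where
      arith : ∀ a b i o v c → a + (i + suc (suc o)) ≡ b + v → b ≡ suc c → a + (i + suc o) ≡ c + v
      arith a b i o v c e refl = suc-injective (trans (lhs a i o) e)
        where
        lhs : ∀ a i o → suc (a + (i + suc o)) ≡ a + (i + suc (suc o))
        lhs = solve-∀
    fits-tally {o} {node c s} {v} (node p q) v≤n h =
      arith (tallyH D v) (tallyH D w) (tallyH D (suc o)) (tallyH D o) (inner c) (inner s) o v w
        (fits-tally p w≤n (hull-child V ia (fits-< p))) (fits-tally q v≤n (proj₂ later))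
            (tally-yes (HSlot? D) (proj₁ later))
      where
      w = H D (suc o)
      w≤n : w ≤ n
      w≤n = ≤-trans (<⇒≤ (fits-< q)) v≤n
      ia : In (suc o)
      ia = s≤s z≤n , ≤-trans (<⇒≤ (fits-< p)) w≤n
      later = sibling-hull ia refl h (fits-< q)
      arith : ∀ tv tw ta to i j o v w → tw + (i + suc (suc o)) ≡ ta + w → tv + (j + suc w) ≡ tw + v → ta ≡ suc to →
              tv + (suc (i + j) + suc o) ≡ to + v
      arith tv tw ta to i j o v w e₁ e₂ refl = +-cancelʳ-≡ (suc w + tw) _ _
        (trans (lhs tv tw i j o w) (trans (cong₂ _+_ e₁ e₂) (rhs tw to v w)))
        where
        lhs : ∀ tv tw i j o w → tv + (suc (i + j) + suc o) + (suc w + tw) ≡ (tw + (i + suc (suc o))) +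
            (tv + (j + suc w))
        lhs = solve-∀
        rhs : ∀ tw to v w → (suc to + w) + (tw + v) ≡ to + v + (suc w + tw)
        rhs = solve-∀

    -- Left behind by the preceding run: row s + 1 begins an east run with rows of length u, or row
    -- u ends a north run with rows of length s. On the diagonal the first run itself provides this
    -- (`inv-start`).
    Inv : Side → ℕ → ℕ → Set
    Inv north s u = u < n → t D (suc s) ≡ u
    Inv east  s u = 1 ≤ s → t D u ≡ s

    -- `u′` is n or the row length of the next east run. Conversely, a row reaching past u is among
    -- the first s, all of length at least `u′`.
    north-hull : ∀ {f s u u′ r es ns} → Closed D u → Fits (H D) u r u′ → (∀ {x} → u < x → x ≤ u′ → t D x ≡ s) →
                 Outer D f east s u′ es ns → hull D (suc u) ≡ u′
    north-hull {f} {s} {u} {u′} cl p g o = ≤-antisym (hull-min D (row-u′ o) (fits-< p))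
        (go (hull-row D i₀) (hull-lower D i₀))
      where
      u′≤n = outer-≤n o
      i₀ : In (suc u)
      i₀ = s≤s z≤n , ≤-trans (fits-< p) u′≤n
      row-u′ : ∀ {es ns} → Outer D f east s u′ es ns → Row D (suc u) u′
      row-u′ done = top
      row-u′ (east q h o) = subst (Row D (suc u)) (h (fits-< q) ≤-refl) (row (≤-trans (s≤s z≤n) (fits-< q) , s≤n))
        where
        s≤n : s ≤ n
        s≤n = ≤-trans (≤-reflexive (sym (g ≤-refl (fits-< p)))) (t-upper i₀)
      go : ∀ {v} → Row D (suc u) v → suc u ≤ v → u′ ≤ v
      go top _ = u′≤n
      go (arc 1≤d d<) ≤v = contradiction (cl 1≤d (s≤s⁻¹ d<)) (<⇒≱ ≤v)
      go (row {m} im) ≤v = t-sym′ (≤-trans (≤-trans (t-sym im (s≤s z≤n) ≤v) (≤-reflexive (g ≤-refl (fits-< p)))) ≤-refl)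
        where
        t-sym′ : m ≤ s → u′ ≤ t D m
        t-sym′ m≤s = outer-low o (proj₁ im) m≤s

    -- `s` is the length of row `u`. Conversely, all columns of the run are equally long, so a row
    -- containing one of them contains all.
    east-hull : ∀ {f s s′ u r es ns} → s ≤ u → t D u ≡ s → Fits (H D) s′ r s → (∀ {x} → s′ < x → x ≤ s → t D x ≡ u) →
                Outer D f north s′ u es ns → hull D (suc s′) ≡ s
    east-hull {f} {s} {s′} {u} s≤u tu≡s p g o = ≤-antisym
      (hull-min D (subst (Row D (suc s′)) tu≡s (row iu)) (fits-< p)) (go (hull-row D i₀) (hull-lower D i₀))
      where
      iu : In u
      iu = ≤-trans (s≤s z≤n) (≤-trans (fits-< p) s≤u) , outer-≤n o
      i₀ : In (suc s′)
      i₀ = s≤s z≤n , ≤-trans (fits-< p) (≤-trans s≤u (proj₂ iu))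
      go : ∀ {v} → Row D (suc s′) v → suc s′ ≤ v → s ≤ v
      go top _ = ≤-trans s≤u (proj₂ iu)
      go (arc 1≤d d<) ≤v = contradiction (proj₂ (outer-H-low o 1≤d (s≤s⁻¹ d<))) (<⇒≱ ≤v)
      go (row im) ≤v = t-sym (≤-trans (s≤s z≤n) (fits-< p) , ≤-trans s≤u (proj₂ iu)) (proj₁ im)
        (≤-trans (≤-trans (t-sym im (s≤s z≤n) ≤v) (≤-reflexive (g ≤-refl (fits-< p))))
            (≤-reflexive (sym (g (fits-< p) ≤-refl))))

    outer-slot : ∀ {f τ s u es ns x} → Outer D f τ s u es ns → s ≤ u → Closed D u → Inv τ s u →
                 Done s u x → H D x ≢ x → HSlot D x
    outer-slot done _ _ _ d _ = ⊥-elim (done-empty d)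
    outer-slot {x = x} (north {u = u} {u′} p g o) s≤u cl inv (ix , d) H≢ with d
    ... | inj₁ x≤s = outer-slot o (≤-trans s≤u (<⇒≤ (fits-< p))) (Closed-north {D} p cl)
        (λ _ → g (fits-< p) ≤-refl) (ix , inj₁ x≤s) H≢
    ... | inj₂ u<x with ≤-<-connex x u′
    ...   | inj₁ le = fits-slot p (outer-≤n o) (north-hull cl p g o) u<x le H≢
    ...   | inj₂ gt = outer-slot o (≤-trans s≤u (<⇒≤ (fits-< p))) (Closed-north {D} p cl)
        (λ _ → g (fits-< p) ≤-refl) (ix , inj₂ gt) H≢
    outer-slot {x = x} (east {s} {s′} p g o) s≤u cl inv (ix , d) H≢ with d
    ... | inj₂ u<x = outer-slot o (≤-trans (<⇒≤ (fits-< p)) s≤u) cl (λ _ → g ≤-refl (fits-< p)) (ix , inj₂ u<x) H≢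
    ... | inj₁ x≤s with ≤-<-connex x s′
    ...   | inj₁ le = outer-slot o (≤-trans (<⇒≤ (fits-< p)) s≤u) cl (λ _ → g ≤-refl (fits-< p)) (ix , inj₁ le) H≢
    ...   | inj₂ gt = fits-slot p (≤-trans s≤u (outer-≤n o)) (east-hull s≤u (inv (≤-trans (s≤s z≤n) (fits-< p)))
        p g o) gt x≤s H≢

    private
      c : ℕ → ℕ
      c x = tallyH D x + tallyT D x

    -- Free of subtraction: the slots in (0 , s] and (u , n] number as many as the nodes there, less
    -- one per list of siblings, plus one `TSlot` per north run. For north runs the last two cancel,
    -- which leaves `length es`.
    outer-tally : ∀ {f τ s u es ns} → Outer D f τ s u es ns → s ≤ u → Closed D u → Inv τ s u →
                  c n + c s + (inners es + inners ns + length es) + u ≡ c u + n + s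
    outer-tally done _ _ _ = arith (c n) n
      where
      arith : ∀ a b → a + 0 + (0 + 0 + 0) + b ≡ a + b + 0
      arith = solve-∀
    outer-tally {s = s} {u} {es} {r ∷ ns} (north {u′ = u′} p g o) s≤u cl inv =
      arith (c n) (c s) (inners es) (inner r) (inners ns) (length es) u u′ (tallyH D u) (tallyH D u′)
          (tallyT D u) (tallyT D u′) n s
        (outer-tally o (≤-trans s≤u (<⇒≤ (fits-< p))) (Closed-north {D} p cl) (λ _ → g (fits-< p) ≤-refl))
        (fits-tally p (outer-≤n o) (north-hull cl p g o)) slots≡
      where
      east-row = inv (≤-trans (fits-< p) (outer-≤n o))
      corner : TSlot D (suc u)
      corner = s≤s (≤-trans (≤-reflexive ts) s≤u) , trans (cong (λ z → suc (t D (suc z))) ts) (cong suc east-row)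
        where ts = g ≤-refl (fits-< p)
      -- Only the first row of a north run begins an addable rectangle.
      slots≡ : tallyT D u′ ≡ suc (tallyT D u)
      slots≡ = trans (tally-none (TSlot? D) (fits-< p) (λ l v (_ , e) →
        <-irrefl (trans (cong suc (sym east-row)) (trans (cong (λ z → suc (t D (suc z))) (sym (g (<⇒≤ l) v))) e)) l))
        (tally-yes (TSlot? D) corner)
      arith : ∀ A B e i m l u u′ hu hu′ tu tu′ n s → A + B + (e + m + l) + u′ ≡ hu′ + tu′ + n + s → hu′ +
          (i + suc u) ≡ hu + u′ → tu′ ≡ suc tu →
              A + B + (e + (i + m) + l) + u ≡ hu + tu + n + s
      arith A B e i m l u u′ hu hu′ tu tu′ n s e₁ e₂ refl = +-cancelʳ-≡ (suc u′) _ _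
        (trans (lhs A B e i m l u u′) (trans (cong (_+ (i + suc u)) e₁)
            (trans (mid hu′ tu n s i u) (trans (cong (_+ (suc tu + n + s)) e₂) (rhs hu u′ tu n s)))))
        where
        lhs : ∀ A B e i m l u u′ → A + B + (e + (i + m) + l) + u + suc u′ ≡ A + B + (e + m + l) + u′ + (i + suc u)
        lhs = solve-∀
        mid : ∀ hu′ tu n s i u → hu′ + suc tu + n + s + (i + suc u) ≡ hu′ + (i + suc u) + (suc tu + n + s)
        mid = solve-∀
        rhs : ∀ hu u′ tu n s → hu + u′ + (suc tu + n + s) ≡ hu + tu + n + s + suc u′
        rhs = solve-∀
    outer-tally {s = s} {u} {r ∷ es} {ns} (east {s′ = s′} p g o) s≤u cl inv =
      arith (c n) (c u) (inners es) (inner r) (inners ns) (length es) s s′ (tallyH D s) (tallyH D s′)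
          (tallyT D s) (tallyT D s′) n u
        (outer-tally o (≤-trans (<⇒≤ (fits-< p)) s≤u) cl (λ _ → g ≤-refl (fits-< p)))
        (fits-tally p (≤-trans s≤u (outer-≤n o)) (east-hull s≤u (inv (≤-trans (s≤s z≤n) (fits-< p))) p g o))
        -- Rows of an east run reach the diagonal, so none of them has a `TSlot`.
        (tally-none (TSlot? D) (<⇒≤ (fits-< p))
            (λ l v (lt , _) → <⇒≱ lt (≤-trans (≤-trans v s≤u) (≤-reflexive (sym (g l v))))))
      where
      arith : ∀ A B e i m l s s′ hs hs′ ts ts′ n u → A + (hs′ + ts′) + (e + m + l) + u ≡ B + n + s′ → hs +
          (i + suc s′) ≡ hs′ + s → ts ≡ ts′ →
              A + (hs + ts) + (i + e + m + suc l) + u ≡ B + n + s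
      arith A B e i m l s s′ hs hs′ ts ts′ n u e₁ e₂ refl = +-cancelʳ-≡ s′ _ _
        (trans (lhs A e i m l s′ hs ts u) (trans (cong (_+ (A + ts + (e + m + l) + u)) e₂)
            (trans (mid hs′ s A ts e m l u) (trans (cong (_+ s) e₁) (rhs B n s′ s)))))
        where
        lhs : ∀ A e i m l s′ hs ts u → A + (hs + ts) + (i + e + m + suc l) + u + s′ ≡ hs + (i + suc s′) +
            (A + ts + (e + m + l) + u)
        lhs = solve-∀
        mid : ∀ hs′ s A ts e m l u → hs′ + s + (A + ts + (e + m + l) + u) ≡ A + (hs′ + ts) + (e + m + l) + u + s
        mid = solve-∀
        rhs : ∀ B n s′ s → B + n + s′ + s ≡ B + n + s + s′
        rhs = solve-∀

    inv-start : ∀ {f τ p es ns} → Outer D f τ p p es ns → Inv τ p p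
    inv-start {τ = north} done          n<n = contradiction n<n (<-irrefl refl)
    inv-start {τ = north} (north q g _) _   = g ≤-refl (fits-< q)
    inv-start {τ = east}  done          ()
    inv-start {τ = east}  (east q g _)  _   = g (fits-< q) ≤-refl

    closed-start : ∀ {f τ p es ns} → Outer D f τ p p es ns → Closed D p
    closed-start o 1≤c c≤ = proj₂ (outer-H-low o 1≤c c≤)

    outer-image : ∀ {f τ p es r ns} → Outer D f τ p p es (r ∷ ns) → Image D
    outer-image {p = p} {r = r} {ns} o = record
      { leaf = λ ia → outer-slot o ≤-refl (closed-start o) (inv-start o) (all-done ia)
      ; notFull = ≤-<-trans (outer-high o p<n ≤-refl) p<n
      }
      where
      p<n : p < n
      p<n = ≤-trans (≤-trans (≤-reflexive (+-comm 1 p)) (+-monoʳ-≤ p (≤-trans (size>0 r) (m≤m+n (size r) (sizes ns)))))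
                    (≤-reflexive (sym (proj₂ (outer-sizes o))))

    outer-slots : ∀ {f τ p es ns} → Outer D f τ p p es ns → c n + (inners es + inners ns + length es) ≡ n
    outer-slots {p = p} {es} {ns} o = +-cancelʳ-≡ (c p + p) _ _
      (trans (lhs (c n) (c p) (inners es + inners ns + length es) p)
        (trans (outer-tally o ≤-refl (closed-start o) (inv-start o)) (rhs (c p) n p)))
      where
      lhs : ∀ a b k p → a + k + (b + p) ≡ a + b + k + p
      lhs = solve-∀
      rhs : ∀ b n p → b + n + p ≡ n + (b + p)
      rhs = solve-∀

  module _ {D : Data} where

    outer-low-strict : ∀ {f s u es ns} → Outer D f north s u es ns → 1 ≤ s → u < t D s
    outer-low-strict done ()
    outer-low-strict (north p _ o) 1≤s = <-≤-trans (fits-< p) (outer-low o 1≤s ≤-refl)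

    outer-high-strict : ∀ {f s u es ns} → Outer D f east s u es ns → u < n → t D (suc u) < s
    outer-high-strict done n<n = contradiction n<n (<-irrefl refl)
    outer-high-strict (east p _ o) u<n = ≤-<-trans (outer-high o ≤-refl u<n) (fits-< p)

    -- A north run cannot stop early, since the row after it is shorter than s; an east run cannot
    -- either, since the row before it is longer than u.
    outer-functional : ∀ {f f′ τ s u es es′ ns ns′} → Outer D f τ s u es ns → Outer D f′ τ s u es′ ns′ →
                       f ≡ f′ × es ≡ es′ × ns ≡ ns′
    outer-functional done done = refl , refl , refl
    outer-functional done (north p _ o) = contradiction (outer-≤n o) (<⇒≱ (fits-< p))
    outer-functional done (east p _ _)  = contradiction (fits-< p) λ ()
    outer-functional (north p _ o) done = contradiction (outer-≤n o) (<⇒≱ (fits-< p))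
    outer-functional (east p _ _) done  = contradiction (fits-< p) λ ()
    outer-functional {s = s} (north {u = u} {u′ = u₁} p g o) (north {u′ = u₂} q h o′) with <-cmp u₁ u₂
    ... | tri< lt _ _ = contradiction (h (<⇒≤ (s≤s (fits-< p))) lt)
        (<⇒≢ (outer-high-strict o (<-≤-trans lt (outer-≤n o′))))
    ... | tri> _ _ gt = contradiction (g (<⇒≤ (s≤s (fits-< q))) gt)
        (<⇒≢ (outer-high-strict o′ (<-≤-trans gt (outer-≤n o))))
    ... | tri≈ _ refl _ with a , b , e ← outer-functional o o′ = a , b , cong₂ _∷_ (fits-functional p q) e
    outer-functional {u = u} (east {s′ = s₁} p g o) (east {s′ = s₂} q h o′) with <-cmp s₁ s₂
    ... | tri< lt _ _ = contradiction (g lt (<⇒≤ (fits-< q))) (>⇒≢ (outer-low-strict o′ (≤-trans (s≤s z≤n) lt)))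
    ... | tri> _ _ gt = contradiction (h gt (<⇒≤ (fits-< p))) (>⇒≢ (outer-low-strict o (≤-trans (s≤s z≤n) gt)))
    ... | tri≈ _ refl _ with a , b , e ← outer-functional o o′ = a , cong₂ _∷_ (fits-functional p q) b , e

    -- `p` is the side of the Durfee square of `t`.
    centre-unique : ∀ {f f′ τ τ′ p p′ es es′ ns ns′} → Outer D f τ p p es ns → Outer D f′ τ′ p′ p′ es′ ns′ → p ≡ p′
    centre-unique {p = p} {p′} o o′ with <-cmp p p′
    ... | tri≈ _ e _  = e
    ... | tri< lt _ _ = contradiction (≤-trans (outer-low o′ (≤-trans (s≤s z≤n) lt) ≤-refl)
        (outer-high o lt (outer-≤n o′))) (<⇒≱ lt)
    ... | tri> _ _ gt = contradiction (≤-trans (outer-low o (≤-trans (s≤s z≤n) gt) ≤-refl)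
        (outer-high o′ gt (outer-≤n o))) (<⇒≱ gt)

    private
      sides : ∀ {f f′ p es es′ r r′ ns ns′} → Outer D f north p p es (r ∷ ns) → Outer D f′ east p p es′ (r′ ∷ ns′) → ⊥
      sides o (east q h _) = <⇒≢ (outer-low-strict o (≤-trans (s≤s z≤n) (fits-< q))) (sym (h (fits-< q) ≤-refl))

    -- A north start makes row p, if there is one, longer than p; an east start makes it exactly p
    -- long.
    side-unique : ∀ {f f′ τ τ′ p es es′ r r′ ns ns′} → Outer D f τ p p es (r ∷ ns) → Outer D f′ τ′ p p es′
        (r′ ∷ ns′) → τ ≡ τ′
    side-unique {τ = north} {north} _ _  = refl
    side-unique {τ = east}  {east}  _ _  = refl
    side-unique {τ = north} {east}  o o′ = ⊥-elim (sides o o′)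
    side-unique {τ = east}  {north} o o′ = ⊥-elim (sides o′ o)

  -- Reading the runs off an element of the image.

  module Parse {D : Data} (V : Valid D) (image : Image D) where
    open Valid V

    -- `k` bounds the v - o nodes left to read. `Image` excludes a last sibling with children, for
    -- which `Siblings` has no constructor.
    parse-siblings : ∀ k {o v} → v ≤ o + k → In (suc o) → hull D (suc o) ≡ v → ∃[ s ] Fits (H D) o s v
    parse-siblings zero {o} v≤ ia e =
      contradiction (≤-trans (hull-lower D ia)
          (≤-trans (≤-reflexive e) (≤-trans v≤ (≤-reflexive (+-identityʳ o))))) 1+n≰n
    parse-siblings (suc k) {o} {v} v≤ ia refl with hull D (suc o) ≟ H D (suc o) | H D (suc o) ≟ suc o
    ... | yes e | no ¬leaf = contradiction e (Image.leaf image ia ¬leaf)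
    ... | yes e | yes e′   = last , subst (Fits (H D) o last) (sym (trans e e′)) (last e′)
    ... | no ¬e | yes e′ =
      let h = subst (λ z → hull D (suc z) ≡ hull D (suc o)) e′ (hull-sibling V ia ¬e)
          s , q = parse-siblings k (≤-trans v≤ (≤-reflexive (+-suc o k))) (s≤s z≤n , ≤-trans (≤-trans (≤-reflexive (cong suc (sym e′))) (next≤hull V ia ¬e)) (hull-≤n D (suc o))) h
      in leaf s , leaf e′ q
    ... | no ¬e | no ¬e′ =
      let a<H = ≤∧≢⇒< (H-lower ia) (¬e′ ∘ sym)
          v≤′ = ≤-trans v≤ (≤-reflexive (+-suc o k))
          H<v = next≤hull V ia ¬e
          c , p = parse-siblings k (≤-trans (<⇒≤ H<v) v≤′) (s≤s z≤n , ≤-trans a<H (H-upper ia)) (hull-child V ia a<H)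
          s , q = parse-siblings k (≤-trans v≤′ (+-monoˡ-≤ k (<⇒≤ a<H))) (s≤s z≤n , ≤-trans H<v (hull-≤n D (suc o))) (hull-sibling V ia ¬e)
      in node c s , node p q

    record North (s u : ℕ) : Set where
      field
        s≤u     : s ≤ u
        u≤n     : u ≤ n
        closedᵘ : Closed D u
        closedˢ : Closed D s
        row-u   : u < n → t D (suc u) ≡ s
        end     : u ≡ n → s ≡ 0

    record East (s u : ℕ) : Set where
      field
        s≤u     : s ≤ u
        u≤n     : u ≤ n
        closedᵘ : Closed D u
        closedˢ : Closed D s
        row-s   : 1 ≤ s → t D s ≡ u
        row-u   : 1 ≤ s → t D u ≡ s
        end     : s ≡ 0 → u ≡ n

    module _ {s u : ℕ} (N : North s u) (u<n : u < n) where
      open North N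

      private
        u′ = hull D (suc u)
        i₀ : In (suc u)
        i₀ = s≤s z≤n , u<n
        u<u′ : u < u′
        u<u′ = hull-lower D i₀
        u′≤n : u′ ≤ n
        u′≤n = hull-≤n D (suc u)
        ts≥ : 1 ≤ s → u′ ≤ t D s
        ts≥ 1≤s = hull-min D (row is) (t-sym i₀ 1≤s (≤-reflexive (sym (row-u u<n))))
          where is = 1≤s , ≤-trans s≤u u≤n
        ts≤ : 1 ≤ s → t D s ≤ u′
        ts≤ 1≤s = go (hull-row D i₀) u<u′
          where
          is = 1≤s , ≤-trans s≤u u≤n
          go : ∀ {v} → Row D (suc u) v → suc u ≤ v → t D s ≤ v
          go top _ = t-upper is
          go (arc 1≤d d<) ≤v = contradiction (closedᵘ 1≤d (s≤s⁻¹ d<)) (<⇒≱ ≤v)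
          go (row im) ≤v = row≤ V (proj₁ im) (≤-trans (t-sym im (s≤s z≤n) ≤v) (≤-reflexive (row-u u<n))) (proj₂ is)

      north-run : ∀ {x} → u < x → x ≤ u′ → t D x ≡ s
      north-run {x} u<x x≤ = ≤-antisym (≤-trans (row≤ V (s≤s z≤n) u<x (≤-trans x≤ u′≤n))
          (≤-reflexive (row-u u<n))) (low s ts≥ s≤u)
        where
        low : ∀ s → (1 ≤ s → u′ ≤ t D s) → s ≤ u → s ≤ t D x
        low zero    _ _   = z≤n
        low (suc s) g s≤u = t-sym (s≤s z≤n , ≤-trans s≤u u≤n) (≤-trans (s≤s z≤n) u<x) (≤-trans x≤ (g (s≤s z≤n)))

      north-east : East s u′
      north-east = record
        { s≤u = ≤-trans s≤u (<⇒≤ u<u′)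
        ; u≤n = u′≤n
        ; closedᵘ = closed′
        ; closedˢ = closedˢ
        ; row-s = λ 1≤s → ≤-antisym (ts≤ 1≤s) (ts≥ 1≤s)
        ; row-u = λ _ → north-run u<u′ ≤-refl
        ; end = λ s≡0 → ≤-antisym u′≤n (go s≡0 (hull-row D i₀) u<u′)
        }
        where
        closed′ : Closed D u′
        closed′ {c} 1≤c c≤ with ≤-<-connex c u
        ... | inj₁ le = ≤-trans (closedᵘ 1≤c le) (<⇒≤ u<u′)
        ... | inj₂ gt = row-nest V i₀ (hull-row D i₀) gt c≤
        go : ∀ {v} → s ≡ 0 → Row D (suc u) v → suc u ≤ v → n ≤ v
        go _ top _ = ≤-refl
        go _ (arc 1≤d d<) ≤v = contradiction (closedᵘ 1≤d (s≤s⁻¹ d<)) (<⇒≱ ≤v)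
        go s≡0 (row im) ≤v = contradiction
            (≤-trans (proj₁ im) (≤-trans (t-sym im (s≤s z≤n) ≤v) (≤-reflexive (trans (row-u u<n) s≡0)))) λ ()

    module _ {s u : ℕ} (E : East s u) (1≤s : 1 ≤ s) where
      open East E

      private
        is : In s
        is = 1≤s , ≤-trans s≤u u≤n
        iu : In u
        iu = ≤-trans 1≤s s≤u , u≤n

      east-step : ∃[ s′ ] s′ < s × North s′ u × (∀ {x} → s′ < x → x ≤ s → t D x ≡ u) × hull D (suc s′) ≡ s
      east-step with u <? n
      -- Further in, rows are longer than u: these are the rows that meet column u + 1,
      -- `t D (suc u)` in number. For u = n there are none, and the run extends down to 0.
      ... | yes u<n = s′ , s′<s , record
            { s≤u = ≤-trans (<⇒≤ s′<s) s≤u ; u≤n = u≤n ; closedᵘ = closedᵘ ; closedˢ = closed′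
            ; row-u = λ _ → refl ; end = λ u≡n → contradiction u≡n (<⇒≢ u<n) }
            , run , ≤-antisym (hull-min D (subst (Row D (suc s′)) (row-u 1≤s) (row iu)) s′<s)
                (go (hull-row D i₀) (hull-lower D i₀))
        where
        s′ = t D (suc u)
        iu′ : In (suc u)
        iu′ = s≤s z≤n , u<n
        s′<s : s′ < s
        s′<s = ≰⇒> λ s≤ → 1+n≰n (≤-trans (t-sym iu′ 1≤s s≤) (≤-reflexive (row-s 1≤s)))
        closed′ : Closed D s′
        closed′ 1≤c c≤ = t-nest iu′ 1≤c c≤
        run : ∀ {x} → s′ < x → x ≤ s → t D x ≡ u
        run {x} s′<x x≤s = ≤-antisym (≮⇒≥ λ u<t → <⇒≱ s′<x
            (t-sym (≤-trans (s≤s z≤n) s′<x , ≤-trans x≤s (proj₂ is)) (s≤s z≤n) u<t))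
          (≤-trans (≤-reflexive (sym (row-s 1≤s))) (row≤ V (≤-trans (s≤s z≤n) s′<x) x≤s (proj₂ is)))
        i₀ : In (suc s′)
        i₀ = s≤s z≤n , ≤-trans s′<s (proj₂ is)
        go : ∀ {v} → Row D (suc s′) v → suc s′ ≤ v → s ≤ v
        go top _ = proj₂ is
        go (arc 1≤d d<) ≤v = contradiction (closed′ 1≤d (s≤s⁻¹ d<)) (<⇒≱ ≤v)
        go (row im) ≤v = t-sym is (proj₁ im)
            (≤-trans (t-sym im (s≤s z≤n) ≤v) (≤-reflexive (trans (run ≤-refl s′<s) (sym (row-s 1≤s)))))
      ... | no u≮n = 0 , 1≤s , record
            { s≤u = z≤n ; u≤n = u≤n ; closedᵘ = closedᵘ ; closedˢ = λ 1≤c c≤0 → contradiction (≤-trans 1≤c c≤0) λ ()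
            ; row-u = λ u<n → contradiction u<n u≮n ; end = λ _ → refl }
            , run , ≤-antisym (hull-min D (subst (Row D 1) (row-u 1≤s) (row iu)) 1≤s)
                (go (hull-row D i₀) (hull-lower D i₀))
        where
        u≡n : u ≡ n
        u≡n = ≤-antisym u≤n (≮⇒≥ u≮n)
        run : ∀ {x} → 0 < x → x ≤ s → t D x ≡ u
        run {x} 0<x x≤s = ≤-antisym (≤-trans (t-upper (0<x , ≤-trans x≤s (proj₂ is))) (≤-reflexive (sym u≡n)))
          (≤-trans (≤-reflexive (sym (row-s 1≤s))) (row≤ V 0<x x≤s (proj₂ is)))
        i₀ : In 1
        i₀ = s≤s z≤n , ≤-trans 1≤s (proj₂ is)
        go : ∀ {v} → Row D 1 v → 1 ≤ v → s ≤ v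
        go top _ = proj₂ is
        go (arc 1≤d d<) ≤v = contradiction (≤-trans 1≤d (s≤s⁻¹ d<)) λ ()
        go (row im) ≤v = t-sym is (proj₁ im)
            (≤-trans (t-sym im (s≤s z≤n) ≤v) (≤-reflexive (trans (run ≤-refl 1≤s) (sym (row-s 1≤s)))))

    mutual

      -- `k` bounds (n - u) + s, the number of nodes not yet read; each run reads at least one.
      parse-north : ∀ k {s u} → n + s ≤ k + u → North s u → ∃[ f ] ∃[ es ] ∃[ ns ] Outer D f north s u es ns
      parse-north k {s} {u} fuel N with u ≟ n
      ... | yes refl with refl ← North.end N refl = north , [] , [] , done
      parse-north zero {s} {u} fuel N | no u≢n =
        contradiction (≤-antisym (North.u≤n N) (≤-trans (m≤m+n n s) fuel)) u≢n
      parse-north (suc k) {s} {u} fuel N | no u≢n =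
        let u<n = ≤∧≢⇒< (North.u≤n N) u≢n
            i₀ = s≤s z≤n , u<n
            r , p = parse-siblings (hull D (suc u)) (m≤n+m (hull D (suc u)) u) i₀ refl
            f , es , ns , o = parse-east k (≤-trans fuel (≤-trans (≤-reflexive (sym (+-suc k u))) (+-monoʳ-≤ k (hull-lower D i₀)))) (north-east N u<n)
        in f , es , r ∷ ns , north p (north-run N u<n) o

      parse-east : ∀ k {s u} → n + s ≤ k + u → East s u → ∃[ f ] ∃[ es ] ∃[ ns ] Outer D f east s u es ns
      parse-east k {zero} {u} fuel E with refl ← East.end E refl = east , [] , [] , done
      parse-east zero {suc s} {u} fuel E =
        contradiction (≤-trans (≤-trans (≤-reflexive (+-comm 1 n)) (+-monoʳ-≤ n (s≤s z≤n)))
            (≤-trans fuel (East.u≤n E))) 1+n≰n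
      parse-east (suc k) {suc s} {u} fuel E =
        let s′ , s′<s , N , run , h = east-step E (s≤s z≤n)
            r , p = parse-siblings (suc s) (m≤n+m (suc s) s′) (s≤s z≤n , ≤-trans s′<s (≤-trans (East.s≤u E) (East.u≤n E))) h
            f , es , ns , o = parse-north k (s≤s⁻¹ (≤-trans (≤-trans (≤-reflexive (sym (+-suc n s′))) (+-monoʳ-≤ n s′<s)) fuel)) N
        in f , r ∷ es , ns , east p run o

    private
      nonempty : ∀ {p} → p < n → (∃[ τ ] ∃[ f ] ∃[ es ] ∃[ ns ] Outer D f τ p p es ns) →
                 ∃[ p ] ∃[ f ] ∃[ τ ] ∃[ es ] ∃[ r ] ∃[ ns ] Outer D f τ p p es (r ∷ ns)
      nonempty {p} p<n (τ , f , es , []     , o) = contradiction (trans (proj₂ (outer-sizes o)) (+-identityʳ p))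
          (>⇒≢ p<n)
      nonempty {p} p<n (τ , f , es , r ∷ ns , o) = p , f , τ , es , r , ns , o

    -- The walk starts at the corner of the Durfee square. `notFull` places it before n, so at least
    -- one north run follows, the head of `Runs`.
    parse : 1 ≤ n → ∃[ p ] ∃[ f ] ∃[ τ ] ∃[ es ] ∃[ r ] ∃[ ns ] Outer D f τ p p es (r ∷ ns)
    parse 1≤n with greatest (λ a → a ≤? t D a) n
    ... | inj₂ none = nonempty 1≤n (north , parse-north n (≤-reflexive refl) record
          { s≤u = z≤n ; u≤n = z≤n ; closedᵘ = none₀ ; closedˢ = none₀
          ; row-u = λ _ → n≤0⇒n≡0 (s≤s⁻¹ (≰⇒> (none (s≤s z≤n) 1≤n))) ; end = λ _ → refl })
      where
      none₀ : Closed D 0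
      none₀ 1≤c c≤0 = contradiction (≤-trans 1≤c c≤0) λ ()
    ... | inj₁ (p , ip , p≤t , max) = nonempty p<n runs-at-p
      where
      p<n : p < n
      p<n = ≤∧≢⇒< (proj₂ ip) λ { refl → <⇒≱ (Image.notFull image) p≤t }
      runs-at-p : ∃[ τ ] ∃[ f ] ∃[ es ] ∃[ ns ] Outer D f τ p p es ns
      runs-at-p with m≤n⇒m<n∨m≡n p≤t
      ... | inj₂ e = east , parse-east n ≤-refl record
            { s≤u = ≤-refl ; u≤n = proj₂ ip ; closedᵘ = cl ; closedˢ = cl
            ; row-s = λ _ → sym e ; row-u = λ _ → sym e ; end = λ { refl → contradiction (proj₁ ip) λ () } }
        where
        cl : Closed D p
        cl {c} 1≤c c≤ = subst (H D c ≤_) (sym e) (t-nest ip 1≤c (≤-trans c≤ (≤-reflexive e)))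
      ... | inj₁ lt = north , parse-north n ≤-refl record
            { s≤u = ≤-refl ; u≤n = proj₂ ip ; closedᵘ = cl ; closedˢ = cl
            ; row-u = λ _ → e ; end = λ { refl → contradiction p<n (<-irrefl refl) } }
        where
        i′ : In (suc p)
        i′ = s≤s z≤n , p<n
        e : t D (suc p) ≡ p
        e = ≤-antisym (s≤s⁻¹ (≰⇒> (max ≤-refl p<n))) (t-sym ip (s≤s z≤n) lt)
        cl : Closed D p
        cl {c} 1≤c c≤ = subst (H D c ≤_) e (t-nest i′ 1≤c (≤-trans c≤ (≤-reflexive (sym e))))

-- The bijection between the image and the balanced codes.

module Count (n N : ℕ) (n≡ : suc N ≡ n) where
  open Analysis n

  private
    1≤n : 1 ≤ n
    1≤n = subst (1 ≤_) n≡ (s≤s z≤n)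

  data Reads (D : Data) (c : Code) : Set where
    reads : ∀ {p} → Outer D (outer c) (centre c) p p (easts (build (steps c)))
        (head (build (steps c)) ∷ norths (build (steps c))) →
            Reads D c

  slots-count : ∀ {x c} → Tamari x → Reads (encode x) c → length (upperCovers n x) + #rise (steps c) ≡ n
  slots-count {x} {c} tx (reads o) =
    trans (cong₂ _+_ (trans (length-upperCovers tx) (cong₂ _+_ (length-oneTo (HSlot? (encode x)) n)
        (length-oneTo (TSlot? (encode x)) n)))
                     (sym (rank-build (steps c))))
          (outer-slots (encode-valid tx) o)

  reads-image : ∀ {x c} → Tamari x → Reads (encode x) c → Image (encode x)
  reads-image tx (reads o) = outer-image (encode-valid tx) o

  private
    balance : ∀ τ a b u d k → a + u ≡ d + b → suc (a + k) ≡ b + northᵇ τ → u ≡ d + (k + eastᵇ τ)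
    balance τ a b u d k e₁ e₂ = +-cancelʳ-≡ (a + (b + northᵇ τ)) _ _
      (trans (lhs a b u (northᵇ τ)) (trans (cong₂ (λ x y → x + y) e₁ (sym e₂)) (rhs τ)))
      where
      lhs : ∀ a b u x → u + (a + (b + x)) ≡ a + u + (b + x)
      lhs = solve-∀
      rhs : ∀ τ → d + b + suc (a + k) ≡ d + (k + eastᵇ τ) + (a + (b + northᵇ τ))
      rhs east  = r d b a k
        where
        r : ∀ d b a k → d + b + suc (a + k) ≡ d + (k + 1) + (a + (b + 0))
        r = solve-∀
      rhs north = r d b a k
        where
        r : ∀ d b a k → d + b + suc (a + k) ≡ d + (k + 0) + (a + (b + 1))
        r = solve-∀

    unbalance : ∀ τ a b u d k → a + u ≡ d + b → u ≡ d + (k + eastᵇ τ) → suc (a + k) ≡ b + northᵇ τ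
    unbalance τ a b u d k e₁ refl = +-cancelˡ-≡ d _ _
        (trans (lhs τ) (trans (cong (_+ northᵇ τ) e₁) (+-assoc d b (northᵇ τ))))
      where
      lhs : ∀ τ → d + suc (a + k) ≡ a + (d + (k + eastᵇ τ)) + northᵇ τ
      lhs east  = r d a k
        where
        r : ∀ d a k → d + suc (a + k) ≡ a + (d + (k + 1)) + 0
        r = solve-∀
      lhs north = r d a k
        where
        r : ∀ d a k → d + suc (a + k) ≡ a + (d + (k + 0)) + 1
        r = solve-∀

  -- Compares the alternation of the runs (`outer-balance`) with the numbers of runs that the word
  -- builds (`balance-build`).
  reads-balance : ∀ {D c} → Reads D c → #rise (steps c) ≡ #down c
  reads-balance {c = code v f τ} (reads o) =
    balance τ (length (norths (build v))) (length (easts (build v))) (#rise v) (#fall v) (northᵇ f)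
      (balance-build v) (outer-balance o)

  reads-≈ : ∀ {D E c} → D ≈ E → Reads D c → Reads E c
  reads-≈ (l , l′) (reads o) = reads (outer-cong ≤-refl
    (λ (ix , _) → ≤-antisym (H-mono l ix) (H-mono l′ ix) , ≤-antisym (t-mono l ix) (t-mono l′ ix)) o)

  code-reads : ∀ {c k} → c ∈ codes N → #rise (steps c) ≡ k → #down c ≡ k → ∃[ D ] Valid D × Reads D c
  code-reads {code v f τ} {k} c∈ e₁ e₂
    with D , o ← realise-runs f τ (sizes (easts (build v))) (easts (build v)) (head (build v) ∷ norths (build v)) ≤-refl (sym (trans (weight-build v) (trans (cong suc (∈-codes⁻ N c∈)) n≡)))
                   (unbalance τ (length (norths (build v))) (length (easts (build v))) (#rise v) (#fall v)
                       (northᵇ f) (balance-build v) (trans e₁ (sym e₂))) =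
    D , outer-valid o , reads o

  image-reads : ∀ {D} → Valid D → Image D → ∃[ c ] c ∈ codes N × Reads D c
  image-reads {D} V image
    with p , f , τ , es , r , ns , o ← Parse.parse V image 1≤n
    with v , l , b ← build-surjective N (runs es r ns)
           (trans (cong (_+ (size r + sizes ns)) (sym (proj₁ (outer-sizes o))))
               (trans (sym (proj₂ (outer-sizes o))) (sym n≡))) =
    code v f τ , subst (λ k → code v f τ ∈ codes k) l (∈-codes⁺ v f τ) ,
    reads (subst (λ R → Outer D f τ p p (easts R) (head R ∷ norths R)) (sym b) o)

  reads-injective : ∀ {D D′ c} → Reads D c → Reads D′ c → D ≈ D′
  reads-injective {D} {D′} (reads o) (reads o′) with refl ← trans (proj₁ (outer-sizes o)) (sym (proj₁ (outer-sizes o′))) =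
    ((λ ix → ≤-reflexive (proj₁ (eq ix))) , (λ ix → ≤-reflexive (proj₂ (eq ix)))) ,
    ((λ ix → ≤-reflexive (sym (proj₁ (eq ix)))) , (λ ix → ≤-reflexive (sym (proj₂ (eq ix)))))
    where
    eq : ∀ {x} → In x → H D x ≡ H D′ x × t D x ≡ t D′ x
    eq ix = outer-agree o o′ (all-done ix)

  reads-functional : ∀ {D c c′} → Reads D c → Reads D c′ → c ≡ c′
  reads-functional {c = code v f τ} {code v′ f′ τ′} (reads o) (reads o′)
    with refl ← centre-unique o o′
    with refl ← side-unique o o′
    with refl , a , b ← outer-functional o o′ =
    cong (λ v → code v f τ) (build-injective v v′ (glue (build v) (build v′) a b))
    where
    glue : ∀ r r′ → easts r ≡ easts r′ → head r ∷ norths r ≡ head r′ ∷ norths r′ → r ≡ r′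
    glue (runs _ _ _) (runs _ _ _) refl refl = refl

  inImage : ℕ → List ℕ → Bool
  inImage j b = inPopImage n b ∧ (length (upperCovers n b) ≡ᵇ j)

  member : ∀ {j x} → x ∈ filterᵇ (inImage j) (Tam n) →
           Σ (Tamari x) λ tx → ∃[ c ] c ∈ codes N × Reads (encode x) c × j + #rise (steps c) ≡ n
  member {j} {x} x∈ =
    let x∈T , q = ∈-filter⁻ (T? ∘ inImage j) {xs = Tam n} x∈
        tx = tamari⁻ x∈T
        im , u = to (T-∧ {inPopImage n x}) q
        c , c∈ , r = image-reads (encode-valid tx) (inPopImage⁻ 1≤n tx im)
    in tx , c , c∈ , r , trans (cong (_+ #rise (steps c)) (sym (≡ᵇ⇒≡ (length (upperCovers n x)) j u))) (slots-count tx r)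

  -- By `slots-count`, j upper covers mean n - j rises, and by `reads-balance` as many falls.
  popCoeff-codes : ∀ {j} → j ≤ n → popCoeff n j ≡ codes-with N (n ∸ j) (n ∸ j)
  popCoeff-codes {j} j≤n = length-bijection (λ x c → Reads (encode x) c)
    (Unique.filter⁺ (T? ∘ inImage j) Tam-unique) (Unique.filter⁺ (T? ∘ hasStats k k) (codes-unique N))
    (λ x∈ → let tx , c , c∈ , r , e = member x∈
                e′ = trans (sym (m+n∸m≡n j _)) (cong (_∸ j) e) in
      c , ∈-filter⁺ (T? ∘ hasStats k k) c∈ (from T-∧ (≡⇒≡ᵇ _ k e′ , ≡⇒≡ᵇ _ k (trans (sym (reads-balance r)) e′))) , r)
    (λ {c} c∈ → let c∈′ , q = ∈-filter⁻ (T? ∘ hasStats k k) {xs = codes N} c∈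
                    e₁ , e₂ = to (T-∧ {#rise (steps c) ≡ᵇ k}) q
                    e = ≡ᵇ⇒≡ (#rise (steps c)) k e₁
                    D , V , r = code-reads c∈′ e (≡ᵇ⇒≡ (#down c) k e₂)
                    x , tx , l , l′ = realise V
                    r′ = reads-≈ (l′ , l) r in
      x , ∈-filter⁺ (T? ∘ inImage j) (tamari⁺ tx)
            (from T-∧ (inPopImage⁺ tx (reads-image tx r′) ,
                       ≡⇒≡ᵇ (length (upperCovers n x)) j (+-cancelʳ-≡ k _ _
                         (trans (cong (length (upperCovers n x) +_) (sym e))
                             (trans (slots-count tx r′) (sym (m+[n∸m]≡n j≤n))))))) ,
      r′)
    (λ x∈ x′∈ r r′ → let l , l′ = reads-injective r r′ in ⊑-antisym-perm (proj₁ (member x∈)) (proj₁ (member x′∈)) l l′)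
    (λ _ _ r r′ → reads-functional r r′)
    where
    k = n ∸ j

  popCoeff-zero : ∀ {j} → n < j → popCoeff n j ≡ 0
  popCoeff-zero {j} n<j = n≤0⇒n≡0 (length-≤ {B = ℕ} (λ _ _ → ⊥) {ys = []} (Unique.filter⁺ (T? ∘ inImage j) Tam-unique)
    (λ x∈ → let _ , _ , _ , _ , e = member x∈ in contradiction (≤-trans (m≤m+n j _) (≤-reflexive e)) (<⇒≱ n<j)) (λ _ _ ()))

  coefficient : ∀ j → popCoeff n j ≡ rhsCoeff n j
  coefficient j with ≤-<-connex j n
  ... | inj₂ n<j = trans (popCoeff-zero n<j) (sym (sum-none e g (upTo (suc n)) λ {k} _ q →
          <⇒≱ n<j (≤-trans (≤-reflexive (sym (≡ᵇ⇒≡ (n ∸ k) j q))) (m∸n≤m n k))))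
    where
    e : ℕ → Bool
    e k = (n ∸ k) ≡ᵇ j
    g : ℕ → ℕ
    g k = ((n ∸ 1) C k) * ((n ∸ k + 1) C k)
  ... | inj₁ j≤n = trans (popCoeff-codes j≤n) (trans (codes-count N k k) (trans
          -- With n = N + 1, the index 2 + N - k from `codes-count` is n - k + 1.
          (cong₂ (λ a b → (a C k) * (b C k)) (cong (_∸ 1) n≡)
            (trans (cong (λ m → suc m ∸ k) n≡) (trans (+-∸-assoc 1 (m∸n≤m n j)) (+-comm 1 (n ∸ k)))))
          (sym (sum-single e g (upTo (suc n)) (Unique.upTo⁺ (suc n)) (∈-upTo⁺ (s≤s (m∸n≤m n j)))
            (≡⇒≡ᵇ (n ∸ k) j (m∸[m∸n]≡n j≤n))
            (λ {i} i∈ q → trans (sym (m∸[m∸n]≡n (s≤s⁻¹ (∈-upTo⁻ i∈)))) (cong (n ∸_) (≡ᵇ⇒≡ (n ∸ i) j q)))))))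
    where
    k = n ∸ j
    e : ℕ → Bool
    e k = (n ∸ k) ≡ᵇ j
    g : ℕ → ℕ
    g k = ((n ∸ 1) C k) * ((n ∸ k + 1) C k)

mainTheorem2 : (n : ℕ) → 1 ≤ n → (j : ℕ) → popCoeff n j ≡ rhsCoeff n j
mainTheorem2 (suc N) _ j = Count.coefficient (suc N) N refl j
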